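{- Let $V_1,V_2$ be disjoint finite sets with $|V_1|=p$, $|V_2|=q$, $(p,q)\neq(0,0)$, and write $n=p+q$. (1) If $p\ge1$, then $\sum_{v\in V_1}\mu(m_v,\hat1)=(-1)^{n-1}\frac{(n-1)!}{(p-1)!}\,n^{p-1}$. Equivalently, when $n\ge2$, the sum over $v\in V_1$ of the dimensions of the unique nonvanishing reduced homology groups of the maximal intervals $[m_v,\hat1]$ equals $\frac{(n-1)!}{(p-1)!}n^{p-1}$. (2) If $p\ge1$, then the Möbius number of $\widehat\Pi(V_1,V_2)$ is $\mu(\hat0,\hat1)=(-1)^{n}\frac{(n-1)!}{(p-1)!}(n-1)^{p-1}$ (with $0^0=1$). Equivalently, the dimension of the unique nonvanishing reduced homology group of $\widehat\Pi(V_1,V_2)$ is $\frac{(n-1)!}{(p-1)!}(n-1)^{p-1}$. (3) The sum over all minimal elements $m$ of $\Pi(V_1,V_2)$ of $\mu(m,\hat1)$ equals $(-1)^{n-1}\frac{(n-1)!}{p!}\,n^{p}$. Equivalently, when $n\ge2$, the sum of the dimensions of the unique nonvanishing reduced homology groups of all maximal intervals of $\Pi(V_1,V_2)$ is $\frac{(n-1)!}{p!}n^p$.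
   Context: Let $V_1,V_2$ be disjoint finite sets, $V=V_1\sqcup V_2$. A semi-pointed partition of $(V_1,V_2)$ is a set partition of $V$ into nonempty blocks in which each block $B$ is either unpointed or pointed at one chosen element of $B\cap V_1$, subject to: a block contained in $V_1$ must be pointed, and a block contained in $V_2$ must be unpointed. $\Pi(V_1,V_2)$ is the set of semi-pointed partitions, ordered by: $P\le Q$ iff every block $b$ of $P$ is a union $q_1\cup\dots\cup q_r$ of blocks of $Q$, and if $b$ is pointed at $e$ then some $q_i$ is pointed at $e$, while if $b$ is unpointed then some $q_i$ is unpointed. Its greatest element $\hat1$ is the partition into singletons. Its minimal elements are $m_v$, $v\in V_1$ (the block $V$ pointed at $v$), and, if $V_2\neq\emptyset$, $m_\times$ (the unpointed block $V$). The maximal intervals are $[m,\hat1]$ for $m$ minimal. $\widehat\Pi(V_1,V_2)$ is $\Pi(V_1,V_2)$ with a new least element $\hat0$ adjoined. $\mu$ is the Möbius function. The homology of a bounded poset means the reduced homology over $\mathbb C$ of the order complex of its proper part. These posets are Cohen–Macaulay, so this homology is concentrated in one degree. -}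

module Defs where

open import Algebra.Apartness.Bundles using (HeytingField; HeytingCommutativeRing)
open import Algebra.Bundles using (CommutativeRing; Semiring)
import Algebra.Definitions.RawMonoid as RawMonoidDefs
import Algebra.Definitions.RawSemiring as RawSemiringDefs
open import Data.Bool.Base using (true; false)
open import Data.Bool.Properties using () renaming (_≟_ to _≟ᵇ_)
open import Data.Fin.Base using (Fin; toℕ; splitAt; _↑ˡ_; _↑ʳ_)
open import Data.Fin.Induction using (spo-wellFounded)
open import Data.Fin.Properties using (all?; any?; splitAt⁻¹-↑ˡ; splitAt⁻¹-↑ʳ)
  renaming (_≟_ to _≟ᶠ_)
open import Data.Fin.Subset using (Subset; _∈_; _⊆_; ⁅_⁆)
  renaming (⊤ to full; ⊥ to empty)
open import Data.Fin.Subset.Properties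
  using (_∈?_; _⊆?_; ⊆-antisym; ∈⊤; ∉⊥; x∈⁅x⁆; x∈⁅y⁆⇒x≡y)
open import Data.Integer.Base using (ℤ; 0ℤ; 1ℤ) renaming (_+_ to _+ℤ_; -_ to -ℤ_)
open import Data.List.Base using
  (List; []; _∷_; map; foldr; filter; mapMaybe; deduplicate; allFin; cartesianProductWith; lookup)
open import Data.List.Membership.Propositional using () renaming (_∈_ to _∈ₗ_)
open import Data.List.Membership.Propositional.Properties
  using (∈-map⁺; ∈-allFin; ∈-cartesianProductWith⁺; ∈-deduplicate⁺)
import Data.List.Relation.Unary.All as ListAll
import Data.List.Relation.Unary.All.Properties as ListAllₚ
open import Data.List.Relation.Unary.Any using (here; there; index)
import Data.List.Relation.Unary.Any as Any
import Data.List.Relation.Unary.Any.Properties as Anyₚ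
open import Data.List.Relation.Unary.AllPairs using ([]; _∷_)
open import Data.List.Relation.Unary.Enumerates.Setoid using (IsEnumeration)
open import Data.List.Relation.Unary.Unique.Propositional using (Unique)
import Data.List.Relation.Unary.Unique.Propositional.Properties as Uniqueₚ
import Data.List.Relation.Unary.Unique.DecPropositional.Properties as DecUniqueₚ
open import Data.Maybe.Base using (Maybe; just; nothing)
import Data.Maybe.Properties as Maybeₚ
import Data.Maybe.Relation.Unary.Any as MAny
open import Data.Nat.Base using (ℕ; zero; suc; _+_)
open import Data.Product.Base using (Σ; Σ-syntax; ∃-syntax; _×_; _,_; proj₁; proj₂)
open import Data.Sum.Base using (inj₁; inj₂; [_,_]′)
open import Data.Unit.Polymorphic.Base using (⊤)
open import Data.Vec.Base as Vec using (Vec; []; _∷_; _++_; insertAt; replicate; tabulate)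
import Data.Vec.Properties as Vecₚ
import Data.Vec.Relation.Unary.All as VecAll
import Data.Vec.Relation.Unary.AllPairs as VecAllPairs
open import Function.Base using (_∘_; id; const)
open import Induction.WellFounded using (WellFounded; Acc; acc; module Subrelation)
open import Level using (Level; 0ℓ; _⊔_)
open import Relation.Binary.Core using (Rel)
import Relation.Binary.Construct.Add.Infimum.NonStrict as AddInfimum
import Relation.Binary.Construct.NonStrictToStrict as ToStrict
import Relation.Binary.Construct.On as On
open import Relation.Binary.Definitions using (Decidable; DecidableEquality)
open import Relation.Binary.PropositionalEquality
  using (_≡_; _≢_; refl; sym; trans; cong; cong₂; subst; subst₂; setoid; isEquivalence; resp₂)
open import Relation.Binary.Structures
  using (IsPartialOrder; IsDecPartialOrder; IsStrictPartialOrder)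
open import Relation.Nullary.Construct.Add.Infimum using (_₋; ⊥₋; [_]; []-injective)
open import Relation.Nullary.Decidable
  using (Dec; yes; no; map′; _×-dec_; _→-dec_; ¬?; recompute; dec⇒maybe)
open import Relation.Nullary.Negation using (¬_; contradiction)

record FinitePoset : Set₁ where
  infix 4 _≤_
  field
    Carrier           : Set
    _≤_               : Rel Carrier 0ℓ
    isDecPartialOrder : IsDecPartialOrder _≡_ _≤_
    elements          : List Carrier
    complete          : IsEnumeration (setoid Carrier) elements
    unique            : Unique elements

  open IsDecPartialOrder isDecPartialOrder public
    using (isPartialOrder; _≟_; _≤?_)
    renaming (refl to ≤-refl; trans to ≤-trans; antisym to ≤-antisym)

  open ToStrict _≡_ _≤_ public using (_<_; <-decidable)

  infix 4 _<?_
  _<?_ : Decidable _<_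
  _<?_ = <-decidable _≟_ _≤?_

  <-isStrictPartialOrder : IsStrictPartialOrder _≡_ _<_
  <-isStrictPartialOrder = ToStrict.<-isStrictPartialOrder _≡_ _≤_ isPartialOrder

  Minimal : Carrier → Set
  Minimal x = ∀ y → y ≤ x → y ≡ x

  minimal? : ∀ x → Dec (Minimal x)
  minimal? x = map′ (λ all y → ListAll.lookup all (complete y))
                    (λ min → ListAll.universal min elements)
                    (ListAll.all? (λ y → (y ≤? x) →-dec (y ≟ x)) elements)

  minimals : List Carrier
  minimals = filter minimal? elements

  <-wellFounded : WellFounded _<_
  <-wellFounded = Subrelation.wellFounded into (On.wellFounded position positions-wf)
    where
    position : Carrier → Fin _
    position x = index (complete x)

    lookup-position : ∀ x → x ≡ lookup elements (position x)
    lookup-position x = Anyₚ.lookup-index (complete x)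

    open IsStrictPartialOrder <-isStrictPartialOrder using (irrefl) renaming (trans to <-trans)

    positions-wf : WellFounded (λ i j → lookup elements i < lookup elements j)
    positions-wf = spo-wellFounded record
      { isEquivalence = isEquivalence
      ; irrefl        = λ i≡j → irrefl (cong (lookup elements) i≡j)
      ; trans         = <-trans
      ; <-resp-≈      = resp₂ _
      }

    into : ∀ {x y} → x < y → lookup elements (position x) < lookup elements (position y)
    into {x} {y} = subst₂ _<_ (lookup-position x) (lookup-position y)

sumℤ : List ℤ → ℤ
sumℤ = foldr _+ℤ_ 0ℤ

module _ (P : FinitePoset) where
  open FinitePoset P

  -- μ(x,x) = 1 and μ(x,y) = - Σ_{x ≤ z < y} μ(x,z); if x ≰ y the sum is empty, so μ(x,y) = 0.
  μ-acc : (x y : Carrier) → Acc _<_ y → ℤ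
  μ-acc x y (acc below) with x ≟ y
  ... | yes _ = 1ℤ
  ... | no  _ = -ℤ sumℤ (map (λ z → term z (x ≤? z) (z <? y)) elements)
    where
    term : ∀ z → Dec (x ≤ z) → Dec (z < y) → ℤ
    term z (yes _) (yes z<y) = μ-acc x z (below z<y)
    term z _       _         = 0ℤ

  μ : (x y : Carrier) → ℤ
  μ x y = μ-acc x y (<-wellFounded y)

withBottom : FinitePoset → FinitePoset
withBottom P = record
  { Carrier           = Carrier ₋
  ; _≤_               = AddInfimum._≤₋_ _≤_
  ; isDecPartialOrder = AddInfimum.≤₋-isDecPartialOrder-≡ _≤_ isDecPartialOrder
  ; elements          = ⊥₋ ∷ map [_] elements
  ; complete          = λ { ⊥₋ → here refl ; [ x ] → there (∈-map⁺ [_] (complete x)) }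
  ; unique            = ListAllₚ.map⁺ (ListAll.universal (λ _ ()) elements)
                        ∷ Uniqueₚ.map⁺ []-injective unique
  }
  where open FinitePoset P

CharacteristicZero : ∀ {c ℓ₁ ℓ₂} → HeytingField c ℓ₁ ℓ₂ → Set ℓ₂
CharacteristicZero K = ∀ m → (suc m · 1#) # 0#
  where
  open HeytingField K
  open CommutativeRing (HeytingCommutativeRing.commutativeRing heytingCommutativeRing)
    using (+-rawMonoid)
  open RawMonoidDefs +-rawMonoid using () renaming (_×_ to _·_)

-- Reduced homology with coefficients in K of the order complex of the open interval (a , b),
-- i.e. of the proper part of the bounded poset [a , b].
module Homology {c ℓ₁ ℓ₂} (K : HeytingField c ℓ₁ ℓ₂)
                (P : FinitePoset) (a b : FinitePoset.Carrier P) where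

  open FinitePoset P using (elements; _<_) renaming (Carrier to X)
  open HeytingField K using (heytingCommutativeRing)
  open CommutativeRing (HeytingCommutativeRing.commutativeRing heytingCommutativeRing)
    using (_≈_; _*_; -_; 0#; 1#; +-rawMonoid; semiring)
    renaming (Carrier to 𝕜; _+_ to _⊕_)
  open RawMonoidDefs +-rawMonoid using (sum)
  open RawSemiringDefs (Semiring.rawSemiring semiring) using (_^_)

  -- The faces of the order complex, listed increasingly. They are indexed by their number of
  -- vertices, so that k corresponds to homological degree k - 1 and k = 0 to the empty face.
  Face : ∀ {k} → Vec X k → Set
  Face zs = VecAll.All (λ z → a < z × z < b) zs × VecAllPairs.AllPairs _<_ zs

  record Chain (k : ℕ) : Set (c ⊔ ℓ₁) where
    field
      coeff   : Vec X k → 𝕜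
      support : ∀ zs → ¬ Face zs → coeff zs ≈ 0#

  open Chain public

  -- The coefficient at zs of the boundary of Σ f(ws) ws, where
  -- ∂(w₀ < ⋯ < w_k) = Σ_j (-1)^j (w₀ < ⋯ ŵ_j ⋯ < w_k):
  -- the ws whose j-th face is zs arise by inserting an element at position j.
  ∂ : ∀ {k} → (Vec X (suc k) → 𝕜) → Vec X k → 𝕜
  ∂ {k} f zs = sum {suc k} λ j →
    (- 1#) ^ toℕ j * foldr _⊕_ 0# (map (λ z → f (insertAt zs j z)) elements)

  IsCycle : ∀ {k} → Chain k → Set ℓ₁
  IsCycle {zero}  f = ⊤
  IsCycle {suc k} f = ∀ zs → ∂ (coeff f) zs ≈ 0#

  Cycle : ℕ → Set (c ⊔ ℓ₁)
  Cycle k = Σ (Chain k) IsCycle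

  infix 4 _∼_
  _∼_ : ∀ {k} → (f g : Vec X k → 𝕜) → Set (c ⊔ ℓ₁)
  _∼_ {k} f g = Σ[ h ∈ Chain (suc k) ] (∀ zs → f zs ≈ g zs ⊕ ∂ (coeff h) zs)

  combination : ∀ {k m} → (Fin m → 𝕜) → (Fin m → Cycle k) → Vec X k → 𝕜
  combination r e zs = sum λ i → r i * coeff (proj₁ (e i)) zs

  -- The homology group, i.e. cycles modulo _∼_, has a basis of m elements.
  HasDimension : (k m : ℕ) → Set (c ⊔ ℓ₁)
  HasDimension k m = Σ[ e ∈ (Fin m → Cycle k) ]
    ((z : Cycle k) → Σ[ r ∈ (Fin m → 𝕜) ] coeff (proj₁ z) ∼ combination r e) ×
    ((r : Fin m → 𝕜) → combination r e ∼ const 0# → ∀ i → r i ≈ 0#)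

  -- Exactly one reduced homology group is nonzero, and it has dimension m.
  UniqueNonvanishingDimension : ℕ → Set (c ⊔ ℓ₁)
  UniqueNonvanishingDimension m = m ≢ 0 ×
    Σ[ k ∈ ℕ ] (HasDimension k m × (∀ l → l ≢ k → HasDimension l 0))

open Homology public using (UniqueNonvanishingDimension)

-- V = V₁ ⊔ V₂ is Fin (p + q), whose first p elements form V₁ and last q elements form V₂.
V₁ : ∀ p q → Subset (p + q)
V₁ p q = full {p} ++ empty {q}

V₂ : ∀ p q → Subset (p + q)
V₂ p q = empty {p} ++ full {q}

record Block (p q : ℕ) : Set where
  constructor _at_
  field
    members : Subset (p + q)
    point   : Maybe (Fin p)

open Block public

-- A family of blocks indexed by V: the block at x is meant to be the one containing x.
IsSemiPointedPartition : ∀ {p q} → Vec (Block p q) (p + q) → Set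
IsSemiPointedPartition {p} {q} blocks =
  (∀ x → x ∈ members (B x)) ×
  (∀ x y → y ∈ members (B x) → B y ≡ B x) ×
  (∀ x e → point (B x) ≡ just e → (e ↑ˡ q) ∈ members (B x)) ×
  (∀ x → members (B x) ⊆ V₁ p q → point (B x) ≢ nothing) ×
  (∀ x → members (B x) ⊆ V₂ p q → point (B x) ≡ nothing)
  where
  B : Fin (p + q) → Block p q
  B = Vec.lookup blocks

-- The validity proof is irrelevant, so that _≡_ is equality of semi-pointed partitions.
record SemiPointedPartition (p q : ℕ) : Set where
  constructor mk
  field
    blocks : Vec (Block p q) (p + q)
    .valid : IsSemiPointedPartition blocks

  blockOf : Fin (p + q) → Block p q
  blockOf = Vec.lookup blocks

open SemiPointedPartition public using (blocks; blockOf)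

-- The block of P at x is a union of blocks of Q iff it contains the Q-block of each of its
-- elements y; the Q-blocks making it up are then exactly those, and one of them must be
-- pointed at the same element as the block of P, resp. be unpointed if the latter is.
infix 4 _⊑_
_⊑_ : ∀ {p q} → Rel (SemiPointedPartition p q) 0ℓ
P ⊑ Q = ∀ x →
  (∀ y → y ∈ members (blockOf P x) → members (blockOf Q y) ⊆ members (blockOf P x)) ×
  (∃[ y ] (y ∈ members (blockOf P x) × point (blockOf Q y) ≡ point (blockOf P x)))

module _ {p q : ℕ} where

  infix 4 _≟ᴮ_
  _≟ᴮ_ : DecidableEquality (Block p q)
  (s at u) ≟ᴮ (t at v) = map′ (λ { (refl , refl) → refl }) (λ { refl → refl , refl })
    (Vecₚ.≡-dec _≟ᵇ_ s t ×-dec Maybeₚ.≡-dec _≟ᶠ_ u v)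

  valid? : (bs : Vec (Block p q) (p + q)) → Dec (IsSemiPointedPartition bs)
  valid? bs =
    all? (λ x → x ∈? members (B x)) ×-dec
    all? (λ x → all? λ y → (y ∈? members (B x)) →-dec (B y ≟ᴮ B x)) ×-dec
    all? (λ x → all? λ e → Maybeₚ.≡-dec _≟ᶠ_ (point (B x)) (just e)
                             →-dec ((e ↑ˡ q) ∈? members (B x))) ×-dec
    all? (λ x → (members (B x) ⊆? V₁ p q)
                  →-dec ¬? (Maybeₚ.≡-dec _≟ᶠ_ (point (B x)) nothing)) ×-dec
    all? (λ x → (members (B x) ⊆? V₂ p q)
                  →-dec Maybeₚ.≡-dec _≟ᶠ_ (point (B x)) nothing)
    where
    B : Fin (p + q) → Block p q
    B = Vec.lookup bs

  isValid : (P : SemiPointedPartition p q) → IsSemiPointedPartition (blocks P)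
  isValid (mk bs v) = recompute (valid? bs) v

  self∈ : (P : SemiPointedPartition p q) → ∀ x → x ∈ members (blockOf P x)
  self∈ P = proj₁ (isValid P)

  sameBlock : (P : SemiPointedPartition p q) →
              ∀ x y → y ∈ members (blockOf P x) → blockOf P y ≡ blockOf P x
  sameBlock P = proj₁ (proj₂ (isValid P))

  mk-≡ : {P Q : SemiPointedPartition p q} → blocks P ≡ blocks Q → P ≡ Q
  mk-≡ {mk _ _} {mk _ _} refl = refl

  _≟ˢ_ : DecidableEquality (SemiPointedPartition p q)
  P ≟ˢ Q = map′ mk-≡ (cong blocks) (Vecₚ.≡-dec _≟ᴮ_ (blocks P) (blocks Q))

  _⊑?_ : Decidable (_⊑_ {p} {q})
  P ⊑? Q = all? λ x →
    all? (λ y → (y ∈? members (blockOf P x))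
                  →-dec (members (blockOf Q y) ⊆? members (blockOf P x))) ×-dec
    any? (λ y → (y ∈? members (blockOf P x))
                  ×-dec Maybeₚ.≡-dec _≟ᶠ_ (point (blockOf Q y)) (point (blockOf P x)))

  ⊑-reflexive : {P Q : SemiPointedPartition p q} → P ≡ Q → P ⊑ Q
  ⊑-reflexive {P} refl x =
    (λ y y∈ {z} z∈ → subst (λ B → z ∈ members B) (sameBlock P x y y∈) z∈) ,
    x , self∈ P x , refl

  ⊑-trans : {P Q R : SemiPointedPartition p q} → P ⊑ Q → Q ⊑ R → P ⊑ R
  ⊑-trans {P} {Q} {R} P⊑Q Q⊑R x with P⊑Q x
  ... | Q⊆P , y , y∈P , Qy≡Px with Q⊑R y
  ... | R⊆Q , z , z∈Q , Rz≡Qy =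
    (λ w w∈P → Q⊆P w w∈P ∘ proj₁ (Q⊑R w) w (self∈ Q w)) ,
    z , Q⊆P y y∈P z∈Q , trans Rz≡Qy Qy≡Px

  ⊑-antisym : {P Q : SemiPointedPartition p q} → P ⊑ Q → Q ⊑ P → P ≡ Q
  ⊑-antisym {P} {Q} P⊑Q Q⊑P = mk-≡ (lookup-ext same)
    where
    lookup-ext : ∀ {n} {us vs : Vec (Block p q) n} →
                 (∀ i → Vec.lookup us i ≡ Vec.lookup vs i) → us ≡ vs
    lookup-ext {us = us} {vs} eq =
      trans (sym (Vecₚ.tabulate∘lookup us))
            (trans (Vecₚ.tabulate-cong eq) (Vecₚ.tabulate∘lookup vs))

    members≡ : ∀ x → members (blockOf P x) ≡ members (blockOf Q x)
    members≡ x = ⊆-antisym (proj₁ (Q⊑P x) x (self∈ Q x)) (proj₁ (P⊑Q x) x (self∈ P x))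

    point≡ : ∀ x → point (blockOf P x) ≡ point (blockOf Q x)
    point≡ x with proj₂ (P⊑Q x)
    ... | y , y∈P , Qy≡Px =
      trans (sym Qy≡Px) (cong point (sameBlock Q x y (subst (y ∈_) (members≡ x) y∈P)))

    same : ∀ x → blockOf P x ≡ blockOf Q x
    same x = cong₂ _at_ (members≡ x) (point≡ x)

allVecs : ∀ {A : Set} → List A → ∀ n → List (Vec A n)
allVecs xs zero    = [] ∷ []
allVecs xs (suc n) = cartesianProductWith _∷_ xs (allVecs xs n)

∈-allVecs : ∀ {A : Set} {xs : List A} → IsEnumeration (setoid A) xs →
            ∀ {n} → IsEnumeration (setoid (Vec A n)) (allVecs xs n)
∈-allVecs enum []       = here refl
∈-allVecs enum (v ∷ vs) = ∈-cartesianProductWith⁺ _∷_ (enum v) (∈-allVecs enum vs)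

module _ (p q : ℕ) where

  allBlocks : List (Block p q)
  allBlocks = cartesianProductWith _at_ (allVecs (true ∷ false ∷ []) (p + q))
                                        (nothing ∷ map just (allFin p))

  ∈-allBlocks : IsEnumeration (setoid (Block p q)) allBlocks
  ∈-allBlocks (s at u) = ∈-cartesianProductWith⁺ _at_ (∈-allVecs bool s) (point∈ u)
    where
    bool : IsEnumeration (setoid _) (true ∷ false ∷ [])
    bool true  = here refl
    bool false = there (here refl)

    point∈ : IsEnumeration (setoid (Maybe (Fin p))) (nothing ∷ map just (allFin p))
    point∈ nothing  = here refl
    point∈ (just e) = there (∈-map⁺ just (∈-allFin e))

  toPartition : Vec (Block p q) (p + q) → Maybe (SemiPointedPartition p q)
  toPartition bs with valid? bs
  ... | yes v = just (mk bs v)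
  ... | no  _ = nothing

  toPartition-blocks : ∀ P → MAny.Any (P ≡_) (toPartition (blocks P))
  toPartition-blocks P with valid? (blocks P)
  ... | yes _ = MAny.just refl
  ... | no ¬v = contradiction (isValid P) ¬v

  allPartitions : List (SemiPointedPartition p q)
  allPartitions = deduplicate _≟ˢ_ (mapMaybe toPartition (allVecs allBlocks (p + q)))

  ∈-allPartitions : IsEnumeration (setoid (SemiPointedPartition p q)) allPartitions
  ∈-allPartitions P = ∈-deduplicate⁺ _≟ˢ_ (Anyₚ.mapMaybe⁺ toPartition _
    (Anyₚ.map⁺ (Any.map (λ { refl → toPartition-blocks P })
                        (∈-allVecs ∈-allBlocks (blocks P)))))

  Π : FinitePoset
  Π = record
    { Carrier           = SemiPointedPartition p q
    ; _≤_               = _⊑_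
    ; isDecPartialOrder = record
      { isPartialOrder = record
        { isPreorder = record
          { isEquivalence = isEquivalence
          ; reflexive     = ⊑-reflexive
          ; trans         = λ {P} {Q} {R} → ⊑-trans {P = P} {Q} {R}
          }
        ; antisym    = ⊑-antisym
        }
      ; _≟_  = _≟ˢ_
      ; _≤?_ = _⊑?_
      }
    ; elements          = allPartitions
    ; complete          = ∈-allPartitions
    ; unique            = DecUniqueₚ.deduplicate-! _≟ˢ_ _
    }

  Π̂ : FinitePoset
  Π̂ = withBottom Π

module _ {p q : ℕ} where

  ↑ˡ∈V₁ : ∀ (v : Fin p) → (v ↑ˡ q) ∈ V₁ p q
  ↑ˡ∈V₁ v = Vecₚ.lookup⇒[]= _ _
    (trans (Vecₚ.lookup-++ˡ full empty v) (Vecₚ.[]=⇒lookup (∈⊤ {x = v})))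

  ↑ˡ∉V₂ : ∀ (v : Fin p) → ¬ ((v ↑ˡ q) ∈ V₂ p q)
  ↑ˡ∉V₂ v v∈ = ∉⊥ (Vecₚ.lookup⇒[]= v empty
    (trans (sym (Vecₚ.lookup-++ˡ empty (full {q}) v)) (Vecₚ.[]=⇒lookup v∈)))

  ↑ʳ∉V₁ : ∀ (w : Fin q) → ¬ ((p ↑ʳ w) ∈ V₁ p q)
  ↑ʳ∉V₁ w w∈ = ∉⊥ (Vecₚ.lookup⇒[]= w empty
    (trans (sym (Vecₚ.lookup-++ʳ (full {p}) empty w)) (Vecₚ.[]=⇒lookup w∈)))

  m : Fin p → SemiPointedPartition p q
  m v = mk (replicate (p + q) B₀)
    ( (λ x → subst (λ B → x ∈ members B) (sym (entry x)) ∈⊤)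
    , (λ x y _ → trans (entry y) (sym (entry x)))
    , (λ x e _ → subst (λ B → (e ↑ˡ q) ∈ members B) (sym (entry x)) ∈⊤)
    , (λ x _ eq → just≢nothing (trans (sym (cong point (entry x))) eq))
    , (λ x ⊆V₂ → contradiction
        (⊆V₂ (subst (λ B → (v ↑ˡ q) ∈ members B) (sym (entry x)) ∈⊤)) (↑ˡ∉V₂ v))
    )
    where
    B₀ : Block p q
    B₀ = full at just v

    entry : ∀ x → Vec.lookup (replicate (p + q) B₀) x ≡ B₀
    entry x = Vecₚ.lookup-replicate x B₀

    just≢nothing : just v ≢ nothing
    just≢nothing ()

  -- A singleton is pointed exactly when it lies in V₁: the block conditions force this.
  singletons : SemiPointedPartition p q
  singletons = mk (tabulate B)
    ( (λ x → subst (λ C → x ∈ members C) (sym (entry x)) (x∈⁅x⁆ x))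
    , (λ x y y∈ → cong (Vec.lookup (tabulate B))
        (x∈⁅y⁆⇒x≡y x (subst (λ C → y ∈ members C) (entry x) y∈)))
    , (λ x e eq → subst (λ C → (e ↑ˡ q) ∈ members C) (sym (entry x))
        (pointed x e (trans (sym (cong point (entry x))) eq)))
    , (λ x ⊆V₁ eq → in-V₁ x
        (⊆V₁ (subst (λ C → x ∈ members C) (sym (entry x)) (x∈⁅x⁆ x)))
        (trans (sym (cong point (entry x))) eq))
    , (λ x ⊆V₂ → trans (cong point (entry x)) (in-V₂ x
        (⊆V₂ (subst (λ C → x ∈ members C) (sym (entry x)) (x∈⁅x⁆ x)))))
    )
    where
    pointing : Fin (p + q) → Maybe (Fin p)
    pointing x = [ just , const nothing ]′ (splitAt p x)

    B : Fin (p + q) → Block p q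
    B x = ⁅ x ⁆ at pointing x

    entry : ∀ x → Vec.lookup (tabulate B) x ≡ B x
    entry = Vecₚ.lookup∘tabulate B

    pointed : ∀ x e → pointing x ≡ just e → (e ↑ˡ q) ∈ ⁅ x ⁆
    pointed x e eq with splitAt p x in split
    pointed x e refl | inj₁ .e =
      subst (λ y → y ∈ ⁅ x ⁆) (sym (splitAt⁻¹-↑ˡ split)) (x∈⁅x⁆ x)

    in-V₁ : ∀ x → x ∈ V₁ p q → pointing x ≢ nothing
    in-V₁ x x∈ eq with splitAt p x in split
    ... | inj₂ w = ↑ʳ∉V₁ w (subst (_∈ V₁ p q) (sym (splitAt⁻¹-↑ʳ split)) x∈)

    in-V₂ : ∀ x → x ∈ V₂ p q → pointing x ≡ nothing
    in-V₂ x x∈ with splitAt p x in split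
    ... | inj₁ v = contradiction (subst (_∈ V₂ p q) (sym (splitAt⁻¹-↑ˡ split)) x∈) (↑ˡ∉V₂ v)
    ... | inj₂ _ = refl

{-# OPTIONS --safe #-}
module Submission where

-- Every coatom of an interval [x , y] merges two blocks of y, the new block keeping the point of one
-- of them. These posets are not totally semimodular: two disjoint merges that each absorb an unpointed
-- block into a pointed one may have no common lower coatom. But listing first the coatoms that merge
-- two unpointed blocks (those that change no point), and then the others, is a recursive coatom
-- ordering. For a set A of coatoms let D_A be the part of the open interval below A. Adding a coatom a
-- to A glues a cone to D_A along D_B, with B the coatoms of [x , a] below A, so by Mayer-Vietoris the
-- homology stays concentrated in top degree and the dimensions add; the partial sums of μ(x , -) over
-- the D_A obey the same recursion up to sign.
--
-- The Möbius numbers are found by Möbius inversion: it suffices to evaluate Σ_{z ≤ y} T(i , j) for the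
-- claimed values T, where i and j count the pointed and unpointed blocks of z. Such z correspond to a
-- set I of chosen blocks of y together with a map sending each remaining pointed block to I, and each
-- remaining unpointed one to a pointed or an earlier unpointed element of I. Summing over I one block
-- at a time turns the claim into the vanishing of high finite differences of a polynomial.

-- Equality in a Heyting field need not be decidable, so no dimension can be read off by
-- elimination: every homology group needs an explicit basis, and gluing has to be carried out on
-- chains. Each basis cycle of the intersection is filled once by a cone and once on the other side,
-- and the difference is a new basis cycle. The gluing induction closes up only if B is again an
-- admissible list of coatoms of `a`. As the order within each class is arbitrary, it suffices that
-- B either consists of special coatoms or contains all of them. Nonvanishing is a separate matter.
-- In the poset itself no interval of length two is a chain, which forces a positive dimension. With
-- the bottom element adjoined this can fail, and the closed formula decides instead. For the
-- pointed sums and for the bottom, the polynomial shape of the summand is guaranteed only when at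
-- least one pointed block is chosen. The defect of the remaining term is what produces the
-- right-hand side of the inversion, while all other terms combine into a vanishing difference.

open import Defs

-- Finite sums and indicator functions over a commutative ring

module FiniteSums where

  open import Algebra.Bundles using (CommutativeRing)
  import Algebra.Properties.Ring as RingProps
  import Algebra.Properties.CommutativeSemigroup as CSG
  open import Data.List.Base as List using (List; []; _∷_)
  open import Data.List.Membership.Propositional using () renaming (_∈_ to _∈ₗ_)
  open import Data.List.Relation.Unary.Any using (here; there)
  open import Data.List.Relation.Unary.AllPairs as LAP using ()
  open import Data.List.Relation.Unary.All as LAll using ()
  open import Data.List.Relation.Unary.Unique.Propositional using (Unique)
  open import Data.Product.Base using (_×_; proj₁; proj₂)
  open import Relation.Binary.Definitions using (DecidableEquality)
  open import Relation.Binary.PropositionalEquality as ≡ using (_≡_; _≢_)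
  open import Relation.Nullary using (¬_; Dec; yes; no; contradiction)

  module Sums {c ℓ} (R : CommutativeRing c ℓ) where

    open CommutativeRing R renaming (Carrier to 𝕜)
    open RingProps ring using (-0#≈0#; -‿+-comm)
    open CSG +-commutativeSemigroup using (interchange)

    private variable
      A B : Set

    Σₗ : List A → (A → 𝕜) → 𝕜
    Σₗ xs f = List.foldr _+_ 0# (List.map f xs)

    Σₗ-cong : ∀ (xs : List A) {f g : A → 𝕜} → (∀ x → f x ≈ g x) → Σₗ xs f ≈ Σₗ xs g
    Σₗ-cong []       eq = refl
    Σₗ-cong (x ∷ xs) eq = +-cong (eq x) (Σₗ-cong xs eq)

    Σₗ-zero : ∀ (xs : List A) → Σₗ xs (λ _ → 0#) ≈ 0#
    Σₗ-zero []       = refl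
    Σₗ-zero (x ∷ xs) = trans (+-identityˡ _) (Σₗ-zero xs)

    Σₗ-+ : ∀ (xs : List A) (f g : A → 𝕜) → Σₗ xs (λ x → f x + g x) ≈ Σₗ xs f + Σₗ xs g
    Σₗ-+ []       f g = sym (+-identityˡ _)
    Σₗ-+ (x ∷ xs) f g = trans (+-congˡ (Σₗ-+ xs f g)) (interchange _ _ _ _)

    Σₗ-neg : ∀ (xs : List A) (f : A → 𝕜) → Σₗ xs (λ x → - f x) ≈ - Σₗ xs f
    Σₗ-neg []       f = sym -0#≈0#
    Σₗ-neg (x ∷ xs) f = trans (+-congˡ (Σₗ-neg xs f)) (-‿+-comm _ _)

    Σₗ-* : ∀ (xs : List A) r (f : A → 𝕜) → Σₗ xs (λ x → r * f x) ≈ r * Σₗ xs f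
    Σₗ-* []       r f = sym (zeroʳ r)
    Σₗ-* (x ∷ xs) r f = trans (+-congˡ (Σₗ-* xs r f)) (sym (distribˡ r _ _))

    Σₗ-swap : ∀ (xs : List A) (ys : List B) (f : A → B → 𝕜) →
              Σₗ xs (λ x → Σₗ ys (f x)) ≈ Σₗ ys (λ y → Σₗ xs (λ x → f x y))
    Σₗ-swap []       ys f = sym (Σₗ-zero ys)
    Σₗ-swap (x ∷ xs) ys f = trans (+-congˡ (Σₗ-swap xs ys f)) (sym (Σₗ-+ ys _ _))

    when : ∀ {p} {P : Set p} → Dec P → 𝕜 → 𝕜
    when (yes _) r = r
    when (no _)  r = 0#

    when-cong : ∀ {p} {P : Set p} (d : Dec P) {r s} → r ≈ s → when d r ≈ when d s
    when-cong (yes _) eq = eq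
    when-cong (no _)  eq = refl

    when-yes : ∀ {p} {P : Set p} (d : Dec P) {r} → P → when d r ≈ r
    when-yes (yes _) p = refl
    when-yes (no ¬p) p = contradiction p ¬p

    when-no : ∀ {p} {P : Set p} (d : Dec P) {r} → ¬ P → when d r ≈ 0#
    when-no (yes p) ¬p = contradiction p ¬p
    when-no (no _)  ¬p = refl

    when-⇔ : ∀ {p q} {P : Set p} {Q : Set q} (d : Dec P) (e : Dec Q) {r s} →
             (P → Q) → (Q → P) → (P → r ≈ s) → when d r ≈ when e s
    when-⇔ (yes p) (yes _) f g eq = eq p
    when-⇔ (yes p) (no ¬q) f g eq = contradiction (f p) ¬q
    when-⇔ (no ¬p) (yes q) f g eq = contradiction (g q) ¬p
    when-⇔ (no _)  (no _)  f g eq = refl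

    Σₗ-when : ∀ {p} {P : Set p} (d : Dec P) (xs : List A) (f : A → 𝕜) →
              when d (Σₗ xs f) ≈ Σₗ xs (λ x → when d (f x))
    Σₗ-when (yes _) xs f = refl
    Σₗ-when (no _)  xs f = sym (Σₗ-zero xs)

    module _ (_≟_ : DecidableEquality A) where

      Σₗ-absent : ∀ {a} (xs : List A) (f : A → 𝕜) → LAll.All (a ≢_) xs → Σₗ xs (λ x → when (x ≟ a) (f x)) ≈ 0#
      Σₗ-absent []       f _ = refl
      Σₗ-absent {a} (x ∷ xs) f (a≢x LAll.∷ rest) =
        trans (+-cong (when-no (x ≟ a) (λ x≡a → a≢x (≡.sym x≡a))) (Σₗ-absent xs f rest)) (+-identityˡ _)

      Σₗ-single : ∀ {a} {xs : List A} (f : A → 𝕜) → Unique xs → a ∈ₗ xs → Σₗ xs (λ x → when (x ≟ a) (f x)) ≈ f a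
      Σₗ-single {a} {x ∷ xs} f (x∉ LAP.∷ u) a∈ with x ≟ a
      ... | yes ≡.refl = trans (+-congˡ (Σₗ-absent xs f x∉)) (+-identityʳ _)
      Σₗ-single {a} f (x∉ LAP.∷ u) (here a≡x) | no x≢a = contradiction (≡.sym a≡x) x≢a
      Σₗ-single {a} f (x∉ LAP.∷ u) (there a∈) | no x≢a = trans (+-identityˡ _) (Σₗ-single f u a∈)

    -- Both sides equal the double sum of `G y` over the pairs with `y ≡ f x`, which for admissible
    -- `x` and `y` are the pairs with `x ≡ g y`. Predicates in place of subtypes let the sums run
    -- over full enumerations.
    Σₗ-bijection : (_≟ᴬ_ : DecidableEquality A) (_≟ᴮ_ : DecidableEquality B) {xs : List A} {ys : List B} →
      Unique xs → Unique ys → (∀ x → x ∈ₗ xs) → (∀ y → y ∈ₗ ys) →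
      ∀ {p q} {P : A → Set p} {Q : B → Set q} (P? : ∀ x → Dec (P x)) (Q? : ∀ y → Dec (Q y)) (f : A → B) (g : B → A) →
      (∀ x → P x → Q (f x) × g (f x) ≡ x) → (∀ y → Q y → P (g y) × f (g y) ≡ y) →
      (F : A → 𝕜) (G : B → 𝕜) → (∀ x → P x → F x ≈ G (f x)) →
      Σₗ xs (λ x → when (P? x) (F x)) ≈ Σₗ ys (λ y → when (Q? y) (G y))
    Σₗ-bijection _≟ᴬ_ _≟ᴮ_ {xs} {ys} ux uy cx cy P? Q? f g to from F G eq = begin
      Σₗ xs (λ x → when (P? x) (F x))
        ≈⟨ Σₗ-cong xs (λ x → when-⇔ (P? x) (P? x) (λ p → p) (λ p → p) (λ p → trans (eq x p) (sym (Σₗ-single _≟ᴮ_ G uy (cy (f x)))))) ⟩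
      Σₗ xs (λ x → when (P? x) (Σₗ ys λ y → when (y ≟ᴮ f x) (G y)))
        ≈⟨ Σₗ-cong xs (λ x → Σₗ-when (P? x) ys _) ⟩
      Σₗ xs (λ x → Σₗ ys λ y → when (P? x) (when (y ≟ᴮ f x) (G y)))
        ≈⟨ Σₗ-swap xs ys _ ⟩
      Σₗ ys (λ y → Σₗ xs λ x → when (P? x) (when (y ≟ᴮ f x) (G y)))
        ≈⟨ Σₗ-cong ys (λ y → Σₗ-cong xs (λ x → exchange x y)) ⟩
      Σₗ ys (λ y → Σₗ xs λ x → when (Q? y) (when (x ≟ᴬ g y) (G y)))
        ≈⟨ Σₗ-cong ys (λ y → sym (Σₗ-when (Q? y) xs _)) ⟩
      Σₗ ys (λ y → when (Q? y) (Σₗ xs λ x → when (x ≟ᴬ g y) (G y)))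
        ≈⟨ Σₗ-cong ys (λ y → when-cong (Q? y) (Σₗ-single _≟ᴬ_ (λ _ → G y) ux (cx (g y)))) ⟩
      Σₗ ys (λ y → when (Q? y) (G y)) ∎
      where
      open import Relation.Binary.Reasoning.Setoid setoid
      exchange : ∀ x y → when (P? x) (when (y ≟ᴮ f x) (G y)) ≈ when (Q? y) (when (x ≟ᴬ g y) (G y))
      exchange x y with P? x | y ≟ᴮ f x | Q? y | x ≟ᴬ g y
      ... | yes p | yes ≡.refl | yes q | yes _    = refl
      ... | yes p | yes ≡.refl | no ¬q | _        = contradiction (proj₁ (to x p)) ¬q
      ... | yes p | yes ≡.refl | yes q | no x≢    = contradiction (≡.sym (proj₂ (to x p))) x≢
      ... | yes p | no y≢ | yes q | yes ≡.refl    = contradiction (≡.sym (proj₂ (from y q))) y≢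
      ... | yes p | no y≢ | yes q | no _          = refl
      ... | yes p | no y≢ | no _  | _             = refl
      ... | no ¬p | _ | yes q | yes ≡.refl        = contradiction (proj₁ (from y q)) ¬p
      ... | no ¬p | _ | yes q | no _              = refl
      ... | no ¬p | _ | no _  | _                 = refl

-- The Möbius function and Möbius inversion

module MöbiusFunctions where

  open FiniteSums
  open import Algebra.Bundles using (AbelianGroup)
  open import Data.Integer.Base as ℤ using (ℤ; 0ℤ; 1ℤ)
  import Data.Integer.Properties as ℤₚ
  open import Algebra.Properties.Group (AbelianGroup.group ℤₚ.+-0-abelianGroup) using (∙-cancelʳ)
  open import Data.List.Base as List using ()
  open import Data.Product.Base using (Σ; _,_; proj₁; proj₂)
  open import Induction.WellFounded using (Acc; acc)
  open import Relation.Binary.PropositionalEquality as ≡ using (_≡_; _≢_; refl; sym; trans; cong; cong₂)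
  open import Relation.Nullary using (¬_; Dec; yes; no; contradiction)

  open Sums ℤₚ.+-*-commutativeRing

  module Möbius (P : FinitePoset) where

    open FinitePoset P renaming (Carrier to X)

    term : ∀ x y → (∀ {z} → z < y → Acc _<_ z) → ∀ z → Dec (x ≤ z) → Dec (z < y) → ℤ
    term x y below z (yes _) (yes z<y) = μ-acc P x z (below z<y)
    term x y below z _       _         = 0ℤ

    private
      -- The summand in the definition of μ-acc is a local function of that definition; unification names it.
      summand : ∀ x y (below : ∀ {z} → z < y → Acc _<_ z) → x ≢ y →
                Σ (X → ℤ) λ f → μ-acc P x y (acc below) ≡ ℤ.- Σₗ elements f
      summand x y below x≢y with x ≟ y
      ... | yes x≡y = contradiction x≡y x≢y
      ... | no  _   = _ , refl

      summand≡term : ∀ x y (below : ∀ {z} → z < y → Acc _<_ z) (x≢y : x ≢ y) z →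
                     proj₁ (summand x y below x≢y) z ≡ term x y below z (x ≤? z) (z <? y)
      summand≡term x y below x≢y z with x ≟ y
      ... | yes x≡y = contradiction x≡y x≢y
      ... | no  _   with x ≤? z | z <? y
      ... | yes _ | yes _ = refl
      ... | yes _ | no  _ = refl
      ... | no  _ | yes _ = refl
      ... | no  _ | no  _ = refl

    μ-acc-step : ∀ x y (below : ∀ {z} → z < y → Acc _<_ z) → x ≢ y →
                 μ-acc P x y (acc below) ≡ ℤ.- Σₗ elements (λ z → term x y below z (x ≤? z) (z <? y))
    μ-acc-step x y below x≢y = trans (proj₂ (summand x y below x≢y))
      (cong ℤ.-_ (Σₗ-cong elements (summand≡term x y below x≢y)))

    μ-acc-refl : ∀ x y (a : Acc _<_ y) → x ≡ y → μ-acc P x y a ≡ 1ℤ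
    μ-acc-refl x y (acc _) x≡y with x ≟ y
    ... | yes _   = refl
    ... | no  x≢y = contradiction x≡y x≢y

    -- The recursion of `μ-acc` passes on accessibility proofs other than the canonical ones inside
    -- `μ`. Independence of the proof turns it into a recursion for `μ` itself.
    μ-acc-irrelevant : ∀ x y (a b : Acc _<_ y) → μ-acc P x y a ≡ μ-acc P x y b
    μ-acc-irrelevant x y (acc r) (acc s) = by-cases (x ≟ y)
      where
      same : ∀ z d e → term x y r z d e ≡ term x y s z d e
      same z (yes _) (yes z<y) = μ-acc-irrelevant x z (r z<y) (s z<y)
      same z (yes _) (no _)    = refl
      same z (no _)  _         = refl
      by-cases : Dec (x ≡ y) → μ-acc P x y (acc r) ≡ μ-acc P x y (acc s)
      by-cases (yes x≡y) = trans (μ-acc-refl x y _ x≡y) (sym (μ-acc-refl x y _ x≡y))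
      by-cases (no x≢y)  = trans (μ-acc-step x y r x≢y) (trans
        (cong ℤ.-_ (Σₗ-cong elements λ z → same z (x ≤? z) (z <? y))) (sym (μ-acc-step x y s x≢y)))

    μ-refl : ∀ x → μ P x x ≡ 1ℤ
    μ-refl x = μ-acc-refl x x (<-wellFounded x) refl

    μ-step : ∀ {x y} → x ≢ y → μ P x y ≡ ℤ.- Σₗ elements (λ z → when (x ≤? z) (when (z <? y) (μ P x z)))
    μ-step {x} {y} x≢y with <-wellFounded y
    ... | acc r = trans (μ-acc-step x y r x≢y) (cong ℤ.-_ (Σₗ-cong elements λ z → same z (x ≤? z) (z <? y)))
      where
      same : ∀ z d e → term x y r z d e ≡ when d (when e (μ P x z))
      same z (yes _) (yes z<y) = μ-acc-irrelevant x z (r z<y) (<-wellFounded z)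
      same z (yes _) (no _)    = refl
      same z (no _)  (yes _)   = refl
      same z (no _)  (no _)    = refl

    μ-zero : ∀ {x y} → ¬ x ≤ y → μ P x y ≡ 0ℤ
    μ-zero {x} {y} x≰y = trans (μ-step λ { refl → x≰y ≤-refl }) (cong ℤ.-_
      (trans (Σₗ-cong elements vanish) (Σₗ-zero elements)))
      where
      vanish : ∀ z → when (x ≤? z) (when (z <? y) (μ P x z)) ≡ 0ℤ
      vanish z with x ≤? z | z <? y
      ... | yes x≤z | yes (z≤y , _) = contradiction (≤-trans x≤z z≤y) x≰y
      ... | yes _   | no _          = refl
      ... | no _    | _             = refl

    below-split : ∀ (φ : X → ℤ) y →
      Σₗ elements (λ z → when (z ≤? y) (φ z)) ≡ φ y ℤ.+ Σₗ elements (λ z → when (z <? y) (φ z))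
    below-split φ y = trans (Σₗ-cong elements split) (trans (Σₗ-+ elements _ _)
      (cong (λ t → t ℤ.+ Σₗ elements (λ z → when (z <? y) (φ z))) (Σₗ-single _≟_ φ unique (complete y))))
      where
      split : ∀ z → when (z ≤? y) (φ z) ≡ when (z ≟ y) (φ z) ℤ.+ when (z <? y) (φ z)
      split z with z ≤? y | z ≟ y | z <? y
      ... | yes _   | yes z≡y  | yes (_ , z≢y) = contradiction z≡y z≢y
      ... | yes _   | yes _    | no _          = sym (ℤₚ.+-identityʳ _)
      ... | yes _   | no _     | yes _         = sym (ℤₚ.+-identityˡ _)
      ... | yes z≤y | no z≢y   | no z≮y        = contradiction (z≤y , z≢y) z≮y
      ... | no z≰y  | yes refl | _             = contradiction ≤-refl z≰y
      ... | no z≰y  | no _     | yes (z≤y , _) = contradiction z≤y z≰y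
      ... | no _    | no _     | no _          = refl

    Σμ : ∀ x y → Σₗ elements (λ z → when (z ≤? y) (μ P x z)) ≡ when (x ≟ y) 1ℤ
    Σμ x y = trans (below-split (μ P x) y) (trans (cong (λ t → μ P x y ℤ.+ t) (Σₗ-cong elements guard)) (by-cases (x ≟ y)))
      where
      guard : ∀ z → when (z <? y) (μ P x z) ≡ when (x ≤? z) (when (z <? y) (μ P x z))
      guard z with x ≤? z
      ... | yes _  = refl
      ... | no x≰z = trans (when-cong (z <? y) (μ-zero x≰z)) (zero-when (z <? y))
        where
        zero-when : ∀ d → when d 0ℤ ≡ 0ℤ
        zero-when (yes _) = refl
        zero-when (no _)  = refl
      by-cases : ∀ d → μ P x y ℤ.+ Σₗ elements (λ z → when (x ≤? z) (when (z <? y) (μ P x z))) ≡ when d 1ℤ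
      by-cases (no x≢y)   = trans (cong (λ t → t ℤ.+ S) (μ-step x≢y)) (ℤₚ.+-inverseˡ S)
        where S = Σₗ elements (λ z → when (x ≤? z) (when (z <? y) (μ P x z)))
      by-cases (yes refl) = trans (cong₂ ℤ._+_ (μ-refl x) (trans (Σₗ-cong elements vanish) (Σₗ-zero elements))) refl
        where
        vanish : ∀ z → when (x ≤? z) (when (z <? x) (μ P x z)) ≡ 0ℤ
        vanish z with x ≤? z | z <? x
        ... | yes x≤z | yes (z≤x , z≢x) = contradiction (≤-antisym z≤x x≤z) z≢x
        ... | yes _   | no _            = refl
        ... | no _    | _               = refl

    -- The zeta matrix is unitriangular: once the values strictly below `y` agree, they cancel and
    -- leave those at `y`. All three Möbius formulas are proved by comparing lower sums in this way.
    Σ≤-injective : ∀ {φ ψ : X → ℤ} →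
      (∀ y → Σₗ elements (λ z → when (z ≤? y) (φ z)) ≡ Σₗ elements (λ z → when (z ≤? y) (ψ z))) → ∀ y → φ y ≡ ψ y
    Σ≤-injective {φ} {ψ} eq y = go y (<-wellFounded y)
      where
      go : ∀ y → Acc _<_ y → φ y ≡ ψ y
      go y (acc r) = ∙-cancelʳ (Σₗ elements (λ z → when (z <? y) (φ z))) (φ y) (ψ y)
        (trans (sym (below-split φ y)) (trans (eq y) (trans (below-split ψ y) (cong (λ t → ψ y ℤ.+ t) (Σₗ-cong elements λ z → same z (z <? y))))))
        where
        same : ∀ z d → when d (ψ z) ≡ when d (φ z)
        same z (yes z<y) = sym (go z (r z<y))
        same z (no _)    = refl

-- Chain complexes of order complexes, cones and Mayer-Vietoris

module OrderComplexes where

  open FiniteSums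
  open import Algebra.Apartness.Bundles using (HeytingField; HeytingCommutativeRing)
  open import Algebra.Bundles using (CommutativeRing; Semiring)
  import Algebra.Definitions.RawMonoid as RawMonoidDefs
  import Algebra.Definitions.RawSemiring as RawSemiringDefs
  import Algebra.Properties.CommutativeMonoid.Sum as MonoidSum
  import Algebra.Properties.Semiring.Sum as SemiringSum
  import Algebra.Properties.Ring as RingProps
  import Algebra.Properties.CommutativeSemigroup as CSG
  open import Data.Fin.Base using (Fin; zero; suc; toℕ; splitAt; _↑ˡ_; _↑ʳ_)
  open import Data.Fin.Properties using (splitAt-↑ˡ; splitAt-↑ʳ; splitAt⁻¹-↑ˡ; splitAt⁻¹-↑ʳ)
  open import Data.List.Base as List using ([]; _∷_)
  open import Data.List.Membership.Propositional using () renaming (_∈_ to _∈ₗ_)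
  open import Data.List.Relation.Unary.AllPairs as LAP using ()
  open import Data.List.Relation.Unary.All as LAll using ()
  open import Data.Nat.Base as ℕ using (ℕ; zero; suc)
  import Data.Nat.Properties as ℕₚ
  open import Data.Product.Base using (Σ-syntax; _×_; _,_; proj₁; proj₂)
  open import Data.Sum.Base using (_⊎_; inj₁; inj₂; [_,_]′)
  open import Data.Unit.Polymorphic.Base using (⊤; tt)
  open import Data.Vec.Base as Vec using (Vec; []; _∷_; _∷ʳ_; insertAt)
  import Data.Vec.Relation.Unary.All as VAll
  open VAll using (All; []; _∷_)
  import Data.Vec.Relation.Unary.AllPairs as VAP
  open VAP using (AllPairs; []; _∷_)
  open import Data.Vec.Properties using (∷ʳ-injectiveˡ; ∷ʳ-injectiveʳ; ∷-injectiveʳ)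
  open import Relation.Binary.Structures using (IsStrictPartialOrder)
  open import Function.Base using (_∘_)
  open import Level using (_⊔_)
  open import Relation.Binary.PropositionalEquality as ≡ using (_≡_; _≢_)
  open import Relation.Binary.Definitions using (tri<; tri≈; tri>)
  open import Relation.Nullary using (¬_; Dec; yes; no; contradiction)
  open import Relation.Nullary.Decidable using (¬?)

  module Chains {c ℓ₁ ℓ₂} (K : HeytingField c ℓ₁ ℓ₂) (P : FinitePoset) where

    open FinitePoset P using (elements; complete; unique; _<_; _<?_; _≟_; <-isStrictPartialOrder)
      renaming (Carrier to X)
    open HeytingField K using (heytingCommutativeRing)
    open CommutativeRing (HeytingCommutativeRing.commutativeRing heytingCommutativeRing)
      hiding (zero) renaming (Carrier to 𝕜)
    open Sums (HeytingCommutativeRing.commutativeRing heytingCommutativeRing)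
    open RawMonoidDefs +-rawMonoid using (sum)
    open RawSemiringDefs (Semiring.rawSemiring semiring) using (_^_)
    open MonoidSum +-commutativeMonoid using (∑-distrib-+; ∑-comm; sum-cong-≋; sum-replicate-zero)
    open SemiringSum semiring using (*-distribˡ-sum)
    open RingProps ring using (-0#≈0#; -‿+-comm; -‿involutive; -1*x≈-x; -‿distribˡ-*; -‿distribʳ-*)
    open CSG +-commutativeSemigroup using (interchange; x∙yz≈y∙xz)
    open import Relation.Binary.Reasoning.Setoid setoid

    private variable
      k n l : ℕ

    Fun : ℕ → Set c
    Fun k = Vec X k → 𝕜

    infix 4 _≗_
    _≗_ : Fun k → Fun k → Set ℓ₁
    f ≗ g = ∀ zs → f zs ≈ g zs

    Σₓ : (X → 𝕜) → 𝕜
    Σₓ = Σₗ elements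

    Σₓ-single : ∀ a r → Σₓ (λ x → when (x ≟ a) r) ≈ r
    Σₓ-single a r = Σₗ-single _≟_ (λ _ → r) unique (complete a)

    -- The boundary `∂` unfolded along the tuple, insertions at the front minus insertions into the
    -- tail, so that its identities follow by induction on the tuple.
    δ : Fun (suc k) → Fun k
    δ f []       = Σₓ λ z → f (z ∷ [])
    δ f (y ∷ ys) = Σₓ (λ z → f (z ∷ y ∷ ys)) - δ (λ ws → f (y ∷ ws)) ys

    δ-cong : {f g : Fun (suc k)} → f ≗ g → δ f ≗ δ g
    δ-cong eq []       = Σₗ-cong elements λ z → eq _
    δ-cong eq (y ∷ ys) = +-cong (Σₗ-cong elements λ z → eq _) (-‿cong (δ-cong (λ ws → eq _) ys))

    δ-+ : (f g : Fun (suc k)) → δ (λ ws → f ws + g ws) ≗ λ zs → δ f zs + δ g zs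
    δ-+ f g []       = Σₗ-+ elements _ _
    δ-+ f g (y ∷ ys) = begin
      Σₓ (λ z → f (z ∷ y ∷ ys) + g (z ∷ y ∷ ys)) - δ (λ ws → f (y ∷ ws) + g (y ∷ ws)) ys
        ≈⟨ +-cong (Σₗ-+ elements _ _) (trans (-‿cong (δ-+ _ _ ys)) (sym (-‿+-comm _ _))) ⟩
      (Σₓ (λ z → f (z ∷ y ∷ ys)) + Σₓ (λ z → g (z ∷ y ∷ ys)))
        + (- δ (λ ws → f (y ∷ ws)) ys - δ (λ ws → g (y ∷ ws)) ys)
        ≈⟨ interchange _ _ _ _ ⟩
      δ f (y ∷ ys) + δ g (y ∷ ys) ∎

    δ-* : ∀ r (f : Fun (suc k)) → δ (λ ws → r * f ws) ≗ λ zs → r * δ f zs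
    δ-* r f []       = Σₗ-* elements r _
    δ-* r f (y ∷ ys) = begin
      Σₓ (λ z → r * f (z ∷ y ∷ ys)) - δ (λ ws → r * f (y ∷ ws)) ys
        ≈⟨ +-cong (Σₗ-* elements r _) (trans (-‿cong (δ-* r _ ys)) (-‿distribʳ-* r _)) ⟩
      r * Σₓ (λ z → f (z ∷ y ∷ ys)) + r * - δ (λ ws → f (y ∷ ws)) ys
        ≈⟨ sym (distribˡ r _ _) ⟩
      r * δ f (y ∷ ys) ∎

    δ-zero : (f : Fun (suc k)) → (∀ ws → f ws ≈ 0#) → ∀ zs → δ f zs ≈ 0#
    δ-zero f eq []       = trans (Σₗ-cong elements λ z → eq _) (Σₗ-zero elements)
    δ-zero f eq (y ∷ ys) = trans (+-cong (trans (Σₗ-cong elements λ z → eq _) (Σₗ-zero elements))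
      (trans (-‿cong (δ-zero _ (λ ws → eq _) ys)) -0#≈0#)) (+-identityˡ _)

    δ-neg : (f : Fun (suc k)) → δ (λ ws → - f ws) ≗ λ zs → - δ f zs
    δ-neg f zs = begin
      δ (λ ws → - f ws) zs        ≈⟨ δ-cong (λ ws → sym (-1*x≈-x _)) zs ⟩
      δ (λ ws → - 1# * f ws) zs   ≈⟨ δ-* (- 1#) f zs ⟩
      - 1# * δ f zs               ≈⟨ -1*x≈-x _ ⟩
      - δ f zs                    ∎

    δ-minus : (f g : Fun (suc k)) → δ (λ ws → f ws - g ws) ≗ λ zs → δ f zs - δ g zs
    δ-minus f g zs = trans (δ-+ f _ zs) (+-congˡ (δ-neg g zs))

    δ-Σₗ : ∀ xs (F : X → Fun (suc k)) → δ (λ ws → Σₗ xs λ x → F x ws) ≗ λ zs → Σₗ xs λ x → δ (F x) zs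
    δ-Σₗ []       F zs = δ-zero _ (λ _ → refl) zs
    δ-Σₗ (x ∷ xs) F zs = trans (δ-+ _ _ zs) (+-congˡ (δ-Σₗ xs F zs))

    δ-sum : ∀ (F : Fin l → Fun (suc k)) → δ (λ ws → sum λ i → F i ws) ≗ λ zs → sum λ i → δ (F i) zs
    δ-sum {l = zero}  F zs = δ-zero _ (λ _ → refl) zs
    δ-sum {l = suc l} F zs = trans (δ-+ _ _ zs) (+-congˡ (δ-sum (F ∘ suc) zs))

    x-x≈0 : ∀ {x y} → x ≈ y → x - y ≈ 0#
    x-x≈0 eq = trans (+-congʳ eq) (-‿inverseʳ _)

    -- Two insertions at the front cancel by exchanging the sums, one at the front and one further
    -- back cancel by sign, and the rest is the claim for the tail. No order among the entries is
    -- involved.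
    δδ≈0 : (f : Fun (suc (suc k))) → ∀ zs → δ (δ f) zs ≈ 0#
    δδ≈0 f [] = begin
      Σₓ (λ z → Σₓ (λ w → f (w ∷ z ∷ [])) - Σₓ (λ w → f (z ∷ w ∷ [])))
        ≈⟨ trans (Σₗ-+ elements _ _) (+-congˡ (Σₗ-neg elements _)) ⟩
      Σₓ (λ z → Σₓ (λ w → f (w ∷ z ∷ []))) - Σₓ (λ z → Σₓ (λ w → f (z ∷ w ∷ [])))
        ≈⟨ x-x≈0 (Σₗ-swap elements elements _) ⟩
      0# ∎
    δδ≈0 f (y ∷ ys) = begin
      Σₓ (λ z → Σₓ (λ w → f (w ∷ z ∷ y ∷ ys)) - (Σₓ (λ w → f (z ∷ w ∷ y ∷ ys)) - S z))
        - δ (λ ws → δ f (y ∷ ws)) ys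
        ≈⟨ +-cong (trans (Σₗ-+ elements _ _) (+-congˡ (Σₗ-neg elements _))) (-‿cong inner) ⟩
      (Σₓ (λ z → Σₓ (λ w → f (w ∷ z ∷ y ∷ ys))) - Σₓ (λ z → Σₓ (λ w → f (z ∷ w ∷ y ∷ ys)) - S z)) - Σₓ S
        ≈⟨ +-congʳ (+-congˡ (trans (-‿cong (trans (Σₗ-+ elements _ _) (+-congˡ (Σₗ-neg elements _)))) (sym (-‿+-comm _ _)))) ⟩
      (A + (- B + - - Σₓ S)) - Σₓ S
        ≈⟨ +-congʳ (trans (sym (+-assoc _ _ _)) (trans (+-congʳ (x-x≈0 (Σₗ-swap elements elements _))) (trans (+-identityˡ _) (-‿involutive _)))) ⟩
      Σₓ S - Σₓ S
        ≈⟨ -‿inverseʳ _ ⟩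
      0# ∎
      where
      S : X → 𝕜
      S z = δ (λ ws → f (z ∷ y ∷ ws)) ys
      A = Σₓ (λ z → Σₓ (λ w → f (w ∷ z ∷ y ∷ ys)))
      B = Σₓ (λ z → Σₓ (λ w → f (z ∷ w ∷ y ∷ ys)))
      inner : δ (λ ws → δ f (y ∷ ws)) ys ≈ Σₓ S
      inner = begin
        δ (λ ws → Σₓ (λ w → f (w ∷ y ∷ ws)) - δ (λ us → f (y ∷ us)) ws) ys
          ≈⟨ δ-minus _ _ ys ⟩
        δ (λ ws → Σₓ (λ w → f (w ∷ y ∷ ws))) ys - δ (δ (λ us → f (y ∷ us))) ys
          ≈⟨ +-cong (δ-Σₗ elements _ ys) (trans (-‿cong (δδ≈0 _ ys)) -0#≈0#) ⟩
        Σₓ S + 0#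
          ≈⟨ +-identityʳ _ ⟩
        Σₓ S ∎

    δ-insertions : (f : Fun (suc k)) → ∀ zs → (∀ j z → f (insertAt zs j z) ≈ 0#) → δ f zs ≈ 0#
    δ-insertions f []       eq = trans (Σₗ-cong elements λ z → eq zero z) (Σₗ-zero elements)
    δ-insertions f (y ∷ ys) eq = trans (+-cong (trans (Σₗ-cong elements λ z → eq zero z) (Σₗ-zero elements))
      (trans (-‿cong (δ-insertions _ ys (λ j z → eq (suc j) z))) -0#≈0#)) (+-identityˡ _)

    -- The cone operator appends the apex a to every chain; the sign (-1)^k is built in.
    cone : X → Fun k → Fun (suc k)
    cone {zero}  a g (z ∷ []) = when (z ≟ a) (g [])
    cone {suc k} a g (z ∷ zs) = - cone a (λ ws → g (z ∷ ws)) zs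

    cone-cong : ∀ a {f g : Fun k} → f ≗ g → cone a f ≗ cone a g
    cone-cong {zero}  a eq (z ∷ []) = when-cong (z ≟ a) (eq [])
    cone-cong {suc k} a eq (z ∷ zs) = -‿cong (cone-cong a (λ ws → eq _) zs)

    cone-+ : ∀ a (f g : Fun k) → cone a (λ ws → f ws + g ws) ≗ λ zs → cone a f zs + cone a g zs
    cone-+ {zero} a f g (z ∷ []) with z ≟ a
    ... | yes _ = refl
    ... | no  _ = sym (+-identityˡ _)
    cone-+ {suc k} a f g (z ∷ zs) = trans (-‿cong (cone-+ a _ _ zs)) (sym (-‿+-comm _ _))

    cone-neg : ∀ a (f : Fun k) → cone a (λ ws → - f ws) ≗ λ zs → - cone a f zs
    cone-neg {zero} a f (z ∷ []) with z ≟ a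
    ... | yes _ = refl
    ... | no  _ = sym -0#≈0#
    cone-neg {suc k} a f (z ∷ zs) = -‿cong (cone-neg a _ zs)

    cone-zero : ∀ a (f : Fun k) → (∀ ws → f ws ≈ 0#) → ∀ zs → cone a f zs ≈ 0#
    cone-zero {zero} a f eq (z ∷ []) with z ≟ a
    ... | yes _ = eq []
    ... | no  _ = refl
    cone-zero {suc k} a f eq (z ∷ zs) = trans (-‿cong (cone-zero a _ (λ ws → eq _) zs)) -0#≈0#

    cone-Σₗ : ∀ a xs (F : X → Fun k) → cone a (λ ws → Σₗ xs λ x → F x ws) ≗ λ zs → Σₗ xs λ x → cone a (F x) zs
    cone-Σₗ a []       F zs = cone-zero a _ (λ _ → refl) zs
    cone-Σₗ a (x ∷ xs) F zs = trans (cone-+ a _ _ zs) (+-congˡ (cone-Σₗ a xs F zs))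

    δ-cone₀ : ∀ a (g : Fun 0) → δ (cone a g) ≗ g
    δ-cone₀ a g [] = Σₓ-single a (g [])

    -- Deleting the apex returns `g`, with sign +1 thanks to the sign inside `cone`; deleting
    -- another vertex gives the cone over the boundary. On the empty tuple there is no second term,
    -- whence `δ-cone₀`.
    δ-cone : ∀ a (g : Fun (suc k)) → δ (cone a g) ≗ λ zs → g zs - cone a (δ g) zs
    δ-cone {zero} a g (y ∷ []) = begin
      Σₓ (λ z → - cone a (λ ws → g (z ∷ ws)) (y ∷ [])) - δ (λ ws → - cone a (λ us → g (y ∷ us)) ws) []
        ≈⟨ +-cong (Σₗ-neg elements _) (-‿cong (δ-neg (cone a (λ us → g (y ∷ us))) [])) ⟩
      - Σₓ (λ z → cone a (λ ws → g (z ∷ ws)) (y ∷ [])) - - δ (cone a (λ us → g (y ∷ us))) []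
        ≈⟨ +-cong (-‿cong (sym (cone-Σₗ a elements (λ z ws → g (z ∷ ws)) (y ∷ [])))) (trans (-‿involutive _) (δ-cone₀ a (λ us → g (y ∷ us)) [])) ⟩
      - cone a (λ ws → Σₓ λ z → g (z ∷ ws)) (y ∷ []) + g (y ∷ [])
        ≈⟨ +-comm _ _ ⟩
      g (y ∷ []) - cone a (λ ws → Σₓ λ z → g (z ∷ ws)) (y ∷ [])
        ≈⟨ +-congˡ (-‿cong (cone-cong a {λ ws → Σₓ λ z → g (z ∷ ws)} {δ g} (λ { [] → refl }) (y ∷ []))) ⟩
      g (y ∷ []) - cone a (δ g) (y ∷ []) ∎
    δ-cone {suc k} a g (y ∷ ys) = begin
      Σₓ (λ z → - cone a (λ ws → g (z ∷ ws)) (y ∷ ys)) - δ (λ ws → - cone a (λ us → g (y ∷ us)) ws) ys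
        ≈⟨ +-cong (Σₗ-neg elements _) (-‿cong (δ-neg _ ys)) ⟩
      - Σₓ (λ z → cone a (λ ws → g (z ∷ ws)) (y ∷ ys)) - - δ (cone a (λ us → g (y ∷ us))) ys
        ≈⟨ +-cong (-‿cong (sym (cone-Σₗ a elements (λ z ws → g (z ∷ ws)) (y ∷ ys)))) (trans (-‿involutive _) (δ-cone a _ ys)) ⟩
      - cone a (λ ws → Σₓ λ z → g (z ∷ ws)) (y ∷ ys) + (g (y ∷ ys) - R)
        ≈⟨ x∙yz≈y∙xz _ _ _ ⟩
      g (y ∷ ys) + (- cone a (λ ws → Σₓ λ z → g (z ∷ ws)) (y ∷ ys) - R)
        ≈⟨ +-congˡ (-‿+-comm _ _) ⟩
      g (y ∷ ys) - (- cone a (λ ws → Σₓ λ z → g (z ∷ y ∷ ws)) ys + R)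
        ≈⟨ +-congˡ (-‿cong (trans (+-congˡ (sym (-‿involutive R))) (trans (-‿+-comm _ _) (-‿cong (trans (+-congˡ (sym (cone-neg a _ ys))) (sym (cone-+ a _ _ ys))))))) ⟩
      g (y ∷ ys) - cone a (δ g) (y ∷ ys) ∎
      where
      R = cone a (δ (λ us → g (y ∷ us))) ys

    ∂≈δ : ∀ {o y} (f : Fun (suc k)) → Homology.∂ K P o y f ≗ δ f
    ∂≈δ {zero} f [] = trans (+-identityʳ _) (*-identityˡ _)
    ∂≈δ {suc k} {o} {y} f (w ∷ ws) = +-cong (*-identityˡ _) (begin
      sum (λ j → (- 1# * (- 1#) ^ toℕ j) * F j)
        ≈⟨ sum-cong-≋ {suc k} (λ j → *-assoc (- 1#) ((- 1#) ^ toℕ j) (F j)) ⟩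
      sum (λ j → - 1# * ((- 1#) ^ toℕ j * F j))
        ≈⟨ sym (*-distribˡ-sum (- 1#) (λ j → (- 1#) ^ toℕ j * F j)) ⟩
      - 1# * sum (λ j → (- 1#) ^ toℕ j * F j)
        ≈⟨ -1*x≈-x _ ⟩
      - sum (λ j → (- 1#) ^ toℕ j * F j)
        ≈⟨ -‿cong (∂≈δ {o = o} {y} (λ us → f (w ∷ us)) ws) ⟩
      - δ (λ us → f (w ∷ us)) ws ∎)
      where
      F : Fin (suc k) → 𝕜
      F j = Σₓ (λ z → f (w ∷ insertAt ws j z))

    <-trans : ∀ {x y z} → x < y → y < z → x < z
    <-trans = IsStrictPartialOrder.trans <-isStrictPartialOrder

    <-irrefl : ∀ {x} → ¬ (x < x)
    <-irrefl = IsStrictPartialOrder.irrefl <-isStrictPartialOrder ≡.refl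

    FaceIn : (X → Set) → Vec X k → Set
    FaceIn F zs = All F zs × AllPairs _<_ zs

    SupportedIn : (X → Set) → Fun k → Set ℓ₁
    SupportedIn F f = ∀ zs → ¬ FaceIn F zs → f zs ≈ 0#

    IsCycleᵟ : Fun k → Set ℓ₁
    IsCycleᵟ {zero}  f = ⊤
    IsCycleᵟ {suc k} f = ∀ zs → δ f zs ≈ 0#

    cycle-δ : (f : Fun (suc k)) → IsCycleᵟ (δ f)
    cycle-δ {zero}  f = tt
    cycle-δ {suc k} f = δδ≈0 f

    sum-zero : (F : Fin l → 𝕜) → (∀ i → F i ≈ 0#) → sum F ≈ 0#
    sum-zero {zero}  F eq = refl
    sum-zero {suc l} F eq = trans (+-cong (eq zero) (sum-zero (F ∘ suc) (eq ∘ suc))) (+-identityˡ _)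

    supp-cong : ∀ {F} {f g : Fun k} → f ≗ g → SupportedIn F f → SupportedIn F g
    supp-cong eq s zs ¬face = trans (sym (eq zs)) (s zs ¬face)

    supp-+ : ∀ {F} {f g : Fun k} → SupportedIn F f → SupportedIn F g → SupportedIn F (λ zs → f zs + g zs)
    supp-+ s t zs ¬face = trans (+-cong (s zs ¬face) (t zs ¬face)) (+-identityˡ _)

    supp-neg : ∀ {F} {f : Fun k} → SupportedIn F f → SupportedIn F (λ zs → - f zs)
    supp-neg s zs ¬face = trans (-‿cong (s zs ¬face)) -0#≈0#

    supp-* : ∀ r {F} {f : Fun k} → SupportedIn F f → SupportedIn F (λ zs → r * f zs)
    supp-* r s zs ¬face = trans (*-congˡ (s zs ¬face)) (zeroʳ r)

    supp-sum : ∀ {F} (f : Fin l → Fun k) → (∀ i → SupportedIn F (f i)) → SupportedIn F (λ zs → sum λ i → f i zs)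
    supp-sum f s zs ¬face = sum-zero _ (λ i → s i zs ¬face)

    supp-mono : ∀ {F G : X → Set} {f : Fun k} → (∀ {z} → F z → G z) → SupportedIn F f → SupportedIn G f
    supp-mono F⊆G s zs ¬face = s zs λ (all , pairs) → ¬face (VAll.map F⊆G all , pairs)

    all-insertAt⁻ : ∀ {F : X → Set} (zs : Vec X k) j z → All F (insertAt zs j z) → All F zs
    all-insertAt⁻ zs       zero    z (_ ∷ ps) = ps
    all-insertAt⁻ (y ∷ zs) (suc j) z (p ∷ ps) = p ∷ all-insertAt⁻ zs j z ps

    pairs-insertAt⁻ : ∀ (zs : Vec X k) j z → AllPairs _<_ (insertAt zs j z) → AllPairs _<_ zs
    pairs-insertAt⁻ zs       zero    z (_ ∷ ps) = ps
    pairs-insertAt⁻ (y ∷ zs) (suc j) z (p ∷ ps) = all-insertAt⁻ zs j z p ∷ pairs-insertAt⁻ zs j z ps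

    -- Deleting a vertex from a face leaves a face, so every insertion into a non-face is a
    -- non-face.
    supp-δ : ∀ {F} {f : Fun (suc k)} → SupportedIn F f → SupportedIn F (δ f)
    supp-δ s zs ¬face = δ-insertions _ zs λ j z → s _ λ (all , pairs) →
      ¬face (all-insertAt⁻ zs j z all , pairs-insertAt⁻ zs j z pairs)

    all-∷ʳ⁺ : ∀ {F : X → Set} {us : Vec X k} {w} → All F us → F w → All F (us ∷ʳ w)
    all-∷ʳ⁺ []       q = q ∷ []
    all-∷ʳ⁺ (p ∷ ps) q = p ∷ all-∷ʳ⁺ ps q

    all-∷ʳ⁻ : ∀ {F : X → Set} (us : Vec X k) {w} → All F (us ∷ʳ w) → All F us × F w
    all-∷ʳ⁻ []       (q ∷ []) = [] , q
    all-∷ʳ⁻ (u ∷ us) (p ∷ ps) = let ps′ , q = all-∷ʳ⁻ us ps in (p ∷ ps′) , q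

    pairs-∷ʳ⁺ : ∀ {us : Vec X k} {w} → AllPairs _<_ us → All (_< w) us → AllPairs _<_ (us ∷ʳ w)
    pairs-∷ʳ⁺ []       []       = [] ∷ []
    pairs-∷ʳ⁺ (p ∷ ps) (q ∷ qs) = all-∷ʳ⁺ p q ∷ pairs-∷ʳ⁺ ps qs

    pairs-∷ʳ⁻ : ∀ (us : Vec X k) {w} → AllPairs _<_ (us ∷ʳ w) → AllPairs _<_ us × All (_< w) us
    pairs-∷ʳ⁻ []       _        = [] , []
    pairs-∷ʳ⁻ (u ∷ us) (p ∷ ps) = let p′ , q = all-∷ʳ⁻ us p ; ps′ , qs = pairs-∷ʳ⁻ us ps in
      (p′ ∷ ps′) , (q ∷ qs)

    cone-vanishes : ∀ a (g : Fun k) zs → (∀ us → us ∷ʳ a ≡ zs → g us ≈ 0#) → cone a g zs ≈ 0#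
    cone-vanishes {zero} a g (z ∷ []) eq with z ≟ a
    ... | yes ≡.refl = eq [] ≡.refl
    ... | no  _      = refl
    cone-vanishes {suc k} a g (z ∷ zs) eq =
      trans (-‿cong (cone-vanishes a _ zs λ us us≡ → eq (z ∷ us) (≡.cong (z ∷_) us≡))) -0#≈0#

    restrict : ∀ {F : X → Set} → (∀ z → Dec (F z)) → Fun k → Fun k
    restrict F? f zs = when (VAll.all? F? zs) (f zs)

    coRestrict : ∀ {F : X → Set} → (∀ z → Dec (F z)) → Fun k → Fun k
    coRestrict F? f zs = when (¬? (VAll.all? F? zs)) (f zs)

    restrict+coRestrict : ∀ {F : X → Set} (F? : ∀ z → Dec (F z)) (f : Fun k) →
                          f ≗ λ zs → restrict F? f zs + coRestrict F? f zs
    restrict+coRestrict F? f zs with VAll.all? F? zs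
    ... | yes _ = sym (+-identityʳ _)
    ... | no  _ = sym (+-identityˡ _)

    module Cone (G : X → Set) (a : X) (Ga : G a) (G≤a : ∀ {z} → G z → z ≡ a ⊎ z < a) where

      EndsAt : Vec X (suc k) → Set
      EndsAt zs = Σ[ us ∈ Vec X _ ] us ∷ʳ a ≡ zs × All (_< a) us

      endsAt? : (zs : Vec X (suc k)) → Dec (EndsAt zs)
      endsAt? zs with Vec.initLast zs
      ... | us , w , ≡.refl with w ≟ a | VAll.all? (_<? a) us
      ... | yes ≡.refl | yes us<a = yes (us , ≡.refl , us<a)
      ... | yes ≡.refl | no  us≮a = no λ (vs , eq , vs<a) →
        us≮a (≡.subst (All (_< a)) (∷ʳ-injectiveˡ vs us eq) vs<a)
      ... | no  w≢a    | _        = no λ (vs , eq , _) → w≢a (≡.sym (∷ʳ-injectiveʳ vs us eq))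

      below-not-ending : ∀ (ws : Vec X (suc k)) → All (_< a) ws → ∀ us → us ∷ʳ a ≢ ws
      below-not-ending ws all us ≡.refl = <-irrefl (proj₂ (all-∷ʳ⁻ us all))

      ends-tail : ∀ {y} {ws : Vec X (suc k)} → EndsAt (y ∷ ws) → EndsAt ws
      ends-tail (u ∷ us , eq , _ ∷ us<a) = us , ∷-injectiveʳ eq , us<a

      ends-not-below : ∀ {z y} {ys : Vec X k} → All (_< a) (y ∷ ys) → ¬ EndsAt (z ∷ y ∷ ys)
      ends-not-below ys<a e = let us , eq , _ = ends-tail e in below-not-ending _ ys<a us eq

      ends-single : ∀ {z} → EndsAt (z ∷ []) → a ≡ z
      ends-single ([] , ≡.refl , _) = ≡.refl

      -- The only insertion into us that ends at a appends a.
      cycle-vanishes : (d : Fun (suc k)) → (∀ zs → ¬ EndsAt zs → d zs ≈ 0#) →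
                       ∀ us → All (_< a) us → δ d us ≈ 0# → d (us ∷ʳ a) ≈ 0#
      cycle-vanishes d ends [] [] eq = trans (sym (trans (Σₗ-cong elements only) (Σₓ-single a _))) eq
        where
        only : ∀ z → d (z ∷ []) ≈ when (z ≟ a) (d (a ∷ []))
        only z with z ≟ a
        ... | yes ≡.refl = refl
        ... | no  z≢a    = ends _ λ e → z≢a (≡.sym (ends-single e))
      cycle-vanishes {suc k} d ends (y ∷ ys) (y<a ∷ ys<a) eq =
        cycle-vanishes (λ ws → d (y ∷ ws)) (λ zs ¬e → ends (y ∷ zs) λ e → ¬e (ends-tail e)) ys ys<a (begin
          D                      ≈⟨ sym (-‿involutive _) ⟩
          - - D                  ≈⟨ -‿cong (sym (+-identityˡ _)) ⟩
          - (0# - D)             ≈⟨ -‿cong (+-congʳ (sym inner)) ⟩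
          - δ d (y ∷ ys)         ≈⟨ -‿cong eq ⟩
          - 0#                   ≈⟨ -0#≈0# ⟩
          0# ∎)
        where
        D = δ (λ ws → d (y ∷ ws)) ys
        inner : Σₓ (λ z → d (z ∷ y ∷ ys)) ≈ 0#
        inner = trans (Σₗ-cong elements λ z → ends _ (ends-not-below (y<a ∷ ys<a))) (Σₗ-zero elements)

      module _ (f : Fun k) (supp : SupportedIn G f) where

        base : Fun k
        base = restrict (_<? a) f

        filling : Fun (suc k)
        filling = cone a base

        base-vanishes : ∀ us → ¬ FaceIn G (us ∷ʳ a) → base us ≈ 0#
        base-vanishes us ¬face with VAll.all? (_<? a) us
        ... | yes us<a = supp us λ (all , pairs) → ¬face (all-∷ʳ⁺ all Ga , pairs-∷ʳ⁺ pairs us<a)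
        ... | no  _    = refl

        filling-supp : SupportedIn G filling
        filling-supp zs ¬face = cone-vanishes a base zs λ us us≡ →
          base-vanishes us (≡.subst (λ ws → ¬ FaceIn G ws) (≡.sym us≡) ¬face)

      ends-or-below : (zs : Vec X (suc k)) → FaceIn G zs → All (_< a) zs ⊎ EndsAt zs
      ends-or-below zs (all , pairs) with Vec.initLast zs
      ... | us , w , ≡.refl with G≤a (proj₂ (all-∷ʳ⁻ us all)) | proj₂ (pairs-∷ʳ⁻ us pairs)
      ... | inj₁ ≡.refl | us<a = inj₂ (us , ≡.refl , us<a)
      ... | inj₂ w<a    | us<w = inj₁ (all-∷ʳ⁺ (VAll.map (λ u<w → <-trans u<w w<a) us<w) w<a)

      -- Coning the part `f₀` of `f` strictly below `a` reproduces `f` on all tuples that do not end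
      -- at `a`, because there the cone over `δ f₀` vanishes. What remains is a cycle living on
      -- tuples that end at `a`, and `cycle-vanishes` applies. Only `_<_` has to be decided, not
      -- membership in `G`.
      acyclic : (f : Fun k) → SupportedIn G f → IsCycleᵟ f → Σ[ h ∈ Fun (suc k) ] SupportedIn G h × f ≗ δ h
      acyclic {zero} f supp _ = filling f supp , filling-supp f supp , λ { [] → sym (Σₓ-single a (f [])) }
      acyclic {suc k} f supp cyc = filling f supp , filling-supp f supp , λ zs → begin
          f zs                   ≈⟨ sym (+-identityʳ _) ⟩
          f zs + 0#              ≈⟨ +-congˡ (sym (-‿inverseˡ _)) ⟩
          f zs + (- h zs + h zs) ≈⟨ sym (+-assoc _ _ _) ⟩
          d zs + h zs            ≈⟨ +-congʳ (d≈0 zs) ⟩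
          0# + h zs              ≈⟨ +-identityˡ _ ⟩
          h zs ∎
        where
        f₀ : Fun (suc k)
        f₀ = base f supp
        h d : Fun (suc k)
        h = δ (filling f supp)
        d zs = f zs - h zs
        f₀≈0 : ∀ us → ¬ All (_< a) us → f₀ us ≈ 0#
        f₀≈0 us us≮a with VAll.all? (_<? a) us
        ... | yes us<a = contradiction us<a us≮a
        ... | no  _    = refl
        f≈f₀ : ∀ zs → ¬ EndsAt zs → f zs ≈ f₀ zs
        f≈f₀ zs ¬e with VAll.all? (_<? a) zs
        ... | yes _    = refl
        ... | no  zs≮a = supp zs λ face → [ zs≮a , ¬e ]′ (ends-or-below zs face)
        ends : ∀ zs → ¬ EndsAt zs → d zs ≈ 0#
        ends zs ¬e = x-x≈0 (begin
          f zs                        ≈⟨ f≈f₀ zs ¬e ⟩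
          f₀ zs                       ≈⟨ sym (+-identityʳ _) ⟩
          f₀ zs + 0#                  ≈⟨ +-congˡ (sym -0#≈0#) ⟩
          f₀ zs - 0#                  ≈⟨ +-congˡ (-‿cong (sym coned)) ⟩
          f₀ zs - cone a (δ f₀) zs    ≈⟨ sym (δ-cone a f₀ zs) ⟩
          h zs ∎)
          where
          coned : cone a (δ f₀) zs ≈ 0#
          coned = cone-vanishes a (δ f₀) zs λ us us≡ → δ-insertions f₀ us λ j z →
            f₀≈0 _ λ all → ¬e (us , us≡ , all-insertAt⁻ us j z all)
        d≈0 : ∀ zs → d zs ≈ 0#
        d≈0 zs with endsAt? zs
        ... | no  ¬e = ends zs ¬e
        ... | yes (us , us≡ , us<a) = ≡.subst (λ ws → d ws ≈ 0#) us≡ (cycle-vanishes d ends us us<a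
          (trans (δ-minus f h us) (trans (+-cong (cyc us) (trans (-‿cong (δδ≈0 (filling f supp) us)) -0#≈0#)) (+-identityˡ _))))

    lin : (Fin l → 𝕜) → (Fin l → Fun k) → Fun k
    lin r e zs = sum λ i → r i * e i zs

    δ-lin : (r : Fin l → 𝕜) (e : Fin l → Fun (suc k)) → δ (lin r e) ≗ lin r (δ ∘ e)
    δ-lin {l} r e zs = trans (δ-sum (λ i ws → r i * e i ws) zs) (sum-cong-≋ {l} λ i → δ-* (r i) (e i) zs)

    lin-minus : (r : Fin l → 𝕜) (e f : Fin l → Fun k) →
                lin r (λ i ws → e i ws - f i ws) ≗ λ zs → lin r e zs - lin r f zs
    lin-minus {zero}  r e f zs = sym (-‿inverseʳ _)
    lin-minus {suc l} r e f zs = begin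
      r zero * (e zero zs - f zero zs) + lin (r ∘ suc) (λ i ws → e (suc i) ws - f (suc i) ws) zs
        ≈⟨ +-cong (trans (distribˡ _ _ _) (+-congˡ (sym (-‿distribʳ-* _ _)))) (lin-minus (r ∘ suc) (e ∘ suc) (f ∘ suc) zs) ⟩
      (r zero * e zero zs - r zero * f zero zs) + (lin (r ∘ suc) (e ∘ suc) zs - lin (r ∘ suc) (f ∘ suc) zs)
        ≈⟨ trans (interchange _ _ _ _) (+-congˡ (-‿+-comm _ _)) ⟩
      lin r e zs - lin r f zs ∎

    lin-zero : (r : Fin l → 𝕜) (e : Fin l → Fun k) → ∀ zs → (∀ i → e i zs ≈ 0#) → lin r e zs ≈ 0#
    lin-zero r e zs eq = sum-zero _ λ i → trans (*-congˡ (eq i)) (zeroʳ _)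

    lin-supp : ∀ {F} (r : Fin l → 𝕜) (e : Fin l → Fun k) → (∀ i → SupportedIn F (e i)) → SupportedIn F (lin r e)
    lin-supp r e s = supp-sum _ λ i → supp-* (r i) (s i)

    sum-++ : ∀ l {l′} (F : Fin (l ℕ.+ l′) → 𝕜) → sum F ≈ sum (λ i → F (i ↑ˡ l′)) + sum (λ j → F (l ↑ʳ j))
    sum-++ zero    F = sym (+-identityˡ _)
    sum-++ (suc l) F = trans (+-congˡ (sum-++ l (F ∘ suc))) (sym (+-assoc _ _ _))

    join : ∀ {l l′} → (Fin l → Fun k) → (Fin l′ → Fun k) → Fin (l ℕ.+ l′) → Fun k
    join {l = l} e f i = [ e , f ]′ (splitAt l i)

    join-elim : ∀ {ℓ l l′} {e : Fin l → Fun k} {f : Fin l′ → Fun k} (Q : Fun k → Set ℓ) →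
                (∀ i → Q (e i)) → (∀ j → Q (f j)) → ∀ i → Q (join e f i)
    join-elim {l = l} Q p q i with splitAt l i
    ... | inj₁ i′ = p i′
    ... | inj₂ j′ = q j′

    lin-join : ∀ {l l′} (r : Fin (l ℕ.+ l′) → 𝕜) (e : Fin l → Fun k) (f : Fin l′ → Fun k) →
               lin r (join e f) ≗ λ zs → lin (λ i → r (i ↑ˡ l′)) e zs + lin (λ j → r (l ↑ʳ j)) f zs
    lin-join {l = l} {l′} r e f zs = trans (sum-++ l _) (+-cong
      (sum-cong-≋ {l} λ i → reflexive (≡.cong (λ s → r (i ↑ˡ l′) * [ e , f ]′ s zs) (splitAt-↑ˡ l i l′)))
      (sum-cong-≋ {l′} λ j → reflexive (≡.cong (λ s → r (l ↑ʳ j) * [ e , f ]′ s zs) (splitAt-↑ʳ l l′ j))))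

    -- `N` counts vertices, so the homology sits in degree N - 1. Cycles in `spans` and
    -- `independent` are not taken modulo boundaries: the record is meant for complexes whose faces
    -- have at most `N` vertices.
    record Concentrated (F : X → Set) (N d : ℕ) : Set (c ⊔ ℓ₁) where
      field
        acyclic     : ∀ {k} → k ℕ.< N → (f : Fun k) → SupportedIn F f → IsCycleᵟ f →
                      Σ[ h ∈ Fun (suc k) ] SupportedIn F h × f ≗ δ h
        basis       : Fin d → Fun N
        basis-supp  : ∀ i → SupportedIn F (basis i)
        basis-cycle : ∀ i → IsCycleᵟ (basis i)
        spans       : (f : Fun N) → SupportedIn F f → IsCycleᵟ f → Σ[ r ∈ (Fin d → 𝕜) ] f ≗ lin r basis
        independent : (r : Fin d → 𝕜) → (∀ zs → lin r basis zs ≈ 0#) → ∀ i → r i ≈ 0#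

    concentrated-⇔ : ∀ {F G : X → Set} {N d} → (∀ {z} → F z → G z) → (∀ {z} → G z → F z) →
                     Concentrated F N d → Concentrated G N d
    concentrated-⇔ F⊆G G⊆F C = record
      { acyclic     = λ k<N f supp cyc → let h , h-supp , eq = acyclic k<N f (supp-mono G⊆F supp) cyc in
                        h , supp-mono F⊆G h-supp , eq
      ; basis       = basis
      ; basis-supp  = λ i → supp-mono F⊆G (basis-supp i)
      ; basis-cycle = basis-cycle
      ; spans       = λ f supp cyc → spans f (supp-mono G⊆F supp) cyc
      ; independent = independent
      }
      where open Concentrated C

    -- The only face is the empty one. It is a cycle and bounds nothing, which gives one class in
    -- degree -1.
    concentrated-empty : ∀ {F : X → Set} → (∀ {z} → ¬ F z) → Concentrated F 0 1
    concentrated-empty ¬F = record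
      { acyclic     = λ ()
      ; basis       = λ _ _ → 1#
      ; basis-supp  = λ { _ [] ¬face → contradiction ([] , []) ¬face }
      ; basis-cycle = λ _ → tt
      ; spans       = λ f _ _ → (λ _ → f []) , λ { [] → sym (trans (+-identityʳ _) (*-identityʳ _)) }
      ; independent = λ { r eq zero → trans (sym (trans (+-identityʳ _) (*-identityʳ _))) (eq []) }
      }

    -- A cycle on `N` vertices is the boundary of a chain on N + 1 vertices, and `none` makes that
    -- chain zero; hence the empty basis.
    concentrated-cone : ∀ (G : X → Set) (a : X) → G a → (∀ {z} → G z → z ≡ a ⊎ z < a) → ∀ {N} →
                        ((zs : Vec X (suc N)) → ¬ FaceIn G zs) → Concentrated G N 0
    concentrated-cone G a Ga G≤a none = record
      { acyclic     = λ _ → Cone.acyclic G a Ga G≤a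
      ; basis       = λ ()
      ; basis-supp  = λ ()
      ; basis-cycle = λ ()
      ; spans       = λ f supp cyc → let h , h-supp , eq = Cone.acyclic G a Ga G≤a f supp cyc in
                        (λ ()) , λ zs → trans (eq zs) (δ-zero h (λ ws → h-supp ws (none ws)) zs)
      ; independent = λ _ _ ()
      }

    -- In the application `F` is D_A and `G` the part of the interval up to the new coatom `a`. Both
    -- are down-closed in their union, so the largest vertex of a chain decides on which side the
    -- whole chain lies.
    module MayerVietoris
      (F G : X → Set) (F? : ∀ z → Dec (F z))
      (F-down : ∀ {z w} → z < w → F w → F z ⊎ G z → F z)
      (G-down : ∀ {z w} → z < w → G w → F z ⊎ G z → G z)
      (a : X) (Ga : G a) (¬Fa : ¬ F a) (G≤a : ∀ {z} → G z → z ≡ a ⊎ z < a) where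

      U I : X → Set
      U z = F z ⊎ G z
      I z = F z × G z

      all-F-or-G : (zs : Vec X k) → FaceIn U zs → All F zs ⊎ All G zs
      all-F-or-G []           _ = inj₁ []
      all-F-or-G (z ∷ [])     (inj₁ Fz ∷ [] , _) = inj₁ (Fz ∷ [])
      all-F-or-G (z ∷ [])     (inj₂ Gz ∷ [] , _) = inj₂ (Gz ∷ [])
      all-F-or-G (z ∷ w ∷ zs) (Uz ∷ us , (z<w ∷ _) ∷ ps) with all-F-or-G (w ∷ zs) (us , ps)
      ... | inj₁ (Fw ∷ fs) = inj₁ (F-down z<w Fw Uz ∷ Fw ∷ fs)
      ... | inj₂ (Gw ∷ gs) = inj₂ (G-down z<w Gw Uz ∷ Gw ∷ gs)

      inF inG : Fun k → Fun k
      inF = restrict F?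
      inG = coRestrict F?

      split : (f : Fun k) → f ≗ λ zs → inF f zs + inG f zs
      split = restrict+coRestrict F?

      inF-supp : {f : Fun k} → SupportedIn U f → SupportedIn F (inF f)
      inF-supp supp zs ¬face with VAll.all? F? zs
      ... | yes all = supp zs λ (_ , pairs) → ¬face (all , pairs)
      ... | no  _   = refl

      inG-supp : {f : Fun k} → SupportedIn U f → SupportedIn G (inG f)
      inG-supp supp zs ¬face with VAll.all? F? zs
      ... | yes _   = refl
      ... | no ¬all = supp zs λ face → [ ¬all , (λ all → ¬face (all , proj₂ face)) ]′ (all-F-or-G zs face)

      supp-I : {f : Fun k} → SupportedIn F f → SupportedIn G f → SupportedIn I f
      supp-I sF sG zs ¬face with VAll.all? F? zs
      ... | yes fs = sG zs λ (gs , pairs) → ¬face (VAll.zip (fs , gs) , pairs)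
      ... | no ¬fs = sF zs λ (fs , _) → ¬fs fs

      δ-inG : (f : Fun (suc k)) → IsCycleᵟ f → δ (inG f) ≗ λ zs → - δ (inF f) zs
      δ-inG f cyc zs = begin
        δ (inG f) zs                                          ≈⟨ sym (+-identityˡ _) ⟩
        0# + δ (inG f) zs                                     ≈⟨ +-congʳ (sym (-‿inverseˡ _)) ⟩
        (- δ (inF f) zs + δ (inF f) zs) + δ (inG f) zs        ≈⟨ +-assoc _ _ _ ⟩
        - δ (inF f) zs + (δ (inF f) zs + δ (inG f) zs)        ≈⟨ +-congˡ (sym (δ-+ (inF f) (inG f) zs)) ⟩
        - δ (inF f) zs + δ (λ ws → inF f ws + inG f ws) zs    ≈⟨ +-congˡ (trans (sym (δ-cong (split f) zs)) (cyc zs)) ⟩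
        - δ (inF f) zs + 0#                                   ≈⟨ +-identityʳ _ ⟩
        - δ (inF f) zs ∎

      -- This is the connecting homomorphism: for a cycle, the boundaries of the two parts are
      -- opposite, so each is supported on both sides.
      δ-inG-supp : {f : Fun (suc k)} → SupportedIn U f → IsCycleᵟ f → SupportedIn I (δ (inG f))
      δ-inG-supp {f = f} supp cyc = supp-I
        (supp-cong (λ zs → sym (δ-inG f cyc zs)) (supp-neg (supp-δ (inF-supp supp))))
        (supp-δ (inG-supp supp))

      regroup : ∀ {x y z : 𝕜} → x + y ≈ (x + z) + (y - z)
      regroup {x} {y} {z} = sym (begin
        (x + z) + (y - z)   ≈⟨ +-congˡ (+-comm _ _) ⟩
        (x + z) + (- z + y) ≈⟨ interchange _ _ _ _ ⟩
        (x - z) + (z + y)   ≈⟨ +-assoc _ _ _ ⟩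
        x + (- z + (z + y)) ≈⟨ +-congˡ (trans (sym (+-assoc _ _ _)) (trans (+-congʳ (-‿inverseˡ _)) (+-identityˡ _))) ⟩
        x + y ∎)

      module _ {N d d′ : ℕ} (CF : Concentrated F (suc N) d) (CI : Concentrated I N d′)
               (none : (zs : Vec X (suc (suc N))) → ¬ FaceIn G zs) where

        private
          module CF = Concentrated CF
          module CI = Concentrated CI

        union-acyclic : ∀ {k} → k ℕ.< suc N → (f : Fun k) → SupportedIn U f → IsCycleᵟ f →
                        Σ[ h ∈ Fun (suc k) ] SupportedIn U h × f ≗ δ h
        union-acyclic {zero} k<N f supp _ =
          -- In degree -1 there is only the empty tuple, and `F` alone already bounds it.
          let h , h-supp , eq = CF.acyclic k<N f (λ { [] ¬face → contradiction ([] , []) ¬face }) tt in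
          h , supp-mono inj₁ h-supp , eq
        union-acyclic {suc k} (ℕ.s≤s k<N) f supp cyc =
          (λ ws → h₁ ws + h₂ ws) , supp-+ (supp-mono inj₁ h₁-supp) (supp-mono inj₂ h₂-supp) , λ zs → begin
            f zs                                    ≈⟨ split f zs ⟩
            inF f zs + inG f zs                     ≈⟨ regroup ⟩
            (inF f zs + h zs) + (inG f zs - h zs)   ≈⟨ +-cong (eq₁ zs) (eq₂ zs) ⟩
            δ h₁ zs + δ h₂ zs                       ≈⟨ sym (δ-+ h₁ h₂ zs) ⟩
            δ (λ ws → h₁ ws + h₂ ws) zs ∎
          where
          -- The connecting cycle bounds some `h` in the intersection. Moving `h` from the `G`-part
          -- to the `F`-part makes both of them cycles.
          filled = CI.acyclic k<N (δ (inG f)) (δ-inG-supp supp cyc) (cycle-δ (inG f))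
          h = proj₁ filled
          h-supp = proj₁ (proj₂ filled)
          h-eq = proj₂ (proj₂ filled)
          part₁ = CF.acyclic (ℕ.s≤s k<N) (λ zs → inF f zs + h zs)
            (supp-+ (inF-supp supp) (supp-mono proj₁ h-supp))
            (λ zs → begin
              δ (λ ws → inF f ws + h ws) zs ≈⟨ δ-+ (inF f) h zs ⟩
              δ (inF f) zs + δ h zs         ≈⟨ +-congˡ (trans (sym (h-eq zs)) (δ-inG f cyc zs)) ⟩
              δ (inF f) zs - δ (inF f) zs   ≈⟨ -‿inverseʳ _ ⟩
              0# ∎)
          h₁ = proj₁ part₁
          h₁-supp = proj₁ (proj₂ part₁)
          eq₁ = proj₂ (proj₂ part₁)
          part₂ = Cone.acyclic G a Ga G≤a (λ zs → inG f zs - h zs)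
            (supp-+ (inG-supp supp) (supp-neg (supp-mono proj₂ h-supp)))
            (λ zs → trans (δ-minus (inG f) h zs) (x-x≈0 (h-eq zs)))
          h₂ = proj₁ part₂
          h₂-supp = proj₁ (proj₂ part₂)
          eq₂ = proj₂ (proj₂ part₂)

        -- The top cycles of the intersection have `N` vertices, one fewer than the only homology of
        -- `F`, so they bound in `F`.
        filled : ∀ j → Σ[ g ∈ Fun (suc N) ] SupportedIn F g × CI.basis j ≗ δ g
        filled j = CF.acyclic (ℕₚ.n<1+n N) (CI.basis j) (supp-mono proj₁ (CI.basis-supp j)) (CI.basis-cycle j)

        g : Fin d′ → Fun (suc N)
        g j = proj₁ (filled j)

        coned : Fin d′ → Fun (suc N)
        coned j = cone a (CI.basis j)

        coned-supp : ∀ {f : Fun N} → SupportedIn I f → SupportedIn G (cone a f)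
        coned-supp {f} supp zs ¬face = cone-vanishes a f zs λ us us≡ → supp us λ (is , pairs) →
          let below = VAll.map I⇒<a is in
          ¬face (≡.subst (FaceIn G) us≡ (all-∷ʳ⁺ (VAll.map proj₂ is) Ga , pairs-∷ʳ⁺ pairs below))
          where
          I⇒<a : ∀ {z} → I z → z < a
          I⇒<a (Fz , Gz) with G≤a Gz
          ... | inj₁ ≡.refl = contradiction Fz ¬Fa
          ... | inj₂ z<a    = z<a

        δ-cone-cycle : ∀ {n} (f : Fun n) → IsCycleᵟ f → δ (cone a f) ≗ f
        δ-cone-cycle {zero}  f _   = δ-cone₀ a f
        δ-cone-cycle {suc n} f cyc zs = begin
          δ (cone a f) zs          ≈⟨ δ-cone a f zs ⟩
          f zs - cone a (δ f) zs   ≈⟨ +-congˡ (trans (-‿cong (cone-zero a (δ f) cyc zs)) -0#≈0#) ⟩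
          f zs + 0#                ≈⟨ +-identityʳ _ ⟩
          f zs ∎

        -- Two fillings of the same intersection cycle, one on each side, glued along it: the class
        -- that the connecting homomorphism sends back to `CI.basis j`.
        new : Fin d′ → Fun (suc N)
        new j zs = coned j zs - g j zs

        new-supp : ∀ j → SupportedIn U (new j)
        new-supp j = supp-+ (supp-mono inj₂ (coned-supp (CI.basis-supp j)))
                            (supp-neg (supp-mono inj₁ (proj₁ (proj₂ (filled j)))))

        new-cycle : ∀ j → IsCycleᵟ (new j)
        new-cycle j zs = trans (δ-minus (coned j) (g j) zs)
          (x-x≈0 (trans (δ-cone-cycle (CI.basis j) (CI.basis-cycle j) zs) (proj₂ (proj₂ (filled j)) zs)))

        apex-vanishes : ∀ {f : Fun N} → SupportedIn I f → ∀ zs → All F zs → cone a f zs ≈ 0#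
        apex-vanishes {f} supp zs fs = cone-vanishes a f zs λ us us≡ →
          contradiction (proj₂ (all-∷ʳ⁻ us (≡.subst (All F) (≡.sym us≡) fs))) ¬Fa

        union-spans : (f : Fun (suc N)) → SupportedIn U f → IsCycleᵟ f →
                      Σ[ r ∈ (Fin (d ℕ.+ d′) → 𝕜) ] f ≗ lin r (join CF.basis new)
        union-spans f supp cyc = r , λ zs → begin
            f zs
              ≈⟨ split f zs ⟩
            inF f zs + inG f zs
              ≈⟨ regroup ⟩
            (inF f zs + lin s g zs) + (inG f zs - lin s g zs)
              ≈⟨ +-cong (proj₂ old zs) (+-congʳ (inG-eq zs)) ⟩
            lin t CF.basis zs + (lin s coned zs - lin s g zs)
              ≈⟨ +-cong (sum-cong-≋ {d} λ i → *-congʳ (reflexive (≡.sym (r-old i))))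
                        (trans (sym (lin-minus s coned g zs)) (sum-cong-≋ {d′} λ j → *-congʳ (reflexive (≡.sym (r-new j))))) ⟩
            lin (λ i → r (i ↑ˡ d′)) CF.basis zs + lin (λ j → r (d ↑ʳ j)) new zs
              ≈⟨ sym (lin-join r CF.basis new zs) ⟩
            lin r (join CF.basis new) zs ∎
          where
          edge = CI.spans (δ (inG f)) (δ-inG-supp supp cyc) (cycle-δ (inG f))
          s = proj₁ edge
          -- Both sides have the same boundary. Their difference is a cycle in the cone `G`, hence
          -- bounds a chain on N + 2 vertices, and by `none` that chain is zero.
          inG-eq : inG f ≗ lin s coned
          inG-eq zs = begin
            inG f zs                                                  ≈⟨ sym (+-identityʳ _) ⟩
            inG f zs + 0#                                             ≈⟨ +-congˡ (sym (-‿inverseˡ _)) ⟩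
            inG f zs + (- lin s coned zs + lin s coned zs)            ≈⟨ sym (+-assoc _ _ _) ⟩
            (inG f zs - lin s coned zs) + lin s coned zs              ≈⟨ +-congʳ (trans (proj₂ (proj₂ bound) zs)
                                                                          (δ-zero _ (λ ws → proj₁ (proj₂ bound) ws (none ws)) zs)) ⟩
            0# + lin s coned zs                                       ≈⟨ +-identityˡ _ ⟩
            lin s coned zs ∎
            where
            bound = Cone.acyclic G a Ga G≤a (λ ws → inG f ws - lin s coned ws)
              (supp-+ (inG-supp supp) (supp-neg (lin-supp s coned λ j → coned-supp (CI.basis-supp j))))
              (λ ws → trans (δ-minus (inG f) (lin s coned) ws) (x-x≈0 (begin
                δ (inG f) ws           ≈⟨ proj₂ edge ws ⟩
                lin s CI.basis ws      ≈⟨ sum-cong-≋ {d′} (λ j → *-congˡ (sym (δ-cone-cycle (CI.basis j) (CI.basis-cycle j) ws))) ⟩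
                lin s (δ ∘ coned) ws   ≈⟨ sym (δ-lin s coned ws) ⟩
                δ (lin s coned) ws ∎)))
          old = CF.spans (λ zs → inF f zs + lin s g zs)
            (supp-+ (inF-supp supp) (lin-supp s g λ j → proj₁ (proj₂ (filled j))))
            (λ zs → begin
              δ (λ ws → inF f ws + lin s g ws) zs  ≈⟨ δ-+ (inF f) (lin s g) zs ⟩
              δ (inF f) zs + δ (lin s g) zs        ≈⟨ +-congˡ (δ-lin s g zs) ⟩
              δ (inF f) zs + lin s (δ ∘ g) zs      ≈⟨ +-congˡ (sum-cong-≋ {d′} (λ j → *-congˡ (sym (proj₂ (proj₂ (filled j)) zs)))) ⟩
              δ (inF f) zs + lin s CI.basis zs     ≈⟨ +-congˡ (trans (sym (proj₂ edge zs)) (δ-inG f cyc zs)) ⟩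
              δ (inF f) zs - δ (inF f) zs          ≈⟨ -‿inverseʳ _ ⟩
              0# ∎)
          t = proj₁ old
          r : Fin (d ℕ.+ d′) → 𝕜
          r i = [ t , s ]′ (splitAt d i)
          r-old : ∀ i → r (i ↑ˡ d′) ≡ t i
          r-old i = ≡.cong [ t , s ]′ (splitAt-↑ˡ d i d′)
          r-new : ∀ j → r (d ↑ʳ j) ≡ s j
          r-new j = ≡.cong [ t , s ]′ (splitAt-↑ʳ d d′ j)

        module _ (r : Fin (d ℕ.+ d′) → 𝕜) (eq : ∀ zs → lin r (join CF.basis new) zs ≈ 0#) where

          private
            t = λ i → r (i ↑ˡ d′)
            s = λ j → r (d ↑ʳ j)

          relation : ∀ zs → lin t CF.basis zs + lin s new zs ≈ 0#
          relation zs = trans (sym (lin-join r CF.basis new zs)) (eq zs)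

          cones-in-F : lin s coned ≗ λ zs → lin s g zs - lin t CF.basis zs
          cones-in-F zs = begin
            C                           ≈⟨ sym (+-identityʳ _) ⟩
            C + 0#                      ≈⟨ +-congˡ (sym (-‿inverseˡ _)) ⟩
            C + (- S + S)               ≈⟨ sym (+-assoc _ _ _) ⟩
            (C - S) + S                 ≈⟨ +-congʳ (sym (lin-minus s coned g zs)) ⟩
            lin s new zs + S            ≈⟨ +-congʳ (sym (+-identityˡ _)) ⟩
            (0# + lin s new zs) + S     ≈⟨ +-congʳ (+-congʳ (sym (-‿inverseˡ _))) ⟩
            ((- T + T) + lin s new zs) + S ≈⟨ +-congʳ (+-assoc _ _ _) ⟩
            (- T + (T + lin s new zs)) + S ≈⟨ +-congʳ (trans (+-congˡ (relation zs)) (+-identityʳ _)) ⟩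
            - T + S                     ≈⟨ +-comm _ _ ⟩
            S - T ∎
            where
            C = lin s coned zs
            S = lin s g zs
            T = lin t CF.basis zs

          -- Inside `F` the cones vanish because their tuples end at `a`, which is not in `F`.
          -- Outside `F` they vanish because the relation writes them as a chain supported in `F`.
          cones-vanish : ∀ zs → lin s coned zs ≈ 0#
          cones-vanish zs with VAll.all? F? zs
          ... | yes fs = lin-zero s coned zs λ j → apex-vanishes (CI.basis-supp j) zs fs
          ... | no ¬fs = trans (cones-in-F zs) (supp-+ (lin-supp s g λ j → proj₁ (proj₂ (filled j)))
            (supp-neg (lin-supp t CF.basis CF.basis-supp)) zs λ (fs , _) → ¬fs fs)

          s≈0 : ∀ j → s j ≈ 0#
          s≈0 = CI.independent s λ zs → begin
            lin s CI.basis zs      ≈⟨ sum-cong-≋ {d′} (λ j → *-congˡ (sym (δ-cone-cycle (CI.basis j) (CI.basis-cycle j) zs))) ⟩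
            lin s (δ ∘ coned) zs   ≈⟨ sym (δ-lin s coned zs) ⟩
            δ (lin s coned) zs     ≈⟨ δ-zero _ cones-vanish zs ⟩
            0# ∎

          t≈0 : ∀ i → t i ≈ 0#
          t≈0 = CF.independent t λ zs → begin
            lin t CF.basis zs                      ≈⟨ sym (+-identityʳ _) ⟩
            lin t CF.basis zs + 0#                 ≈⟨ +-congˡ (sym (sum-zero _ λ j → trans (*-congʳ (s≈0 j)) (zeroˡ _))) ⟩
            lin t CF.basis zs + lin s new zs       ≈⟨ relation zs ⟩
            0# ∎

          union-independent : ∀ i → r i ≈ 0#
          union-independent i with splitAt d i in split≡
          ... | inj₁ i′ = ≡.subst (λ j → r j ≈ 0#) (splitAt⁻¹-↑ˡ split≡) (t≈0 i′)
          ... | inj₂ j′ = ≡.subst (λ j → r j ≈ 0#) (splitAt⁻¹-↑ʳ split≡) (s≈0 j′)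

        union-concentrated : Concentrated U (suc N) (d ℕ.+ d′)
        union-concentrated = record
          { acyclic     = union-acyclic
          ; basis       = join CF.basis new
          ; basis-supp  = join-elim (SupportedIn U) (λ i → supp-mono inj₁ (CF.basis-supp i)) new-supp
          ; basis-cycle = join-elim IsCycleᵟ CF.basis-cycle new-cycle
          ; spans       = union-spans
          ; independent = union-independent
          }

    module _ {o y : X} where

      private module H = Homology K P o y

      cycle⇒ : (f : H.Chain k) → H.IsCycle f → IsCycleᵟ (H.coeff f)
      cycle⇒ {zero}  f _ = tt
      cycle⇒ {suc k} f cyc zs = trans (sym (∂≈δ {o = o} {y} (H.coeff f) zs)) (cyc zs)

      ⇒cycle : (f : H.Chain k) → IsCycleᵟ (H.coeff f) → H.IsCycle f
      ⇒cycle {zero}  f _ = tt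
      ⇒cycle {suc k} f cyc zs = trans (∂≈δ {o = o} {y} (H.coeff f) zs) (cyc zs)

      -- By `none` every chain on more than `N` vertices is zero: nothing has to be divided out in
      -- the top degree, and there is no homology above it.
      concentrated⇒unique : ∀ {N d} → d ≢ 0 → Concentrated (λ z → o < z × z < y) N d →
        (∀ {k} → N ℕ.< k → (zs : Vec X k) → ¬ FaceIn (λ z → o < z × z < y) zs) →
        UniqueNonvanishingDimension K P o y d
      concentrated⇒unique {N} {d} d≢0 C none = d≢0 , N ,
        ( (λ i → record { coeff = basis i ; support = basis-supp i } , ⇒cycle _ (basis-cycle i))
        , (λ (f , cyc) → let r , eq = spans (H.coeff f) (H.support f) (cycle⇒ f cyc) in
            r , record { coeff = λ _ → 0# ; support = λ _ _ → refl } ,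
            λ zs → trans (eq zs) (sym (trans (+-congˡ (trans (∂≈δ {o = o} {y} _ zs) (δ-zero _ (λ _ → refl) zs))) (+-identityʳ _))))
        , λ r (h , eq) → independent r λ zs → trans (eq zs) (trans (+-identityˡ _)
            (trans (∂≈δ {o = o} {y} (H.coeff h) zs) (δ-zero _ (λ ws → H.support h ws (none (ℕₚ.n<1+n N) ws)) zs)))
        ) , λ k k≢N → (λ ()) ,
        (λ (f , cyc) → (λ ()) , bounds k k≢N f cyc) , λ _ _ ()
        where
        open Concentrated C
        bounds : ∀ k → k ≢ N → (f : H.Chain k) → H.IsCycle f → H._∼_ (H.coeff f) (λ _ → 0#)
        bounds k k≢N f cyc with ℕₚ.<-cmp k N
        ... | tri< k<N _ _ = let h , h-supp , eq = acyclic k<N (H.coeff f) (H.support f) (cycle⇒ f cyc) in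
          record { coeff = h ; support = h-supp } ,
          λ zs → trans (eq zs) (sym (trans (+-identityˡ _) (∂≈δ {o = o} {y} h zs)))
        ... | tri≈ _ k≡N _ = contradiction k≡N k≢N
        ... | tri> _ _ N<k = record { coeff = λ _ → 0# ; support = λ _ _ → refl } , λ zs →
          trans (H.support f zs (none N<k zs)) (sym (trans (+-identityˡ _)
            (trans (∂≈δ {o = o} {y} _ zs) (δ-zero _ (λ _ → refl) zs))))

-- Recursive coatom orderings, homology and Möbius numbers of intervals

module CoatomOrderings where

  open FiniteSums
  open MöbiusFunctions
  open OrderComplexes
  open import Algebra.Apartness.Bundles using (HeytingField)
  open import Data.Integer.Base as ℤ using (ℤ; +_; 0ℤ; -1ℤ)
  import Data.Integer.Properties as ℤₚ
  open import Data.List.Base as List using (List; []; _∷_; _++_; filter)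
  open import Data.List.Membership.Propositional using () renaming (_∈_ to _∈ₗ_)
  open import Data.List.Membership.Propositional.Properties using (∈-filter⁺; ∈-filter⁻; ∈-++⁺ˡ; ∈-++⁺ʳ; ∈-++⁻)
  open import Data.List.Relation.Unary.Any as LAny using (Any; here; there)
  open import Data.List.Relation.Unary.AllPairs as LAP using ()
  open import Data.List.Relation.Unary.All as LAll using ()
  import Data.List.Relation.Unary.All.Properties as LAllₚ
  open import Data.List.Relation.Unary.Unique.Propositional using (Unique)
  import Data.List.Relation.Unary.Unique.Propositional.Properties as Uniqueₚ
  open import Data.Nat.Base as ℕ using (ℕ; zero; suc)
  import Data.Nat.Properties as ℕₚ
  open import Data.Product.Base using (Σ-syntax; _×_; _,_; proj₁; proj₂)
  open import Data.Sum.Base using (_⊎_; inj₁; inj₂; [_,_]′)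
  import Level
  open import Data.Unit.Base using (⊤; tt)
  open import Data.Empty using (⊥)
  open import Data.Vec.Base as Vec using (Vec; []; _∷_)
  import Data.Vec.Relation.Unary.All as VAll
  open VAll using (All; []; _∷_)
  import Data.Vec.Relation.Unary.AllPairs as VAP
  open VAP using (AllPairs; []; _∷_)
  open import Function.Base using (_∘_)
  open import Relation.Binary.PropositionalEquality as ≡ using (_≡_; _≢_; refl; sym; trans; cong; cong₂; subst)
  open import Relation.Nullary using (¬_; Dec; yes; no; contradiction)
  open import Relation.Nullary.Decidable using (_×-dec_; ¬?)

  open Sums ℤₚ.+-*-commutativeRing

  sgn : ℕ → ℤ
  sgn k = -1ℤ ℤ.^ k

  sgn-suc : ∀ k → sgn (suc k) ≡ ℤ.- sgn k
  sgn-suc k = ℤₚ.-1*i≡-i (sgn k)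

  -- A recursive coatom ordering lists the special coatoms first; within the two classes the
  -- order is arbitrary.
  record Shelling (P : FinitePoset) : Set₁ where
    open FinitePoset P renaming (Carrier to X)
    field
      ρ        : X → ℕ
      ρ-mono   : ∀ {x y} → x < y → ρ x ℕ.< ρ y
      Special  : X → X → Set
      special? : ∀ u y → Dec (Special u y)

    infix 4 _⋖_
    _⋖_ : X → X → Set
    u ⋖ y = u ≤ y × suc (ρ u) ≡ ρ y

    _⋖?_ : ∀ u y → Dec (u ⋖ y)
    u ⋖? y = (u ≤? y) ×-dec (suc (ρ u) ℕₚ.≟ ρ y)

    field
      coatom       : ∀ {x y} → x < y → Σ[ u ∈ X ] x ≤ u × u ⋖ y
      -- For `u` listed before `v`, the common lower bound `x` lies below a coatom `b` of `v` that
      -- is below an earlier coatom of `y`. In the second alternative this is `w` in place of `u`: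
      -- being special, it precedes the nonspecial `v`.
      meet         : ∀ {x u v y} → u ⋖ y → v ⋖ y → u ≢ v → x ≤ u → x ≤ v →
                     Σ[ b ∈ X ] x ≤ b × b ⋖ v ×
                       (b ≤ u ⊎ (¬ Special v y × Σ[ w ∈ X ] w ⋖ y × Special w y × b ≤ w))
      -- This field and the next one make the ordering recursive. The coatoms of `v` below earlier
      -- ones are all special if `v` is special, and include all special ones if it is not.
      special-meet : ∀ {b u v y} → u ⋖ y → v ⋖ y → u ≢ v → Special u y → Special v y →
                     b ⋖ v → b ≤ u → Special b v
      special-lift : ∀ {b v y} → v ⋖ y → ¬ Special v y → b ⋖ v → Special b v →
                     Σ[ w ∈ X ] w ⋖ y × Special w y × b ≤ w

    -- No interval of length two is a chain. In the induction this gives the coatom added last a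
    -- nonzero contribution to the dimension.
    Thick : Set
    Thick = ∀ {b a y} → b ⋖ a → a ⋖ y → Σ[ a′ ∈ X ] a′ ≢ a × b ≤ a′ × a′ ⋖ y

  module _ {c ℓ₁ ℓ₂} (K : HeytingField c ℓ₁ ℓ₂) {P : FinitePoset} (S : Shelling P) where

    open FinitePoset P renaming (Carrier to X)
    open Shelling S
    open Möbius P
    open Chains K P using (FaceIn; Concentrated; concentrated-⇔; concentrated-empty; concentrated-cone; module MayerVietoris; concentrated⇒unique; <-trans)

    ≤∧≢-rank : ∀ {x y} → x ≤ y → ρ x ≡ ρ y → x ≡ y
    ≤∧≢-rank {x} {y} x≤y ρ≡ with x ≟ y
    ... | yes x≡y = x≡y
    ... | no  x≢y = contradiction ρ≡ (ℕₚ.<⇒≢ (ρ-mono (x≤y , x≢y)))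

    ⋖⇒< : ∀ {u y} → u ⋖ y → u < y
    ⋖⇒< (u≤y , eq) = u≤y , λ { refl → ℕₚ.1+n≢n eq }

    ≤-<-trans : ∀ {x y z} → x ≤ y → y < z → x < z
    ≤-<-trans x≤y (y≤z , y≢z) = ≤-trans x≤y y≤z , λ { refl → y≢z (≤-antisym y≤z x≤y) }

    chain-length : ∀ {k lo hi} (zs : Vec X k) → lo ℕ.< hi → All (λ z → lo ℕ.< ρ z × ρ z ℕ.< hi) zs →
                   AllPairs _<_ zs → k ℕ.+ lo ℕ.< hi
    chain-length []       lo<hi _ _ = lo<hi
    chain-length {suc k} {lo} (z ∷ zs) _ ((lo<z , z<hi) ∷ bounds) (z<zs ∷ pairs) =
      ℕₚ.≤-<-trans (ℕₚ.≤-trans (ℕₚ.≤-reflexive (sym (ℕₚ.+-suc k lo))) (ℕₚ.+-monoʳ-≤ k lo<z))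
        (chain-length zs z<hi (VAll.map (λ ((_ , w<hi) , z<w) → ρ-mono z<w , w<hi) (VAll.zip (bounds , z<zs))) pairs)

    module _ (o : X) where

      Coatom : X → X → Set
      Coatom y u = o ≤ u × u ⋖ y

      coatom? : ∀ y u → Dec (Coatom y u)
      coatom? y u = (o ≤? u) ×-dec (u ⋖? y)

      -- Lists are read from the back: the head is added last, either while only special coatoms
      -- have been listed or after all of these have.
      Ordered : X → List X → Set
      Ordered y []      = ⊤
      Ordered y (a ∷ A) = Ordered y A ×
        ((Special a y × LAll.All (λ u → Special u y) A) ⊎
         (¬ Special a y × (∀ w → Coatom y w → Special w y → w ∈ₗ A)))

      record Valid (y : X) (A : List X) : Set where
        field
          coatoms : LAll.All (Coatom y) A
          unique! : Unique A
          ordered : Ordered y A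

      module _ (y : X) {Q : X → Set} (Q? : ∀ u → Dec (Q u)) where

        plain? : ∀ u → Dec (Coatom y u × Q u × ¬ Special u y)
        plain? u = coatom? y u ×-dec Q? u ×-dec ¬? (special? u y)

        spec? : ∀ u → Dec (Coatom y u × Q u × Special u y)
        spec? u = coatom? y u ×-dec Q? u ×-dec special? u y

        -- The nonspecial coatoms stand in front because the head of a list is the coatom added
        -- last.
        coatomList : List X
        coatomList = filter plain? elements ++ filter spec? elements

        ∈-coatomList⁺ : ∀ {u} → Coatom y u → Q u → u ∈ₗ coatomList
        ∈-coatomList⁺ {u} cu qu with special? u y
        ... | yes su = ∈-++⁺ʳ _ (∈-filter⁺ spec? (complete u) (cu , qu , su))
        ... | no ¬su = ∈-++⁺ˡ (∈-filter⁺ plain? (complete u) (cu , qu , ¬su))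

        ∈-coatomList⁻ : ∀ {u} → u ∈ₗ coatomList → Coatom y u × Q u
        ∈-coatomList⁻ u∈ with ∈-++⁻ (filter plain? elements) u∈
        ... | inj₁ u∈′ = let _ , cu , qu , _ = ∈-filter⁻ plain? {xs = elements} u∈′ in cu , qu
        ... | inj₂ u∈′ = let _ , cu , qu , _ = ∈-filter⁻ spec? {xs = elements} u∈′ in cu , qu

        all-special-ordered : ∀ {A} → LAll.All (λ u → Special u y) A → Ordered y A
        all-special-ordered LAll.[]       = tt
        all-special-ordered (p LAll.∷ ps) = all-special-ordered ps , inj₁ (p , ps)

        coatomList-valid : (∀ u → Coatom y u → Q u → Special u y) ⊎ (∀ w → Coatom y w → Special w y → Q w) →
                           Valid y coatomList
        coatomList-valid dichotomy = record
          { coatoms = LAll.tabulate λ u∈ → proj₁ (∈-coatomList⁻ u∈)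
          ; unique! = Uniqueₚ.++⁺ (Uniqueₚ.filter⁺ plain? unique) (Uniqueₚ.filter⁺ spec? unique)
              λ (u∈ , u∈′) → let _ , _ , _ , ¬su = ∈-filter⁻ plain? {xs = elements} u∈
                                 _ , _ , _ , su = ∈-filter⁻ spec? {xs = elements} u∈′ in ¬su su
          ; ordered = prefix (filter plain? elements) (LAllₚ.all-filter plain? elements)
          }
          where
          prefix : ∀ L → LAll.All (λ u → Coatom y u × Q u × ¬ Special u y) L → Ordered y (L ++ filter spec? elements)
          prefix []      _ = all-special-ordered (LAll.map (λ (_ , _ , su) → su) (LAllₚ.all-filter spec? elements))
          prefix (u ∷ L) ((cu , qu , ¬su) LAll.∷ ps) = prefix L ps , inj₂ (¬su , contains dichotomy)
            where
            contains : (∀ u → Coatom y u → Q u → Special u y) ⊎ (∀ w → Coatom y w → Special w y → Q w) →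
                       ∀ w → Coatom y w → Special w y → w ∈ₗ L ++ filter spec? elements
            contains (inj₁ ⊆Sp) = contradiction (⊆Sp u cu qu) ¬su
            contains (inj₂ ⊇Sp) w cw sw = ∈-++⁺ʳ L (∈-filter⁺ spec? (complete w) (cw , ⊇Sp w cw sw , sw))

      Below : List X → X → Set
      Below A z = Any (z ≤_) A

      below? : ∀ A z → Dec (Below A z)
      below? A z = LAny.any? (z ≤?_) A

      below-down : ∀ {A z w} → z ≤ w → Below A w → Below A z
      below-down z≤w = LAny.map (≤-trans z≤w)

      Open Closed : List X → X → Set
      Open   A z = o < z × Below A z
      Closed A z = o ≤ z × Below A z

      closed? : ∀ A z → Dec (Closed A z)
      closed? A z = (o ≤? z) ×-dec below? A z

      -- Minus the reduced Euler characteristic of D_A, expressed by Möbius values. The element `o`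
      -- is included, so that the value becomes -μ(o , y) as soon as `A` contains all coatoms.
      χ : List X → ℤ
      χ A = Σₗ elements λ z → when (closed? A z) (μ P o z)

      record Result (y : X) (A : List X) (N : ℕ) : Set (c Level.⊔ ℓ₁) where
        field
          d            : ℕ
          concentrated : Concentrated (Open A) N d
          euler        : χ A ≡ sgn N ℤ.* + d
          nonzero      : Thick → (∀ u → Coatom y u → u ∈ₗ A) → d ≢ 0

      χ-principal : ∀ {a} → o ≢ a → χ (a ∷ []) ≡ 0ℤ
      χ-principal {a} o≢a = trans (Σₗ-cong elements drop) (trans (Σμ o a) (when-no (o ≟ a) o≢a))
        where
        drop : ∀ z → when (closed? (a ∷ []) z) (μ P o z) ≡ when (z ≤? a) (μ P o z)
        drop z = by-cases (closed? (a ∷ []) z) (z ≤? a)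
          where
          by-cases : (d : Dec (Closed (a ∷ []) z)) (e : Dec (z ≤ a)) → when d (μ P o z) ≡ when e (μ P o z)
          by-cases (yes _)              (yes _)   = refl
          by-cases (no _)               (no _)    = refl
          by-cases (yes (_ , here z≤a)) (no z≰a)  = contradiction z≤a z≰a
          by-cases (no ¬c)              (yes z≤a) = sym (μ-zero λ o≤z → ¬c (o≤z , here z≤a))

      -- Inclusion and exclusion, where the hypotheses identify the elements below both `a` and `A`
      -- with those below `B`.
      χ-union : ∀ {a A B} → (∀ {z} → o ≤ z → z ≤ a → Below A z → Below B z) →
                (∀ {z} → Below B z → z ≤ a × Below A z) →
                χ (a ∷ A) ≡ χ A ℤ.+ (χ (a ∷ []) ℤ.- χ B)
      χ-union {a} {A} {B} into outof = trans (Σₗ-cong elements pointwise) (trans (Σₗ-+ elements _ _)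
        (cong (λ t → χ A ℤ.+ t) (trans (Σₗ-+ elements _ _) (cong (λ t → χ (a ∷ []) ℤ.+ t) (Σₗ-neg elements _)))))
        where
        pointwise : ∀ z → when (closed? (a ∷ A) z) (μ P o z) ≡
          when (closed? A z) (μ P o z) ℤ.+ (when (closed? (a ∷ []) z) (μ P o z) ℤ.- when (closed? B z) (μ P o z))
        pointwise z = by-cases (o ≤? z) (z ≤? a) (below? A z)
          where
          t = μ P o z
          by-cases : Dec (o ≤ z) → Dec (z ≤ a) → Dec (Below A z) → when (closed? (a ∷ A) z) t ≡
            when (closed? A z) t ℤ.+ (when (closed? (a ∷ []) z) t ℤ.- when (closed? B z) t)
          by-cases (no o≰z) _ _
            rewrite when-no (closed? (a ∷ A) z) {t} (o≰z ∘ proj₁) | when-no (closed? A z) {t} (o≰z ∘ proj₁)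
                  | when-no (closed? (a ∷ []) z) {t} (o≰z ∘ proj₁) | when-no (closed? B z) {t} (o≰z ∘ proj₁) = refl
          by-cases (yes o≤z) (yes z≤a) (yes z∈A)
            rewrite when-yes (closed? (a ∷ A) z) {t} (o≤z , here z≤a) | when-yes (closed? A z) {t} (o≤z , z∈A)
                  | when-yes (closed? (a ∷ []) z) {t} (o≤z , here z≤a) | when-yes (closed? B z) {t} (o≤z , into o≤z z≤a z∈A) =
            sym (trans (cong (λ s → t ℤ.+ s) (ℤₚ.+-inverseʳ t)) (ℤₚ.+-identityʳ t))
          by-cases (yes o≤z) (yes z≤a) (no z∉A)
            rewrite when-yes (closed? (a ∷ A) z) {t} (o≤z , here z≤a) | when-no (closed? A z) {t} (z∉A ∘ proj₂)
                  | when-yes (closed? (a ∷ []) z) {t} (o≤z , here z≤a) | when-no (closed? B z) {t} (z∉A ∘ proj₂ ∘ outof ∘ proj₂) =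
            sym (trans (ℤₚ.+-identityˡ _) (ℤₚ.+-identityʳ t))
          by-cases (yes o≤z) (no z≰a) (yes z∈A)
            rewrite when-yes (closed? (a ∷ A) z) {t} (o≤z , there z∈A) | when-yes (closed? A z) {t} (o≤z , z∈A)
                  | when-no (closed? (a ∷ []) z) {t} (λ { (_ , here z≤a) → z≰a z≤a })
                  | when-no (closed? B z) {t} (z≰a ∘ proj₁ ∘ outof ∘ proj₂) =
            sym (ℤₚ.+-identityʳ t)
          by-cases (yes o≤z) (no z≰a) (no z∉A)
            rewrite when-no (closed? (a ∷ A) z) {t} (λ { (_ , here z≤a) → z≰a z≤a ; (_ , there z∈A) → z∉A z∈A })
                  | when-no (closed? A z) {t} (z∉A ∘ proj₂)
                  | when-no (closed? (a ∷ []) z) {t} (λ { (_ , here z≤a) → z≰a z≤a })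
                  | when-no (closed? B z) {t} (z≰a ∘ proj₁ ∘ outof ∘ proj₂) = refl

      satisfy : ∀ {z A} → Below A z → Σ[ u ∈ X ] u ∈ₗ A × z ≤ u
      satisfy (here z≤u) = _ , here refl , z≤u
      satisfy (there z∈) = let u , u∈ , z≤u = satisfy z∈ in u , there u∈ , z≤u

      -- With a single step from `o` to `y` the only coatom is `o` itself. The open part is empty
      -- and contributes its class in degree -1.
      base : ∀ {y a A} → suc (ρ o) ≡ ρ y → Valid y (a ∷ A) → Result y (a ∷ A) 0
      base {y} {a} {A} rank V = record
        { d = 1
        ; concentrated = concentrated-empty λ ((o≤z , o≢z) , z∈) → o≢z (sym (trapped o≤z z∈))
        ; euler = trans (Σₗ-cong elements only-o) (trans (Σₗ-single _≟_ (μ P o) unique (complete o)) (μ-refl o))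
        ; nonzero = λ _ _ ()
        }
        where
        open Valid V
        is-o : ∀ {u} → u ∈ₗ a ∷ A → u ≡ o
        is-o u∈ = let o≤u , u≤y , eq = LAll.lookup coatoms u∈ in
          sym (≤∧≢-rank o≤u (ℕₚ.suc-injective (trans rank (sym eq))))
        trapped : ∀ {z} → o ≤ z → Below (a ∷ A) z → z ≡ o
        trapped o≤z z∈ = let u , u∈ , z≤u = satisfy z∈ in ≤-antisym (subst (_ ≤_) (is-o u∈) z≤u) o≤z
        only-o : ∀ z → when (closed? (a ∷ A) z) (μ P o z) ≡ when (z ≟ o) (μ P o z)
        only-o z = when-⇔ (closed? (a ∷ A) z) (z ≟ o) (λ (o≤z , z∈) → trapped o≤z z∈)
          (λ { refl → ≤-refl , here (subst (o ≤_) (sym (is-o (here refl))) ≤-refl) }) (λ _ → refl)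

      module Principal {N y a} (rank : suc (suc N ℕ.+ ρ o) ≡ ρ y) (o≤a : o ≤ a) (a⋖y : a ⋖ y) where

        rank-a : suc (N ℕ.+ ρ o) ≡ ρ a
        rank-a = ℕₚ.suc-injective (trans rank (sym (proj₂ a⋖y)))

        o<a : o < a
        o<a = o≤a , λ { refl → ℕₚ.m+1+n≢m (ρ o) (trans (trans (ℕₚ.+-suc (ρ o) N) (cong suc (ℕₚ.+-comm (ρ o) N))) rank-a) }

        top : ∀ {z} → Open (a ∷ []) z → z ≡ a ⊎ z < a
        top {z} (_ , here z≤a) with z ≟ a
        ... | yes z≡a = inj₁ z≡a
        ... | no  z≢a = inj₂ (z≤a , z≢a)

        none : (zs : Vec X (suc (suc N))) → ¬ FaceIn (Open (a ∷ [])) zs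
        none zs (all , pairs) = ℕₚ.<-irrefl rank (chain-length zs (ℕₚ.<-trans (ρ-mono o<a) (ρ-mono (⋖⇒< a⋖y)))
          (VAll.map (λ { (o<z , here z≤a) → ρ-mono o<z , ρ-mono (≤-<-trans z≤a (⋖⇒< a⋖y)) }) all) pairs)

        result : Result y (a ∷ []) (suc N)
        result = record
          { d = 0
          ; concentrated = concentrated-cone (Open (a ∷ [])) a (o<a , here ≤-refl) top none
          ; euler = trans (χ-principal (proj₂ o<a)) (sym (ℤₚ.*-zeroʳ (sgn (suc N))))
          -- Thickness produces a second coatom, so a list with one coatom is never complete.
          ; nonzero = λ thick complete! _ →
              let b , o≤b , b⋖a = coatom o<a
                  a′ , a′≢a , b≤a′ , a′⋖y = thick b⋖a a⋖y
              in absurd a′≢a (complete! a′ (≤-trans o≤b b≤a′ , a′⋖y))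
          }
          where
          absurd : ∀ {a′} → a′ ≢ a → a′ ∈ₗ a ∷ [] → ⊥
          absurd a′≢a (here a′≡a) = a′≢a a′≡a

      module Step {N y a A} (rank : suc (suc N ℕ.+ ρ o) ≡ ρ y) (V : Valid y (a ∷ A)) (A≢[] : A ≢ []) where

        open Valid V
        o≤a = proj₁ (LAll.head coatoms)
        a⋖y = proj₂ (LAll.head coatoms)
        open Principal rank o≤a a⋖y using (rank-a; o<a; top; none) public

        valid-tail : Valid y A
        valid-tail = record { coatoms = LAll.tail coatoms ; unique! = LAP.tail unique! ; ordered = proj₁ ordered }

        a∉A : ∀ {u} → u ∈ₗ A → a ≢ u
        a∉A = LAll.lookup (LAP.head unique!)
        other : ∀ {u} → u ≢ a → u ∈ₗ a ∷ A → u ∈ₗ A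
        other u≢a (here u≡a) = contradiction u≡a u≢a
        other u≢a (there u∈) = u∈
        below-A? : ∀ b → Dec (Below A b)
        below-A? = below? A
        B : List X
        B = coatomList a below-A?

        -- `meet` finds the coatom of `a` above `z`. Its exceptional case is harmless: if `a` is not
        -- special, every special coatom is already in `A`.
        through : ∀ {z} → o ≤ z → z ≤ a → Below A z → Below B z
        through {z} o≤z z≤a z∈A with satisfy z∈A
        ... | u , u∈A , z≤u with meet (proj₂ (LAll.lookup coatoms (there u∈A))) a⋖y (λ u≡a → a∉A u∈A (sym u≡a)) z≤u z≤a
        ... | b , z≤b , b⋖a , b-below = LAny.map (λ { refl → z≤b })
                (∈-coatomList⁺ a below-A? (≤-trans o≤z z≤b , b⋖a) (in-A b-below (proj₂ ordered)))
          where
          in-A : (b ≤ u ⊎ (¬ Special a y × Σ[ w ∈ X ] w ⋖ y × Special w y × b ≤ w)) →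
                 ((Special a y × LAll.All (λ u → Special u y) A) ⊎
                  (¬ Special a y × (∀ w → Coatom y w → Special w y → w ∈ₗ A))) → Below A b
          in-A (inj₁ b≤u) _ = LAny.map (λ { refl → b≤u }) u∈A
          in-A (inj₂ (¬sa , _)) (inj₁ (sa , _)) = contradiction sa ¬sa
          in-A (inj₂ (_ , w , w⋖y , sw , b≤w)) (inj₂ (_ , ⊇Sp)) =
            LAny.map (λ { refl → b≤w }) (⊇Sp w (≤-trans o≤z (≤-trans z≤b b≤w) , w⋖y) sw)

        back : ∀ {z} → Below B z → z ≤ a × Below A z
        back z∈B = let b , b∈B , z≤b = satisfy z∈B
                       (_ , b≤a , _) , b∈A = ∈-coatomList⁻ a below-A? b∈B
                   in ≤-trans z≤b b≤a , below-down z≤b b∈A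

        -- What makes `B` an admissible list for `a`: `special-meet` settles the case of a special
        -- `a`, `special-lift` the other one.
        dichotomy : ((Special a y × LAll.All (λ u → Special u y) A) ⊎
                  (¬ Special a y × (∀ w → Coatom y w → Special w y → w ∈ₗ A))) →
                  (∀ b → Coatom a b → Below A b → Special b a) ⊎ (∀ b → Coatom a b → Special b a → Below A b)
        dichotomy (inj₁ (sa , sA)) = inj₁ λ b (_ , b⋖a) b∈A → let u , u∈A , b≤u = satisfy b∈A in
          special-meet (proj₂ (LAll.lookup coatoms (there u∈A))) a⋖y (λ u≡a → a∉A u∈A (sym u≡a))
            (LAll.lookup sA u∈A) sa b⋖a b≤u
        dichotomy (inj₂ (¬sa , ⊇Sp)) = inj₂ λ b (o≤b , b⋖a) sb → let w , w⋖y , sw , b≤w = special-lift a⋖y ¬sa b⋖a sb in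
          LAny.map (λ { refl → b≤w }) (⊇Sp w (≤-trans o≤b b≤w , w⋖y) sw)

        valid-B : Valid a B
        valid-B = coatomList-valid a below-A? (dichotomy (proj₂ ordered))

        B≢[] : B ≢ []
        B≢[] B≡[] = none-in-[] (subst (λ L → Below L o) B≡[]
          (through ≤-refl o≤a (first A≢[] (LAll.tail coatoms))))
          where
          none-in-[] : ¬ Below [] o
          none-in-[] ()
          first : ∀ {L} → L ≢ [] → LAll.All (Coatom y) L → Below L o
          first L≢[] LAll.[]             = contradiction refl L≢[]
          first _    ((o≤u , _) LAll.∷ _) = here o≤u

        above-o : ∀ {z} → Open A z ⊎ Open (a ∷ []) z → o < z
        above-o = [ proj₁ , proj₁ ]′
        a-not-below : ¬ Open A a
        a-not-below (_ , a∈) = let u , u∈ , a≤u = satisfy a∈ ; _ , _ , eq = LAll.lookup coatoms (there u∈) in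
          a∉A u∈ (≤∧≢-rank a≤u (ℕₚ.suc-injective (trans (proj₂ a⋖y) (sym eq))))
        module MV = MayerVietoris (Open A) (Open (a ∷ [])) (λ z → (o <? z) ×-dec below? A z)
          (λ z<w (_ , w∈) z∈ → above-o z∈ , below-down (proj₁ z<w) w∈)
          (λ z<w (_ , w∈) z∈ → above-o z∈ , below-down (proj₁ z<w) w∈)
          a (o<a , here ≤-refl) a-not-below top
        U⇒ : ∀ {z} → MV.U z → Open (a ∷ A) z
        U⇒ (inj₁ (o<z , z∈)) = o<z , there z∈
        U⇒ (inj₂ (o<z , here z≤a)) = o<z , here z≤a
        ⇒U : ∀ {z} → Open (a ∷ A) z → MV.U z
        ⇒U (o<z , here z≤a) = inj₂ (o<z , here z≤a)
        ⇒U (o<z , there z∈) = inj₁ (o<z , z∈)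
        B⇒I : ∀ {z} → Open B z → MV.I z
        B⇒I (o<z , z∈) = let z≤a , z∈A = back z∈ in (o<z , z∈A) , (o<z , here z≤a)
        I⇒B : ∀ {z} → MV.I z → Open B z
        I⇒B ((o<z , z∈A) , (_ , here z≤a)) = o<z , through (proj₁ o<z) z≤a z∈A

        module _ (R₁ : Result y A (suc N)) (R₂ : Result a B N) where

          private
            module R₁ = Result R₁
            module R₂ = Result R₂
            s₁ = sgn (suc N)

          result : Result y (a ∷ A) (suc N)
          result = record
            { d = R₁.d ℕ.+ R₂.d
            ; concentrated = concentrated-⇔ U⇒ ⇒U
                (MV.union-concentrated R₁.concentrated (concentrated-⇔ B⇒I I⇒B R₂.concentrated) none)
            ; euler = trans (χ-union through back) (trans
                (cong₂ (λ s t → s ℤ.+ (t ℤ.- χ B)) R₁.euler (χ-principal (proj₂ o<a))) (trans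
                (cong (λ t → s₁ ℤ.* + R₁.d ℤ.+ t) (trans (ℤₚ.+-identityˡ _) (trans (cong ℤ.-_ R₂.euler)
                  (trans (ℤₚ.neg-distribˡ-* (sgn N) (+ R₂.d)) (cong (ℤ._* + R₂.d) (sym (sgn-suc N)))))))
                (sym (ℤₚ.*-distribˡ-+ s₁ (+ R₁.d) (+ R₂.d)))))
            -- When all coatoms of `y` are listed, thickness puts each coatom of `a` below a second
            -- coatom of `y`. So `B` is complete as well, and its dimension alone is nonzero.
            ; nonzero = λ thick complete! d≡0 → R₂.nonzero thick (λ b (o≤b , b⋖a) →
                let a′ , a′≢a , b≤a′ , a′⋖y = thick b⋖a a⋖y
                in ∈-coatomList⁺ a below-A? (o≤b , b⋖a) (LAny.map (λ { refl → b≤a′ })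
                     (other a′≢a (complete! a′ (≤-trans o≤b b≤a′ , a′⋖y)))))
                (ℕₚ.m+n≡0⇒n≡0 R₁.d d≡0)
            }

      -- Removing the last coatom keeps `y` and shortens the list, whereas passing to `B` replaces
      -- `y` by `a` and lowers `N`; the induction is lexicographic.
      build : ∀ N y A → suc (N ℕ.+ ρ o) ≡ ρ y → Valid y A → A ≢ [] → Result y A N
      build N       y []             _    _ A≢[] = contradiction refl A≢[]
      build zero    y (a ∷ A)        rank V _ = base rank V
      build (suc N) y (a ∷ [])       rank V _ = Principal.result rank (proj₁ a-coatom) (proj₂ a-coatom)
        where a-coatom = LAll.head (Valid.coatoms V)
      build (suc N) y (a ∷ a′ ∷ A) rank V _ = Step.result rank V (λ ())
        (build (suc N) y (a′ ∷ A) rank (Step.valid-tail rank V λ ()) λ ())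
        (build N a (Step.B rank V λ ()) (Step.rank-a rank V λ ()) (Step.valid-B rank V λ ()) (Step.B≢[] rank V λ ()))

      module _ {y : X} (o<y : o < y) where

        corank : ℕ
        corank = ρ y ℕ.∸ suc (ρ o)

        corank-eq : suc (corank ℕ.+ ρ o) ≡ ρ y
        corank-eq = trans (sym (ℕₚ.+-suc corank (ρ o))) (ℕₚ.m∸n+n≡m (ρ-mono o<y))

        private
          always : (u : X) → Dec ⊤
          always _ = yes tt

          A : List X
          A = coatomList y {Q = λ _ → ⊤} always

          A≢[] : A ≢ []
          A≢[] A≡[] = let u , o≤u , u⋖y = coatom o<y in absent (subst (u ∈ₗ_) A≡[] (∈-coatomList⁺ y {Q = λ _ → ⊤} always (o≤u , u⋖y) tt))
            where
            absent : ∀ {u} → ¬ (u ∈ₗ [])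
            absent ()

          open Result (build corank y A corank-eq (coatomList-valid y {Q = λ _ → ⊤} always (inj₂ λ _ _ _ → tt)) A≢[])

          below⇒< : ∀ {z} → Below A z → z < y
          below⇒< {z} z∈ = go (LAll.tabulate (λ u∈ → proj₂ (proj₁ (∈-coatomList⁻ y {Q = λ _ → ⊤} always u∈)))) z∈
            where
            go : ∀ {L} → LAll.All (_⋖ y) L → Any (z ≤_) L → z < y
            go (u⋖y LAll.∷ _)  (here z≤u) = ≤-<-trans z≤u (⋖⇒< u⋖y)
            go (_   LAll.∷ us) (there z∈) = go us z∈

          <⇒below : ∀ {z} → o ≤ z → z < y → Below A z
          <⇒below o≤z z<y = let u , z≤u , u⋖y = coatom z<y in
            LAny.map (λ { refl → z≤u }) (∈-coatomList⁺ y {Q = λ _ → ⊤} always (≤-trans o≤z z≤u , u⋖y) tt)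

        dimension : ℕ
        dimension = d

        -- Below the complete list of coatoms lie exactly the elements below `y`, so `χ A` is the
        -- sum in the defining recursion of `μ`. Its minus sign accounts for `suc corank`.
        μ≡dimension : μ P o y ≡ sgn (suc corank) ℤ.* + dimension
        μ≡dimension = begin
          μ P o y                                                                   ≡⟨ μ-step (proj₂ o<y) ⟩
          ℤ.- Σₗ elements (λ z → when (o ≤? z) (when (z <? y) (μ P o z)))           ≡⟨ cong ℤ.-_ (Σₗ-cong elements same) ⟩
          ℤ.- χ A                                                                   ≡⟨ cong ℤ.-_ euler ⟩
          ℤ.- (sgn corank ℤ.* + d)                                                  ≡⟨ ℤₚ.neg-distribˡ-* (sgn corank) (+ d) ⟩
          ℤ.- sgn corank ℤ.* + d                                                    ≡⟨ cong (ℤ._* + d) (sgn-suc corank) ⟨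
          sgn (suc corank) ℤ.* + d ∎
          where
          open ≡.≡-Reasoning
          same : ∀ z → when (o ≤? z) (when (z <? y) (μ P o z)) ≡ when (closed? A z) (μ P o z)
          same z = by-cases (o ≤? z) (z <? y)
            where
            by-cases : ∀ d e → when d (when e (μ P o z)) ≡ when (closed? A z) (μ P o z)
            by-cases (yes o≤z) (yes z<y) = sym (when-yes (closed? A z) (o≤z , <⇒below o≤z z<y))
            by-cases (yes o≤z) (no z≮y)  = sym (when-no (closed? A z) (z≮y ∘ below⇒< ∘ proj₂))
            by-cases (no o≰z)  _         = sym (when-no (closed? A z) (o≰z ∘ proj₁))

        thick⇒dimension≢0 : Thick → dimension ≢ 0
        thick⇒dimension≢0 thick = nonzero thick λ u cu → ∈-coatomList⁺ y {Q = λ _ → ⊤} always cu tt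

        interval-homology : dimension ≢ 0 → UniqueNonvanishingDimension K P o y dimension
        interval-homology d≢0 = concentrated⇒unique {o} {y} d≢0
          (concentrated-⇔ (λ (o<z , z∈) → o<z , below⇒< z∈) (λ (o<z , z<y) → o<z , <⇒below (proj₁ o<z) z<y) concentrated)
          λ {k} N<k zs (all , pairs) → ℕₚ.<⇒≱ (chain-length zs (ρ-mono o<y)
              (VAll.map (λ (o<z , z<y) → ρ-mono o<z , ρ-mono z<y) all) pairs)
            (ℕₚ.≤-trans (ℕₚ.≤-reflexive (sym corank-eq)) (ℕₚ.+-monoˡ-≤ (ρ o) N<k))

-- Semi-pointed partitions, merging of blocks and the rank

module Partitions where

  open FiniteSums
  open import Data.Fin.Base as Fin using (Fin; zero; suc; _↑ˡ_)
  import Data.Fin.Properties as Finₚ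
  open import Data.Fin.Subset using (Subset; _∈_; _⊆_)
  open import Data.Fin.Subset.Properties using (_∈?_)
  open import Data.Integer.Base as ℤ using (ℤ; +_; 1ℤ)
  import Data.Integer.Properties as ℤₚ
  open import Data.List.Base as List using ([]; _∷_; filter; length; allFin)
  open import Data.List.Membership.Propositional.Properties using (∈-allFin)
  open import Data.List.Relation.Unary.Unique.Propositional.Properties using (allFin⁺)
  open import Data.Maybe.Base using (Maybe; just; nothing)
  open import Data.Maybe.Properties using () renaming (≡-dec to ≡-decᴹ)
  open import Data.Nat.Base as ℕ using (ℕ; zero; suc)
  import Data.Nat.Properties as ℕₚ
  open import Data.Product.Base using (Σ; Σ-syntax; ∃-syntax; _×_; _,_; proj₁; proj₂)
  open import Data.Sum.Base using (_⊎_; inj₁; inj₂)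
  open import Data.Vec.Base as Vec using (Vec; tabulate)
  import Data.Vec.Properties as Vecₚ
  open import Function.Base using (_∘_)
  open import Relation.Binary.PropositionalEquality using (_≡_; _≢_; refl; sym; trans; cong; cong₂; subst)
  open import Relation.Nullary using (¬_; Dec; yes; no; does; contradiction)
  open import Relation.Nullary.Decidable using (_×-dec_; _⊎-dec_; ¬?; map′; dec-true; decidable-stable)

  open Sums ℤₚ.+-*-commutativeRing

  least : ∀ {n} {Q : Fin n → Set} (Q? : ∀ x → Dec (Q x)) → Σ (Fin n) Q →
          Σ[ x ∈ Fin n ] Q x × (∀ y → Q y → x Fin.≤ y)
  least {suc n} Q? (y , Qy) with Q? zero
  ... | yes Q0 = zero , Q0 , λ _ _ → ℕ.z≤n
  least {suc n} Q? (zero  , Q0) | no ¬Q0 = contradiction Q0 ¬Q0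
  least {suc n} Q? (suc y , Qy) | no ¬Q0 = let x , Qx , x≤ = least (Q? ∘ suc) (y , Qy) in
    suc x , Qx , λ { zero Q0 → contradiction Q0 ¬Q0 ; (suc z) Qz → ℕ.s≤s (x≤ z Qz) }

  count : ∀ {n} {Q : Fin n → Set} → (∀ x → Dec (Q x)) → ℕ
  count {n} Q? = length (filter Q? (allFin n))

  +length-filter : ∀ {A : Set} {Q : A → Set} (Q? : ∀ x → Dec (Q x)) xs →
                   + length (filter Q? xs) ≡ Σₗ xs (λ x → when (Q? x) 1ℤ)
  +length-filter Q? []       = refl
  +length-filter Q? (x ∷ xs) with Q? x
  ... | yes _ = trans (ℤₚ.pos-+ 1 _) (cong (λ t → 1ℤ ℤ.+ t) (+length-filter Q? xs))
  ... | no  _ = trans (+length-filter Q? xs) (sym (ℤₚ.+-identityˡ _))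

  count-bijection : ∀ {n} {Q R : Fin n → Set} (Q? : ∀ x → Dec (Q x)) (R? : ∀ x → Dec (R x)) (f g : Fin n → Fin n) →
                    (∀ x → Q x → R (f x) × g (f x) ≡ x) → (∀ y → R y → Q (g y) × f (g y) ≡ y) → count Q? ≡ count R?
  count-bijection {n} Q? R? f g to from = ℤₚ.+-injective (begin
    + count Q?                                ≡⟨ +length-filter Q? (allFin n) ⟩
    Σₗ (allFin n) (λ x → when (Q? x) 1ℤ)      ≡⟨ Σₗ-bijection Finₚ._≟_ Finₚ._≟_ (allFin⁺ n) (allFin⁺ n) ∈-allFin ∈-allFin
                                                   Q? R? f g to from (λ _ → 1ℤ) (λ _ → 1ℤ) (λ _ _ → refl) ⟩
    Σₗ (allFin n) (λ x → when (R? x) 1ℤ)      ≡⟨ +length-filter R? (allFin n) ⟨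
    + count R? ∎)
    where open Relation.Binary.PropositionalEquality.≡-Reasoning

  count-split : ∀ {n} {Q R S : Fin n → Set} (Q? : ∀ x → Dec (Q x)) (R? : ∀ x → Dec (R x)) (S? : ∀ x → Dec (S x)) →
                (∀ x → when (Q? x) 1ℤ ≡ when (R? x) 1ℤ ℤ.+ when (S? x) 1ℤ) → count Q? ≡ count R? ℕ.+ count S?
  count-split {n} Q? R? S? eq = ℤₚ.+-injective (begin
    + count Q?                                                  ≡⟨ +length-filter Q? xs ⟩
    Σₗ xs (λ x → when (Q? x) 1ℤ)                                ≡⟨ Σₗ-cong xs eq ⟩
    Σₗ xs (λ x → when (R? x) 1ℤ ℤ.+ when (S? x) 1ℤ)             ≡⟨ Σₗ-+ xs _ _ ⟩
    Σₗ xs (λ x → when (R? x) 1ℤ) ℤ.+ Σₗ xs (λ x → when (S? x) 1ℤ)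
      ≡⟨ cong₂ ℤ._+_ (+length-filter R? xs) (+length-filter S? xs) ⟨
    + count R? ℤ.+ + count S?                                   ≡⟨ ℤₚ.pos-+ (count R?) (count S?) ⟨
    + (count R? ℕ.+ count S?) ∎)
    where
    open Relation.Binary.PropositionalEquality.≡-Reasoning
    xs = allFin n

  count-singleton : ∀ {n} (a : Fin n) → count (Finₚ._≟ a) ≡ 1
  count-singleton {n} a = ℤₚ.+-injective (trans (+length-filter (Finₚ._≟ a) (allFin n))
    (Σₗ-single Finₚ._≟_ (λ _ → 1ℤ) (allFin⁺ n) (∈-allFin a)))

  count-remove : ∀ {n} {Q : Fin n → Set} (Q? : ∀ x → Dec (Q x)) {a} → Q a →
                 count Q? ≡ suc (count λ x → Q? x ×-dec ¬? (x Finₚ.≟ a))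
  count-remove Q? {a} Qa = trans (count-split Q? (Finₚ._≟ a) (λ x → Q? x ×-dec ¬? (x Finₚ.≟ a)) pointwise)
    (cong (λ c → c ℕ.+ count λ x → Q? x ×-dec ¬? (x Finₚ.≟ a)) (count-singleton a))
    where
    pointwise : ∀ x → when (Q? x) 1ℤ ≡ when (x Finₚ.≟ a) 1ℤ ℤ.+ when (Q? x ×-dec ¬? (x Finₚ.≟ a)) 1ℤ
    pointwise x with Q? x | x Finₚ.≟ a
    ... | yes _ | yes _    = refl
    ... | yes _ | no  _    = refl
    ... | no ¬q | yes refl = contradiction Qa ¬q
    ... | no _  | no _     = refl

  _≟ᵖ_ : ∀ {p} (u v : Maybe (Fin p)) → Dec (u ≡ v)
  _≟ᵖ_ = ≡-decᴹ Finₚ._≟_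

  module _ {p q : ℕ} where

    private
      n = p ℕ.+ q
      variable
        a b e s t w x y z : Fin n
        P Q : SemiPointedPartition p q

    infix 4 _∼⟨_⟩_
    -- Blocks are handled as an equivalence relation throughout. The record lets `P` be inferred
    -- from a proof.
    record _∼⟨_⟩_ (x : Fin n) (P : SemiPointedPartition p q) (w : Fin n) : Set where
      constructor rel
      field member : w ∈ members (blockOf P x)
    open _∼⟨_⟩_ public

    pt : SemiPointedPartition p q → Fin n → Maybe (Fin p)
    pt P x = point (blockOf P x)

    ∼? : ∀ P x w → Dec (x ∼⟨ P ⟩ w)
    ∼? P x w = map′ rel member (w ∈? members (blockOf P x))

    ∼-refl : x ∼⟨ P ⟩ x
    ∼-refl {x} {P} = rel (self∈ P x)

    ∼-block : x ∼⟨ P ⟩ w → blockOf P w ≡ blockOf P x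
    ∼-block {x} {P} {w} (rel w∈) = sameBlock P x w w∈

    ∼-sym : x ∼⟨ P ⟩ w → w ∼⟨ P ⟩ x
    ∼-sym {x} {P} x∼w = rel (subst (λ B → x ∈ members B) (sym (∼-block x∼w)) (self∈ P x))

    ∼-trans : x ∼⟨ P ⟩ y → y ∼⟨ P ⟩ z → x ∼⟨ P ⟩ z
    ∼-trans {z = z} x∼y (rel z∈) = rel (subst (λ B → z ∈ members B) (∼-block x∼y) z∈)

    ∼-pt : x ∼⟨ P ⟩ w → pt P w ≡ pt P x
    ∼-pt x∼w = cong point (∼-block x∼w)

    pt-member : ∀ {e} → pt P x ≡ just e → x ∼⟨ P ⟩ (e ↑ˡ q)
    pt-member {P} {x} eq = rel (proj₁ (proj₂ (proj₂ (isValid P))) x _ eq)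

    infix 4 _≼_
    -- The given order for equivalence relations. Coarseness replaces unions of blocks, since a
    -- block of `P` is the class of each of its elements.
    record _≼_ (P Q : SemiPointedPartition p q) : Set where
      constructor mk-≼
      field
        coarser : ∀ {x w} → x ∼⟨ Q ⟩ w → x ∼⟨ P ⟩ w
        pointing : ∀ x → ∃[ w ] (x ∼⟨ P ⟩ w × pt Q w ≡ pt P x)
    open _≼_ public

    ⊑⇒≼ : P ⊑ Q → P ≼ Q
    ⊑⇒≼ {P} P⊑Q = mk-≼ (λ {x} (rel w∈) → rel (proj₁ (P⊑Q x) x (self∈ P x) w∈))
      λ x → let w , w∈ , eq = proj₂ (P⊑Q x) in w , rel w∈ , eq

    ≼⇒⊑ : P ≼ Q → P ⊑ Q
    ≼⇒⊑ P≼Q x = (λ y y∈ z∈ → member (∼-trans (rel y∈) (coarser P≼Q (rel z∈)))) ,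
      (let w , x∼w , eq = pointing P≼Q x in w , member x∼w , eq)

    ≼-trans : ∀ {R} → P ≼ Q → Q ≼ R → P ≼ R
    ≼-trans {P} {Q} {R} P≼Q Q≼R = mk-≼ (coarser P≼Q ∘ coarser Q≼R) λ x →
      let w , x∼w , eq = pointing P≼Q x ; v , w∼v , eq′ = pointing Q≼R w in
      v , ∼-trans x∼w (coarser P≼Q w∼v) , trans eq′ eq

    ∼-ext : (∀ {x w} → x ∼⟨ Q ⟩ w → x ∼⟨ P ⟩ w) → (∀ {x w} → x ∼⟨ P ⟩ w → x ∼⟨ Q ⟩ w) →
            (∀ x → pt P x ≡ pt Q x) → P ≡ Q
    ∼-ext Q⊆P P⊆Q pts = ⊑-antisym (≼⇒⊑ (mk-≼ Q⊆P λ x → x , ∼-refl , sym (pts x))) (≼⇒⊑ (mk-≼ P⊆Q λ x → x , ∼-refl , pts x))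

    -- An equivalence relation with a compatible point for each class: the data from which merged
    -- and decoded partitions are built.
    record Pointing : Set₁ where
      field
        _≈_      : Fin n → Fin n → Set
        ≈?       : ∀ x w → Dec (x ≈ w)
        ≈-refl   : ∀ {x} → x ≈ x
        ≈-sym    : ∀ {x y} → x ≈ y → y ≈ x
        ≈-trans  : ∀ {x y z} → x ≈ y → y ≈ z → x ≈ z
        mark     : Fin n → Maybe (Fin p)
        mark-cong  : ∀ {x y} → x ≈ y → mark y ≡ mark x
        mark-here  : ∀ {x e} → mark x ≡ just e → x ≈ (e ↑ˡ q)
        mark-V₁    : ∀ {x} → (∀ {w} → x ≈ w → w ∈ V₁ p q) → mark x ≢ nothing
        mark-V₂    : ∀ {x} → (∀ {w} → x ≈ w → w ∈ V₂ p q) → mark x ≡ nothing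

      class : Fin n → Subset n
      class x = tabulate (λ w → does (≈? x w))

      ∈-class⁺ : ∀ {x w} → x ≈ w → w ∈ class x
      ∈-class⁺ {x} {w} x≈w = Vecₚ.lookup⇒[]= w _ (trans (Vecₚ.lookup∘tabulate _ w) (dec-true (≈? x w) x≈w))

      ∈-class⁻ : ∀ {x w} → w ∈ class x → x ≈ w
      ∈-class⁻ {x} {w} w∈ with ≈? x w | trans (sym (Vecₚ.lookup∘tabulate (λ w → does (≈? x w)) w)) (Vecₚ.[]=⇒lookup w∈)
      ... | yes x≈w | _ = x≈w

      class-cong : ∀ {x y} → x ≈ y → class y ≡ class x
      class-cong {x} {y} x≈y = Vecₚ.tabulate-cong same
        where
        same : ∀ w → does (≈? y w) ≡ does (≈? x w)
        same w with ≈? y w | ≈? x w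
        ... | yes _   | yes _   = refl
        ... | no _    | no _    = refl
        ... | yes y≈w | no x≉w  = contradiction (≈-trans x≈y y≈w) x≉w
        ... | no y≉w  | yes x≈w = contradiction (≈-trans (≈-sym x≈y) x≈w) y≉w

      block : Fin n → Block p q
      block x = class x at mark x

      entry : ∀ x → Vec.lookup (tabulate block) x ≡ block x
      entry = Vecₚ.lookup∘tabulate block

      partition : SemiPointedPartition p q
      partition = mk (tabulate block)
        ( (λ x → subst (λ B → x ∈ members B) (sym (entry x)) (∈-class⁺ ≈-refl))
        , (λ x y y∈ → let x≈y = ∈-class⁻ (subst (λ B → y ∈ members B) (entry x) y∈) in
            trans (entry y) (trans (cong₂ _at_ (class-cong x≈y) (mark-cong x≈y)) (sym (entry x))))
        , (λ x e eq → subst (λ B → (e ↑ˡ q) ∈ members B) (sym (entry x))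
            (∈-class⁺ (mark-here (trans (sym (cong point (entry x))) eq))))
        , (λ x ⊆V₁ eq → mark-V₁ (λ x≈w → ⊆V₁ (subst (λ B → _ ∈ members B) (sym (entry x)) (∈-class⁺ x≈w)))
            (trans (sym (cong point (entry x))) eq))
        , (λ x ⊆V₂ → trans (cong point (entry x))
            (mark-V₂ λ x≈w → ⊆V₂ (subst (λ B → _ ∈ members B) (sym (entry x)) (∈-class⁺ x≈w))))
        )

      ∼⁺ : ∀ {x w} → x ≈ w → x ∼⟨ partition ⟩ w
      ∼⁺ {x} {w} x≈w = rel (subst (λ B → w ∈ members B) (sym (entry x)) (∈-class⁺ x≈w))

      ∼⁻ : ∀ {x w} → x ∼⟨ partition ⟩ w → x ≈ w
      ∼⁻ {x} {w} (rel w∈) = ∈-class⁻ (subst (λ B → w ∈ members B) (entry x) w∈)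

      pt-mark : ∀ x → pt partition x ≡ mark x
      pt-mark x = cong point (entry x)

    In : SemiPointedPartition p q → Fin n → Fin n → Fin n → Set
    In P s t x = s ∼⟨ P ⟩ x ⊎ t ∼⟨ P ⟩ x

    in? : ∀ P s t x → Dec (In P s t x)
    in? P s t x = ∼? P s x ⊎-dec ∼? P t x

    in-∼ : In P s t x → x ∼⟨ P ⟩ w → In P s t w
    in-∼ (inj₁ s∼x) x∼w = inj₁ (∼-trans s∼x x∼w)
    in-∼ (inj₂ t∼x) x∼w = inj₂ (∼-trans t∼x x∼w)

    merging : SemiPointedPartition p q → Fin n → Fin n → Pointing
    merging P s t = record
      { _≈_     = _≈_
      ; ≈?      = λ x w → ∼? P x w ⊎-dec (in? P s t x ×-dec in? P s t w)
      ; ≈-refl  = inj₁ ∼-refl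
      ; ≈-sym   = λ { (inj₁ x∼y) → inj₁ (∼-sym x∼y) ; (inj₂ (i , j)) → inj₂ (j , i) }
      ; ≈-trans = λ { (inj₁ x∼y) (inj₁ y∼z) → inj₁ (∼-trans x∼y y∼z)
                    ; (inj₁ x∼y) (inj₂ (i , j)) → inj₂ (in-∼ i (∼-sym x∼y) , j)
                    ; (inj₂ (i , j)) (inj₁ y∼z) → inj₂ (i , in-∼ j y∼z)
                    ; (inj₂ (i , _)) (inj₂ (_ , j)) → inj₂ (i , j) }
      ; mark    = λ x → choose x (in? P s t x)
      ; mark-cong = λ {x} {y} → mark-cong (in? P s t x) (in? P s t y)
      ; mark-here = λ {x} → mark-here (in? P s t x)
      ; mark-V₁   = λ {x} → mark-V₁ (in? P s t x)
      ; mark-V₂   = λ {x} → mark-V₂ (in? P s t x)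
      }
      where
      _≈_ : Fin n → Fin n → Set
      x ≈ w = x ∼⟨ P ⟩ w ⊎ (In P s t x × In P s t w)
      choose : ∀ x → Dec (In P s t x) → Maybe (Fin p)
      choose x (yes _) = pt P s
      choose x (no _)  = pt P x
      mark-cong : ∀ {x y} d e → x ≈ y → choose y e ≡ choose x d
      mark-cong (yes _) (yes _) _ = refl
      mark-cong (yes i) (no ¬j) (inj₁ x∼y) = contradiction (in-∼ i x∼y) ¬j
      mark-cong (yes _) (no ¬j) (inj₂ (_ , j)) = contradiction j ¬j
      mark-cong (no ¬i) (yes j) (inj₁ x∼y) = contradiction (in-∼ j (∼-sym x∼y)) ¬i
      mark-cong (no ¬i) (yes _) (inj₂ (i , _)) = contradiction i ¬i
      mark-cong (no _) (no _) (inj₁ x∼y) = ∼-pt x∼y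
      mark-cong (no ¬i) (no _) (inj₂ (i , _)) = contradiction i ¬i
      mark-here : ∀ {x e} d → choose x d ≡ just e → x ≈ (e ↑ˡ q)
      mark-here (yes i) eq = inj₂ (i , inj₁ (pt-member eq))
      mark-here (no _)  eq = inj₁ (pt-member eq)
      mark-V₁ : ∀ {x} d → (∀ {w} → x ≈ w → w ∈ V₁ p q) → choose x d ≢ nothing
      mark-V₁ (yes i) ⊆V₁ = proj₁ (proj₂ (proj₂ (proj₂ (isValid P)))) s λ w∈ → ⊆V₁ (inj₂ (i , inj₁ (rel w∈)))
      mark-V₁ (no _)  ⊆V₁ = proj₁ (proj₂ (proj₂ (proj₂ (isValid P)))) _ λ w∈ → ⊆V₁ (inj₁ (rel w∈))
      mark-V₂ : ∀ {x} d → (∀ {w} → x ≈ w → w ∈ V₂ p q) → choose x d ≡ nothing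
      mark-V₂ (yes i) ⊆V₂ = proj₂ (proj₂ (proj₂ (proj₂ (isValid P)))) s λ w∈ → ⊆V₂ (inj₂ (i , inj₁ (rel w∈)))
      mark-V₂ (no _)  ⊆V₂ = proj₂ (proj₂ (proj₂ (proj₂ (isValid P)))) _ λ w∈ → ⊆V₂ (inj₁ (rel w∈))

    abstract

      -- The block of t is absorbed by the block of s, whose point is kept.
      merge : SemiPointedPartition p q → Fin n → Fin n → SemiPointedPartition p q
      merge P s t = Pointing.partition (merging P s t)

      merge-∼⁻ : x ∼⟨ merge P s t ⟩ w → x ∼⟨ P ⟩ w ⊎ (In P s t x × In P s t w)
      merge-∼⁻ {P = P} {s} {t} = Pointing.∼⁻ (merging P s t)

      merge-old : x ∼⟨ P ⟩ w → x ∼⟨ merge P s t ⟩ w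
      merge-old {P = P} {s = s} {t} x∼w = Pointing.∼⁺ (merging P s t) (inj₁ x∼w)

      merge-in : In P s t x → In P s t w → x ∼⟨ merge P s t ⟩ w
      merge-in {P} {s} {t} i j = Pointing.∼⁺ (merging P s t) (inj₂ (i , j))

      pt-in : In P s t x → pt (merge P s t) x ≡ pt P s
      pt-in {P} {s} {t} {x} i with in? P s t x | Pointing.pt-mark (merging P s t) x
      ... | yes _ | eq = eq
      ... | no ¬i | _  = contradiction i ¬i

      pt-out : ¬ In P s t x → pt (merge P s t) x ≡ pt P x
      pt-out {P} {s} {t} {x} ¬i with in? P s t x | Pointing.pt-mark (merging P s t) x
      ... | yes i | _  = contradiction i ¬i
      ... | no _  | eq = eq

    module _ {P : SemiPointedPartition p q} {s t : Fin n} where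

      merge-new : s ∼⟨ merge P s t ⟩ t
      merge-new = merge-in (inj₁ ∼-refl) (inj₂ ∼-refl)

      pt-s : pt (merge P s t) s ≡ pt P s
      pt-s = pt-in (inj₁ ∼-refl)

      merge-≼ : merge P s t ≼ P
      merge-≼ = mk-≼ merge-old λ x → witness x (in? P s t x)
        where
        witness : ∀ x → Dec (In P s t x) → ∃[ w ] (x ∼⟨ merge P s t ⟩ w × pt P w ≡ pt (merge P s t) x)
        witness x (yes i) = s , merge-in i (inj₁ ∼-refl) , sym (pt-in i)
        witness x (no ¬i) = x , ∼-refl , sym (pt-out ¬i)

      -- Away from the two merged blocks `merge P s t` has the points of `P`, so only the block of
      -- `s` needs a new witness. It may come from a third block inside the block of `Z`, hence the
      -- free choice of `w`.
      ≼-merge : ∀ {Z w} → Z ≼ P → s ∼⟨ Z ⟩ t → s ∼⟨ Z ⟩ w → pt (merge P s t) w ≡ pt Z s → Z ≼ merge P s t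
      ≼-merge {Z} {w} Z≼P s∼t s∼w pt≡ = mk-≼ coarse λ x → witness x (∼? Z s x)
        where
        reach : In P s t x → s ∼⟨ Z ⟩ x
        reach (inj₁ s∼x) = coarser Z≼P s∼x
        reach (inj₂ t∼x) = ∼-trans s∼t (coarser Z≼P t∼x)
        coarse : x ∼⟨ merge P s t ⟩ y → x ∼⟨ Z ⟩ y
        coarse x∼y with merge-∼⁻ x∼y
        ... | inj₁ x∼y′    = coarser Z≼P x∼y′
        ... | inj₂ (i , j) = ∼-trans (∼-sym (reach i)) (reach j)
        witness : ∀ x → Dec (s ∼⟨ Z ⟩ x) → ∃[ v ] (x ∼⟨ Z ⟩ v × pt (merge P s t) v ≡ pt Z x)
        witness x (yes s∼x) = w , ∼-trans (∼-sym s∼x) s∼w , trans pt≡ (sym (∼-pt s∼x))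
        witness x (no s≁x)  = let v , x∼v , eq = pointing Z≼P x in
          v , x∼v , trans (pt-out λ i → s≁x (∼-trans (reach i) (∼-sym x∼v))) eq

    abstract

      -- With the same blocks, `pointing` would force the same points, and the partitions would be
      -- equal.
      coarser-pair : P ≼ Q → P ≢ Q → ∃[ s ] ∃[ t ] (¬ s ∼⟨ Q ⟩ t × s ∼⟨ P ⟩ t)
      coarser-pair {P} {Q} P≼Q P≢Q with Finₚ.any? (λ s → Finₚ.any? λ t → ¬? (∼? Q s t) ×-dec ∼? P s t)
      ... | yes found = found
      ... | no ¬found = contradiction (∼-ext (coarser P≼Q) finer λ x → let w , x∼w , eq = pointing P≼Q x in
          trans (sym eq) (∼-pt (finer x∼w))) P≢Q
        where
        finer : x ∼⟨ P ⟩ w → x ∼⟨ Q ⟩ w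
        finer {x} {w} x∼w = decidable-stable (∼? Q x w) λ x≁w → ¬found (x , w , x≁w , x∼w)

    abstract

      -- `pointing` yields a `w` whose `Q`-block has the point of the `P`-block. As `R` separates
      -- `s` from `t`, it separates `w` from one of them. The resulting pair can be merged in `Q`
      -- without leaving the part above `P`; thickness needs an `R` other than `Q`.
      pointed-pair : ∀ {R} → P ≼ Q → ∃[ s ] ∃[ t ] (¬ s ∼⟨ R ⟩ t × s ∼⟨ P ⟩ t) →
                     ∃[ s ] ∃[ t ] (¬ s ∼⟨ R ⟩ t × s ∼⟨ P ⟩ t × pt Q s ≡ pt P s)
      pointed-pair {R = R} P≼Q (s , t , s≁t , s∼t) with pointing P≼Q s
      ... | w , s∼w , eq with ∼? R w s
      ... | yes w∼s = w , t , (λ w∼t → s≁t (∼-trans (∼-sym w∼s) w∼t)) , ∼-trans (∼-sym s∼w) s∼t , trans eq (sym (∼-pt s∼w))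
      ... | no w≁s  = w , s , w≁s , ∼-sym s∼w , trans eq (sym (∼-pt s∼w))

    merge-above : P ≼ Q → s ∼⟨ P ⟩ t → pt Q s ≡ pt P s → P ≼ merge Q s t
    merge-above P≼Q s∼t eq = ≼-merge P≼Q s∼t ∼-refl (trans pt-s eq)

    abstract

      rep : SemiPointedPartition p q → Fin n → Fin n
      rep P x = proj₁ (least (∼? P x) (x , ∼-refl))

      ∼-rep : x ∼⟨ P ⟩ rep P x
      ∼-rep {x} {P} = proj₁ (proj₂ (least (∼? P x) (x , ∼-refl)))

      rep-≤ : x ∼⟨ P ⟩ w → rep P x Fin.≤ w
      rep-≤ {x} {P} {w} = proj₂ (proj₂ (least (∼? P x) (x , ∼-refl))) w

    rep-cong : x ∼⟨ P ⟩ w → rep P x ≡ rep P w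
    rep-cong x∼w = Finₚ.≤-antisym (rep-≤ (∼-trans x∼w ∼-rep)) (rep-≤ (∼-trans (∼-sym x∼w) ∼-rep))

    IsRep : SemiPointedPartition p q → Fin n → Set
    IsRep P x = rep P x ≡ x

    isRep? : ∀ P x → Dec (IsRep P x)
    isRep? P x = rep P x Finₚ.≟ x

    -- Blocks are counted by their least elements, but merges and codes come with other natural
    -- representatives. Counts do not depend on this choice.
    record Transversal (P : SemiPointedPartition p q) (T : Fin n → Set) : Set where
      field
        choice   : Fin n → Fin n
        chosen   : ∀ x → T (choice x)
        ∼-choice : ∀ x → x ∼⟨ P ⟩ choice x
        unique   : ∀ {x w} → T x → T w → x ∼⟨ P ⟩ w → x ≡ w

    reps : ∀ P → Transversal P (IsRep P)
    reps P = record
      { choice   = rep P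
      ; chosen   = λ x → sym (rep-cong ∼-rep)
      ; ∼-choice = λ x → ∼-rep
      ; unique   = λ rx rw x∼w → trans (sym rx) (trans (rep-cong x∼w) rw)
      }

    transversal-count : ∀ {T T′ A : Fin n → Set} (T? : ∀ x → Dec (T x)) (T′? : ∀ x → Dec (T′ x)) (A? : ∀ x → Dec (A x)) →
      Transversal P T → Transversal P T′ → (∀ {x w} → x ∼⟨ P ⟩ w → A x → A w) →
      count (λ x → T? x ×-dec A? x) ≡ count (λ x → T′? x ×-dec A? x)
    transversal-count T? T′? A? τ τ′ sat = count-bijection _ _ τ′.choice τ.choice
        (λ x (Tx , Ax) → (τ′.chosen x , sat (τ′.∼-choice x) Ax) ,
          τ.unique (τ.chosen _) Tx (∼-sym (∼-trans (τ′.∼-choice x) (τ.∼-choice _))))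
        (λ x (Tx , Ax) → (τ.chosen x , sat (τ.∼-choice x) Ax) ,
          τ′.unique (τ′.chosen _) Tx (∼-sym (∼-trans (τ.∼-choice x) (τ′.∼-choice _))))
      where
      module τ = Transversal τ
      module τ′ = Transversal τ′

    abstract

      rank : SemiPointedPartition p q → ℕ
      rank P = count (isRep? P)

      rank≡count : ∀ P → rank P ≡ count (isRep? P)
      rank≡count P = refl

    rank-transversal : ∀ {T : Fin n → Set} (T? : ∀ x → Dec (T x)) → Transversal P T → count T? ≡ rank P
    rank-transversal {P} T? τ = trans (count-bijection T? (isRep? P) (rep P) τ.choice
        (λ x Tx → Transversal.chosen (reps P) x , τ.unique (τ.chosen _) Tx (∼-sym (∼-trans ∼-rep (τ.∼-choice _))))
        (λ x rx → τ.chosen x , trans (sym (rep-cong (τ.∼-choice x))) rx)) (sym (rank≡count P))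
      where module τ = Transversal τ

    -- Without the representative of the absorbed block, the representatives of `P` form a
    -- transversal of the merged partition.
    rank-merge : ¬ s ∼⟨ P ⟩ t → suc (rank (merge P s t)) ≡ rank P
    rank-merge {s} {P} {t} s≁t = sym (trans (rank≡count P) (trans (count-remove (isRep? P) (Transversal.chosen (reps P) t))
      (cong suc (rank-transversal (λ x → isRep? P x ×-dec ¬? (x Finₚ.≟ rep P t)) record
        { choice   = λ x → choice x (∼? P t x)
        ; chosen   = λ x → chosen x (∼? P t x)
        ; ∼-choice = λ x → ∼-choice x (∼? P t x)
        ; unique   = unique
        }))))
      where
      T : Fin n → Set
      T x = IsRep P x × x ≢ rep P t
      choice : ∀ x → Dec (t ∼⟨ P ⟩ x) → Fin n
      choice x (yes _) = rep P s
      choice x (no _)  = rep P x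
      chosen : ∀ x d → T (choice x d)
      chosen x (yes _)   = Transversal.chosen (reps P) s , λ eq → s≁t (∼-trans ∼-rep (subst (_∼⟨ P ⟩ t) (sym eq) (∼-sym ∼-rep)))
      chosen x (no t≁x)  = Transversal.chosen (reps P) x , λ eq → t≁x (∼-trans ∼-rep (subst (_∼⟨ P ⟩ x) eq (∼-sym ∼-rep)))
      ∼-choice : ∀ x d → x ∼⟨ merge P s t ⟩ choice x d
      ∼-choice x (yes t∼x) = merge-in (inj₂ t∼x) (inj₁ ∼-rep)
      ∼-choice x (no _)    = merge-old ∼-rep
      to-s : T x → In P s t x → s ∼⟨ P ⟩ x
      to-s _ (inj₁ s∼x) = s∼x
      to-s (rx , x≢) (inj₂ t∼x) = contradiction (trans (sym rx) (sym (rep-cong t∼x))) x≢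
      unique : T x → T w → x ∼⟨ merge P s t ⟩ w → x ≡ w
      unique Tx Tw x∼w with merge-∼⁻ x∼w
      ... | inj₁ x∼w′    = Transversal.unique (reps P) (proj₁ Tx) (proj₁ Tw) x∼w′
      ... | inj₂ (i , j) = Transversal.unique (reps P) (proj₁ Tx) (proj₁ Tw) (∼-trans (∼-sym (to-s Tx i)) (to-s Tw j))

    abstract

      below-merge : P ≼ Q → P ≢ Q → ∃[ s ] ∃[ t ] (¬ s ∼⟨ Q ⟩ t × P ≼ merge Q s t)
      below-merge P≼Q P≢Q = let s , t , s≁t , s∼t , eq = pointed-pair P≼Q (coarser-pair P≼Q P≢Q) in
        s , t , s≁t , merge-above P≼Q s∼t eq

    mutual

      -- Some `merge` of `Q` lies between `P` and `Q` and has rank one less than `Q`; either it is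
      -- `P`, or the induction on the rank continues with it.
      rank-mono : ∀ k {P Q : SemiPointedPartition p q} → rank Q ≡ k → P ≼ Q → P ≢ Q → rank P ℕ.< rank Q
      rank-mono k {P} {Q} rk P≼Q P≢Q = let s , t , s≁t , P≼U = below-merge P≼Q P≢Q in
        rank-mono′ k rk s≁t P≼U (P ≟ˢ merge Q s t)

      rank-mono′ : ∀ k {P Q : SemiPointedPartition p q} {s t} → rank Q ≡ k → ¬ s ∼⟨ Q ⟩ t →
                   P ≼ merge Q s t → Dec (P ≡ merge Q s t) → rank P ℕ.< rank Q
      rank-mono′ k rk s≁t P≼U (yes P≡U) = ℕₚ.≤-reflexive (trans (cong (suc ∘ rank) P≡U) (rank-merge s≁t))
      rank-mono′ zero rk s≁t P≼U (no _) = contradiction (trans (rank-merge s≁t) rk) λ ()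
      rank-mono′ (suc k) rk s≁t P≼U (no P≢U) =
        ℕₚ.<-trans (rank-mono k (ℕₚ.suc-injective (trans (rank-merge s≁t) rk)) P≼U P≢U) (ℕₚ.≤-reflexive (rank-merge s≁t))

-- The recursive coatom ordering of the semi-pointed partitions

module IntervalShelling where

  open FiniteSums
  open MöbiusFunctions
  open OrderComplexes
  open CoatomOrderings
  open Partitions
  open import Data.Fin.Base as Fin using (Fin; suc)
  import Data.Fin.Properties as Finₚ
  open import Data.Nat.Base as ℕ using (ℕ; suc)
  import Data.Nat.Properties as ℕₚ
  open import Data.Product.Base using (Σ; Σ-syntax; ∃-syntax; _×_; _,_; proj₁; proj₂)
  open import Data.Sum.Base using (_⊎_; inj₁; inj₂; [_,_]′)
  open import Function.Base using (_∘_)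
  open import Relation.Binary.PropositionalEquality using (_≡_; _≢_; refl; sym; trans; subst)
  open import Relation.Nullary using (¬_; Dec; yes; no; contradiction)
  open import Relation.Nullary.Decidable using (¬?; decidable-stable)

  module _ {p q : ℕ} where

    private
      n = p ℕ.+ q
      SPP = SemiPointedPartition p q
      variable
        P Q : SPP

    Cover : SPP → SPP → Set
    Cover U Y = U ≼ Y × suc (rank U) ≡ rank Y

    -- Distinct pointed blocks have distinct points, so a coatom can leave all points unchanged only
    -- by merging two unpointed blocks.
    Special : SPP → SPP → Set
    Special U Y = ∀ x → pt U x ≡ pt Y x

    special? : ∀ U Y → Dec (Special U Y)
    special? U Y = Finₚ.all? λ x → pt U x ≟ᵖ pt Y x

    merge-cover : ∀ {Y s t} → ¬ s ∼⟨ Y ⟩ t → Cover (merge Y s t) Y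
    merge-cover s≁t = merge-≼ , rank-merge s≁t

    ≼-equal-rank : P ≼ Q → rank P ≡ rank Q → P ≡ Q
    ≼-equal-rank {P} {Q} P≼Q eq with P ≟ˢ Q
    ... | yes P≡Q = P≡Q
    ... | no  P≢Q = contradiction eq (ℕₚ.<⇒≢ (rank-mono (rank Q) refl P≼Q P≢Q))

    abstract

      -- `U` lies below some merge of the same rank, and comparable partitions of equal rank
      -- coincide.
      cover-merge : ∀ {U Y} → Cover U Y → ∃[ s ] ∃[ t ] (¬ s ∼⟨ Y ⟩ t × U ≡ merge Y s t)
      cover-merge {U} {Y} (U≼Y , eq) =
        let s , t , s≁t , U≼M = below-merge U≼Y λ { refl → ℕₚ.1+n≢n eq } in
        s , t , s≁t , ≼-equal-rank U≼M (ℕₚ.suc-injective (trans eq (sym (rank-merge s≁t))))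

    -- `B` joins a pair that `A` keeps apart. Merging this pair directly in `Y` gives a second
    -- coatom above `B`.
    thick : ∀ {B A Y} → Cover B A → Cover A Y → Σ[ A′ ∈ SPP ] A′ ≢ A × B ≼ A′ × Cover A′ Y
    thick {B} {A} {Y} (B≼A , eq) (A≼Y , _) =
      let s , t , s≁t , s∼t , pt≡ = pointed-pair (≼-trans B≼A A≼Y) (coarser-pair B≼A λ { refl → ℕₚ.1+n≢n eq }) in
      merge Y s t , (λ A′≡A → s≁t (subst (s ∼⟨_⟩ t) A′≡A merge-new)) , merge-above (≼-trans B≼A A≼Y) s∼t pt≡ ,
      merge-cover λ s∼ᵞt → s≁t (coarser A≼Y s∼ᵞt)

    module Two (Y : SPP) {s t s′ t′ : Fin n} (s≁t : ¬ s ∼⟨ Y ⟩ t) (s′≁t′ : ¬ s′ ∼⟨ Y ⟩ t′) where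

      U V : SPP
      U = merge Y s t
      V = merge Y s′ t′

      -- Here `U` and `V` join the same two blocks of `Y` and can differ only in the point that is
      -- kept.
      module SamePair (s∼t : s ∼⟨ V ⟩ t) where

        s∈ : In Y s′ t′ s
        s∈ = [ (λ s∼ᵞt → contradiction s∼ᵞt s≁t) , proj₁ ]′ (merge-∼⁻ s∼t)

        t∈ : In Y s′ t′ t
        t∈ = in-merge s∈
          where
          in-merge : In Y s′ t′ s → In Y s′ t′ t
          in-merge _ = [ (λ s∼ᵞt → contradiction s∼ᵞt s≁t) , proj₂ ]′ (merge-∼⁻ s∼t)

        into : ∀ {x} → In Y s t x → In Y s′ t′ x
        into (inj₁ s∼x) = in-∼ s∈ s∼x
        into (inj₂ t∼x) = in-∼ t∈ t∼x

        cross : In Y s′ t′ s → In Y s′ t′ t → In Y s t s′ × In Y s t t′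
        cross (inj₁ s′∼s) (inj₁ s′∼t) = contradiction (∼-trans (∼-sym s′∼s) s′∼t) s≁t
        cross (inj₁ s′∼s) (inj₂ t′∼t) = inj₁ (∼-sym s′∼s) , inj₂ (∼-sym t′∼t)
        cross (inj₂ t′∼s) (inj₁ s′∼t) = inj₂ (∼-sym s′∼t) , inj₁ (∼-sym t′∼s)
        cross (inj₂ t′∼s) (inj₂ t′∼t) = contradiction (∼-trans (∼-sym t′∼s) t′∼t) s≁t

        outof : ∀ {x} → In Y s′ t′ x → In Y s t x
        outof (inj₁ s′∼x) = in-∼ (proj₁ (cross s∈ t∈)) s′∼x
        outof (inj₂ t′∼x) = in-∼ (proj₂ (cross s∈ t∈)) t′∼x

        U⇒V : ∀ {x w} → x ∼⟨ U ⟩ w → x ∼⟨ V ⟩ w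
        U⇒V x∼w = [ merge-old , (λ (i , j) → merge-in (into i) (into j)) ]′ (merge-∼⁻ x∼w)

        V⇒U : ∀ {x w} → x ∼⟨ V ⟩ w → x ∼⟨ U ⟩ w
        V⇒U x∼w = [ merge-old , (λ (i , j) → merge-in (outof i) (outof j)) ]′ (merge-∼⁻ x∼w)

        pt-outside : ∀ {w} → ¬ s ∼⟨ V ⟩ w → pt U w ≡ pt Y w × pt V w ≡ pt Y w
        pt-outside s≁w = pt-out (λ i → s≁w (U⇒V (merge-in (inj₁ ∼-refl) i))) ,
                         pt-out (λ i → s≁w (merge-in s∈ i))

        equal : pt U s ≡ pt V s → U ≡ V
        equal eq = ∼-ext V⇒U U⇒V pts
          where
          pts : ∀ x → pt U x ≡ pt V x
          pts x with ∼? V s x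
          ... | yes s∼x = trans (∼-pt (V⇒U s∼x)) (trans eq (sym (∼-pt s∼x)))
          ... | no  s≁x = let eU , eV = pt-outside s≁x in trans eU (sym eV)

        -- Absorbing the joined block into a third one forgets which of the two points had been
        -- kept.
        third : ∀ {w} → ¬ s ∼⟨ V ⟩ w → Cover (merge V w s) V × merge V w s ≼ U
        third s≁w = merge-cover (s≁w ∘ ∼-sym) , ≼-merge (≼-trans merge-≼ merge-≼) (merge-old s∼t) (∼-sym merge-new)
          (trans (proj₁ (pt-outside s≁w)) (trans (sym (proj₂ (pt-outside s≁w))) (sym (pt-in (inj₂ ∼-refl)))))

        third-above : ∀ {X w} → X ≼ V → s ∼⟨ X ⟩ w → ¬ s ∼⟨ V ⟩ w → pt V w ≡ pt X s →
                      Σ[ B ∈ SPP ] X ≼ B × Cover B V × B ≼ U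
        third-above X≼V s∼w s≁w eq = _ , merge-above X≼V (∼-sym s∼w) (trans eq (sym (∼-pt s∼w))) , third s≁w

        meet : ∀ {X} → U ≢ V → X ≼ U → X ≼ V → Σ[ B ∈ SPP ] X ≼ B × Cover B V × B ≼ U
        meet {X} U≢V X≼U X≼V with pointing X≼V s | pointing X≼U s
        ... | w , s∼w , eq | w′ , s∼w′ , eq′ with ∼? V s w | ∼? V s w′
        ... | no s≁w  | _        = third-above X≼V s∼w s≁w eq
        ... | yes _   | no s≁w′  = let eU , eV = pt-outside s≁w′ in
          third-above X≼V s∼w′ s≁w′ (trans eV (trans (sym eU) eq′))
        -- If `X` takes its point from the joined block in both `U` and `V`, then `U` and `V` kept
        -- the same point and are equal.
        ... | yes s∼ⱽw | yes s∼ⱽw′ = contradiction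
          (equal (trans (sym (∼-pt (V⇒U s∼ⱽw′))) (trans eq′ (trans (sym eq) (∼-pt s∼ⱽw))))) U≢V

      module DistinctPairs (s≁ⱽt : ¬ s ∼⟨ V ⟩ t) where

        B₁ B₂ : SPP
        B₁ = merge V s t
        B₂ = merge V t s

        -- If V absorbs the block of s into that of s′, the point of B₁ comes from s′, and U keeps it.
        B₁≼U : B₁ ≼ U
        B₁≼U with in? Y s′ t′ s
        ... | no s∉  = ≼-merge (≼-trans merge-≼ merge-≼) merge-new ∼-refl
                         (trans pt-s (sym (trans pt-s (pt-out s∉))))
        ... | yes s∈ = ≼-merge (≼-trans merge-≼ merge-≼) merge-new (merge-old (merge-in s∈ (inj₁ ∼-refl)))
                         (trans (ptU (in? Y s t s′)) (sym (trans pt-s (pt-in s∈))))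
          where
          ptU : Dec (In Y s t s′) → pt U s′ ≡ pt Y s′
          ptU (no s′∉)           = pt-out s′∉
          ptU (yes (inj₁ s∼s′)) = trans (pt-in (inj₁ s∼s′)) (sym (∼-pt s∼s′))
          ptU (yes (inj₂ t∼s′)) = contradiction (merge-in s∈ (inj₁ (∼-sym t∼s′))) s≁ⱽt

        Meet : SPP → Set
        Meet X = Σ[ B ∈ SPP ] X ≼ B × Cover B V ×
          (B ≼ U ⊎ (¬ Special V Y × Σ[ W ∈ SPP ] Cover W Y × Special W Y × B ≼ W))

        module _ {X : SPP} (X≼U : X ≼ U) (X≼V : X ≼ V) where

          s∼ˣt : s ∼⟨ X ⟩ t
          s∼ˣt = coarser X≼U merge-new

          via-B₁ : ∀ {w} → s ∼⟨ X ⟩ w → pt V w ≡ pt X s → ¬ t ∼⟨ V ⟩ w → Meet X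
          via-B₁ {w} s∼w eq t≁w = B₁ , ≼-merge X≼V s∼ˣt s∼w (ptB (∼? V s w)) , merge-cover s≁ⱽt , inj₁ B₁≼U
            where
            ptB : Dec (s ∼⟨ V ⟩ w) → pt B₁ w ≡ pt X s
            ptB (yes s∼ⱽw) = trans (pt-in (inj₁ s∼ⱽw)) (trans (sym (∼-pt s∼ⱽw)) eq)
            ptB (no s≁ⱽw)  = trans (pt-out [ s≁ⱽw , t≁w ]′) eq

          -- In general `U` has lost the point that `B₂` takes from `t`. The block of `w` in `U`,
          -- inside the merged one, still carries it.
          via-B₂ : ∀ {w} → pt V t ≡ pt X s → In V t s w → pt U w ≡ pt X s → Meet X
          via-B₂ {w} eqt w∈ eq = B₂ , merge-above X≼V (∼-sym s∼ˣt) (trans eqt (sym (∼-pt s∼ˣt))) ,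
            merge-cover (s≁ⱽt ∘ ∼-sym) ,
            inj₁ (≼-merge (≼-trans merge-≼ merge-≼) (∼-sym merge-new) (merge-in (inj₂ ∼-refl) w∈)
              (trans eq (sym (trans (pt-in (inj₂ ∼-refl)) eqt))))

          -- The case that breaks semimodularity. The blocks of `t` and `w` in `Y` are distinct and
          -- have the same point, so both are unpointed and merging them is special. `V` changes the
          -- point at `w`, so `V` is not special; and merging `t` with `w` in `V` yields a coatom of
          -- `V` below the special one.
          via-special : ∀ {w} → s ∼⟨ X ⟩ w → pt V t ≡ pt X s → pt Y w ≡ pt X s → pt V w ≢ pt X s →
                        ¬ t ∼⟨ V ⟩ w → Meet X
          via-special {w} s∼w eqt eqw neq t≁w =
            merge V t w , merge-above X≼V (∼-trans (∼-sym s∼ˣt) s∼w) (trans eqt (sym (∼-pt s∼ˣt))) , merge-cover t≁w ,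
            inj₂ ( (λ sp → neq (trans (sp w) eqw))
                 , merge Y t w , merge-cover (t≁w ∘ merge-old) , special ,
                   ≼-merge (≼-trans merge-≼ merge-≼) merge-new ∼-refl (trans pt-s (trans ptYt (sym (trans pt-s eqt)))))
            where
            w∈ : In Y s′ t′ w
            w∈ with in? Y s′ t′ w
            ... | yes i = i
            ... | no ¬i = contradiction (trans (pt-out ¬i) eqw) neq
            ptYt : pt Y t ≡ pt X s
            ptYt = trans (sym (pt-out λ t∈ → t≁w (merge-in t∈ w∈))) eqt
            special : Special (merge Y t w) Y
            special x with in? Y t w x
            ... | yes (inj₁ t∼x) = trans (pt-in (inj₁ t∼x)) (sym (∼-pt t∼x))
            ... | yes (inj₂ w∼x) = trans (pt-in (inj₂ w∼x)) (trans ptYt (trans (sym eqw) (sym (∼-pt w∼x))))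
            ... | no x∉          = pt-out x∉

          -- The block of `X` finds its point at `w` among the blocks of `V` and at `w′` among those
          -- of `U`. The special coatom is needed only if `w` lies in the block of `t`, `w′` outside
          -- both blocks, and `V` gives `w′` another point.
          meet : Meet X
          meet with pointing X≼V s | pointing X≼U s
          ... | w , s∼w , eq | w′ , s∼w′ , eq′ with ∼? V t w
          ... | no t≁w  = via-B₁ s∼w eq t≁w
          ... | yes t∼w with in? V t s w′
          ... | yes w′∈ = via-B₂ (trans (sym (∼-pt t∼w)) eq) w′∈ eq′
          ... | no  w′∉ with pt V w′ ≟ᵖ pt X s
          ... | yes eq″ = via-B₁ s∼w′ eq″ (w′∉ ∘ inj₁)
          ... | no  neq = via-special s∼w′ (trans (sym (∼-pt t∼w)) eq)
            (trans (sym (pt-out (w′∉ ∘ [ inj₂ ∘ merge-old , inj₁ ∘ merge-old ]′))) eq′) neq (w′∉ ∘ inj₁)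

      meet : ∀ {X} → U ≢ V → X ≼ U → X ≼ V → Σ[ B ∈ SPP ] X ≼ B × Cover B V ×
             (B ≼ U ⊎ (¬ Special V Y × Σ[ W ∈ SPP ] Cover W Y × Special W Y × B ≼ W))
      meet U≢V X≼U X≼V with ∼? V s t
      ... | no  s≁ⱽt = DistinctPairs.meet s≁ⱽt X≼U X≼V
      ... | yes s∼ⱽt = let B , X≼B , cov , B≼U = SamePair.meet s∼ⱽt U≢V X≼U X≼V in B , X≼B , cov , inj₁ B≼U

      -- To be below `U`, the merge of `c` and `d` must join `s` and `t`, which therefore lie one in
      -- each of these blocks. As `U` and `V` are special, the two blocks have the same point.
      special-meet : ∀ {c d} → U ≢ V → Special U Y → Special V Y → ¬ c ∼⟨ V ⟩ d → merge V c d ≼ U →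
                     Special (merge V c d) V
      special-meet {c} {d} U≢V sU sV c≁d M≼U x = by-cases (∼? V s t)
        where
        pt-st : pt V s ≡ pt V t
        pt-st = trans (sV s) (trans (sym (pt-in (inj₂ ∼-refl))) (trans (sU t) (sym (sV t))))
        pt-cd : ¬ s ∼⟨ V ⟩ t → In V c d s → In V c d t → pt V c ≡ pt V d
        pt-cd s≁ⱽt (inj₁ c∼s) (inj₁ c∼t) = contradiction (∼-trans (∼-sym c∼s) c∼t) s≁ⱽt
        pt-cd s≁ⱽt (inj₁ c∼s) (inj₂ d∼t) = trans (sym (∼-pt c∼s)) (trans pt-st (∼-pt d∼t))
        pt-cd s≁ⱽt (inj₂ d∼s) (inj₁ c∼t) = trans (sym (∼-pt c∼t)) (trans (sym pt-st) (∼-pt d∼s))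
        pt-cd s≁ⱽt (inj₂ d∼s) (inj₂ d∼t) = contradiction (∼-trans (∼-sym d∼s) d∼t) s≁ⱽt
        pts : ¬ s ∼⟨ V ⟩ t → Dec (In V c d x) → pt (merge V c d) x ≡ pt V x
        pts s≁ⱽt (no x∉)          = pt-out x∉
        pts s≁ⱽt (yes (inj₁ c∼x)) = trans (pt-in (inj₁ c∼x)) (sym (∼-pt c∼x))
        pts s≁ⱽt (yes (inj₂ d∼x)) = trans (pt-in (inj₂ d∼x)) (trans
          ([ (λ s∼t → contradiction s∼t s≁ⱽt) , (λ (i , j) → pt-cd s≁ⱽt i j) ]′ (merge-∼⁻ (coarser M≼U merge-new)))
          (sym (∼-pt d∼x)))
        by-cases : Dec (s ∼⟨ V ⟩ t) → pt (merge V c d) x ≡ pt V x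
        by-cases (yes s∼ⱽt) = contradiction (SamePair.equal s∼ⱽt (trans (sU s) (sym (sV s)))) U≢V
        by-cases (no s≁ⱽt)  = pts s≁ⱽt (in? V c d x)

      -- Replaces `meet` above the adjoined bottom, where no lower bound prescribes a point. In the
      -- same-pair case any third block will do.
      meet-unbounded : U ≢ V → Σ (Fin n) (λ w → ¬ s ∼⟨ V ⟩ w) → Σ[ B ∈ SPP ] Cover B V × B ≼ U
      meet-unbounded U≢V (w , s≁w) with ∼? V s t
      ... | no  s≁ⱽt = _ , merge-cover s≁ⱽt , DistinctPairs.B₁≼U s≁ⱽt
      ... | yes s∼ⱽt = _ , SamePair.third s∼ⱽt s≁w

    -- The two blocks of `V` merged in `B` are unpointed, so each contains an unpointed block of
    -- `Y`. Merging those two gives a special coatom of `Y` above `B`.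
    special-lift : ∀ {B V Y} → V ≼ Y → Cover B V → Special B V → Σ[ W ∈ SPP ] Cover W Y × Special W Y × B ≼ W
    special-lift {B} {V} {Y} V≼Y cov sp with cover-merge cov
    ... | c , d , c≁d , refl with pointing V≼Y c | pointing V≼Y d
    ... | c′ , c∼c′ , eqc | d′ , d∼d′ , eqd =
        merge Y c′ d′ , merge-cover (λ c′∼d′ → c≁d (∼-trans c∼c′ (∼-trans (coarser V≼Y c′∼d′) (∼-sym d∼d′)))) ,
        special , ≼-merge (≼-trans merge-≼ V≼Y) (merge-in (inj₁ c∼c′) (inj₂ d∼d′)) ∼-refl
                    (trans pt-s (trans eqc (sym (pt-in (inj₁ c∼c′)))))
      where
      pt-cd : pt Y c′ ≡ pt Y d′
      pt-cd = trans eqc (trans (sym (pt-in (inj₂ ∼-refl))) (trans (sp d) (sym eqd)))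
      special : Special (merge Y c′ d′) Y
      special x with in? Y c′ d′ x
      ... | yes (inj₁ c∼x) = trans (pt-in (inj₁ c∼x)) (sym (∼-pt c∼x))
      ... | yes (inj₂ d∼x) = trans (pt-in (inj₂ d∼x)) (trans pt-cd (sym (∼-pt d∼x)))
      ... | no x∉          = pt-out x∉

    meet : ∀ {X U V Y} → Cover U Y → Cover V Y → U ≢ V → X ≼ U → X ≼ V → Σ[ B ∈ SPP ] X ≼ B × Cover B V ×
           (B ≼ U ⊎ (¬ Special V Y × Σ[ W ∈ SPP ] Cover W Y × Special W Y × B ≼ W))
    meet {Y = Y} covU covV with cover-merge covU | cover-merge covV
    ... | _ , _ , s≁t , refl | _ , _ , s′≁t′ , refl = Two.meet Y s≁t s′≁t′

    special-meet : ∀ {B U V Y} → Cover U Y → Cover V Y → U ≢ V → Special U Y → Special V Y → Cover B V → B ≼ U → Special B V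
    special-meet {Y = Y} covU covV U≢V sU sV covB B≼U with cover-merge covU | cover-merge covV | cover-merge covB
    ... | _ , _ , s≁t , refl | _ , _ , s′≁t′ , refl | _ , _ , c≁d , refl =
      Two.special-meet Y s≁t s′≁t′ U≢V sU sV c≁d B≼U

    one-block-rank : ∀ x → (∀ w → x ∼⟨ P ⟩ w) → rank P ≡ 1
    one-block-rank {P} x one = trans (sym (rank-transversal (Finₚ._≟ x) record
      { choice   = λ _ → x
      ; chosen   = λ _ → refl
      ; ∼-choice = λ w → ∼-sym (one w)
      ; unique   = λ { refl refl _ → refl }
      })) (count-singleton x)

    two-blocks : ∀ {k} → rank P ≡ suc (suc k) → ∀ x → Σ[ w ∈ Fin n ] ¬ x ∼⟨ P ⟩ w
    two-blocks {P} rk x with Finₚ.any? (λ w → ¬? (∼? P x w))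
    ... | yes found = found
    ... | no ¬found = contradiction (trans (sym rk) (one-block-rank x λ w →
      decidable-stable (∼? P x w) λ x≁w → ¬found (w , x≁w))) λ ()

    meet-unbounded : ∀ {k U V Y} → Cover U Y → Cover V Y → U ≢ V → rank V ≡ suc (suc k) → Σ[ B ∈ SPP ] Cover B V × B ≼ U
    meet-unbounded {Y = Y} covU covV U≢V rk with cover-merge covU | cover-merge covV
    ... | s , _ , s≁t , refl | _ , _ , s′≁t′ , refl = Two.meet-unbounded Y s≁t s′≁t′ U≢V (two-blocks rk s)

    rank-positive : ∀ (P : SPP) → Fin n → Σ[ k ∈ ℕ ] rank P ≡ suc k
    rank-positive P x = _ , trans (rank≡count P) (count-remove (isRep? P) (Transversal.chosen (reps P) x))

    shelling : Shelling (Π p q)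
    shelling = record
      { ρ            = rank
      ; ρ-mono       = λ {P} {Q} (P⊑Q , P≢Q) → rank-mono (rank Q) refl (⊑⇒≼ P⊑Q) P≢Q
      ; Special      = Special
      ; special?     = special?
      ; coatom       = λ (P⊑Q , P≢Q) → let s , t , s≁t , P≼M = below-merge (⊑⇒≼ P⊑Q) P≢Q in
                         _ , ≼⇒⊑ P≼M , to (merge-cover s≁t)
      ; meet         = λ {x} {u} {v} u⋖y v⋖y u≢v x⊑u x⊑v →
                         let B , X≼B , cov , rest = meet (from u⋖y) (from v⋖y) u≢v (⊑⇒≼ {P = x} {u} x⊑u) (⊑⇒≼ {P = x} {v} x⊑v) in
                         B , ≼⇒⊑ X≼B , to cov , [ inj₁ ∘ ≼⇒⊑ , (λ (¬s , W , covW , sp , B≼W) → inj₂ (¬s , W , to covW , sp , ≼⇒⊑ B≼W)) ]′ rest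
      ; special-meet = λ {b} {u} u⋖y v⋖y u≢v su sv b⋖v b⊑u → special-meet (from u⋖y) (from v⋖y) u≢v su sv (from b⋖v) (⊑⇒≼ {P = b} {u} b⊑u)
      ; special-lift = λ {b} {v} {y} v⋖y _ b⋖v sb →
                         let W , covW , sp , B≼W = special-lift {b} {v} {y} (proj₁ (from v⋖y)) (from b⋖v) sb in
                         W , to covW , sp , ≼⇒⊑ B≼W
      }
      where
      to : ∀ {U Y} → Cover U Y → U ⊑ Y × suc (rank U) ≡ rank Y
      to (U≼Y , eq) = ≼⇒⊑ U≼Y , eq
      from : ∀ {U Y} → U ⊑ Y × suc (rank U) ≡ rank Y → Cover U Y
      from (U⊑Y , eq) = ⊑⇒≼ U⊑Y , eq

    shelling-thick : Shelling.Thick shelling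
    shelling-thick {b} {a} {y} (b⊑a , eq) (a⊑y , eq′) =
      let A′ , A′≢a , b≼A′ , A′≼y , eq″ = thick (⊑⇒≼ {P = b} {a} b⊑a , eq) (⊑⇒≼ {P = a} {y} a⊑y , eq′) in
      A′ , A′≢a , ≼⇒⊑ b≼A′ , ≼⇒⊑ A′≼y , eq″

-- The recursive coatom ordering with a bottom element adjoined

module BottomShelling where

  open CoatomOrderings
  open Partitions
  open IntervalShelling
  open import Data.Fin.Base as Fin using (Fin)
  open import Data.Nat.Base as ℕ using (ℕ; zero; suc)
  import Data.Nat.Properties as ℕₚ
  open import Data.Product.Base using (Σ-syntax; _×_; _,_; proj₁)
  open import Data.Sum.Base using (_⊎_; inj₁; inj₂; [_,_]′)
  open import Data.Empty using (⊥)
  open import Function.Base using (_∘_)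
  import Relation.Binary.Construct.Add.Infimum.NonStrict as AddInfimum
  open import Relation.Binary.PropositionalEquality using (_≡_; _≢_; refl; sym; trans; cong)
  open import Relation.Nullary using (¬_; Dec; no; contradiction)
  open import Relation.Nullary.Construct.Add.Infimum using (_₋; ⊥₋; [_])
  open import Relation.Nullary.Decidable using (decidable-stable)

  module _ {p q : ℕ} (x₀ : Fin (p ℕ.+ q)) where

    private
      SPP = SemiPointedPartition p q

    open AddInfimum (_⊑_ {p} {q}) using (_≤₋_; ⊥₋≤_; [_])

    rank₋ : SPP ₋ → ℕ
    rank₋ ⊥₋    = 0
    rank₋ [ P ] = rank P

    Special₋ : SPP ₋ → SPP ₋ → Set
    Special₋ [ U ] [ Y ] = Special U Y
    Special₋ _     _     = ⊥

    special₋? : ∀ U Y → Dec (Special₋ U Y)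
    special₋? [ U ] [ Y ] = special? U Y
    special₋? [ U ] ⊥₋    = no λ ()
    special₋? ⊥₋    _     = no λ ()

    Cover₋ : SPP ₋ → SPP ₋ → Set
    Cover₋ U Y = U ≤₋ Y × suc (rank₋ U) ≡ rank₋ Y

    rank≢0 : ∀ {P : SPP} → rank P ≢ 0
    rank≢0 {P} eq = let k , rk = rank-positive P x₀ in contradiction (trans (sym rk) eq) λ ()

    one-block : ∀ {P : SPP} → rank P ≡ 1 → ∀ x w → x ∼⟨ P ⟩ w
    one-block {P} rk x w = decidable-stable (∼? P x w) λ x≁w →
      rank≢0 (ℕₚ.suc-injective (trans (rank-merge x≁w) rk))

    from : ∀ {U Y} → Cover₋ [ U ] [ Y ] → Cover U Y
    from ([ U⊑Y ] , eq) = ⊑⇒≼ U⊑Y , eq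

    to : ∀ {U Y} → Cover U Y → Cover₋ [ U ] [ Y ]
    to (U≼Y , eq) = [ ≼⇒⊑ U≼Y ] , eq

    mono : ∀ {x y} → x ≤₋ y → x ≢ y → rank₋ x ℕ.< rank₋ y
    mono (⊥₋≤ ⊥₋)    ne = contradiction refl ne
    mono (⊥₋≤ [ P ]) ne = ℕₚ.n≢0⇒n>0 rank≢0
    mono {[ P ]} {[ Q ]} [ P⊑Q ] ne = rank-mono (rank Q) refl (⊑⇒≼ P⊑Q) (ne ∘ cong [_])

    coatom : ∀ {x y} → x ≤₋ y → x ≢ y → Σ[ u ∈ SPP ₋ ] x ≤₋ u × Cover₋ u y
    coatom (⊥₋≤ ⊥₋) ne = contradiction refl ne
    coatom (⊥₋≤ [ P ]) _ = by-rank (rank P) refl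
      where
      by-rank : ∀ k → rank P ≡ k → Σ[ u ∈ SPP ₋ ] ⊥₋ ≤₋ u × Cover₋ u [ P ]
      by-rank zero          rk = contradiction rk rank≢0
      by-rank (suc zero)    rk = ⊥₋ , (⊥₋≤ ⊥₋) , (⊥₋≤ [ P ]) , sym rk
      by-rank (suc (suc k)) rk = let w , x≁w = two-blocks rk x₀ in
        [ merge P x₀ w ] , (⊥₋≤ _) , to (merge-cover x≁w)
    coatom {[ P ]} {[ Q ]} [ P⊑Q ] ne = let s , t , s≁t , P≼M = below-merge (⊑⇒≼ P⊑Q) (ne ∘ cong [_]) in
      [ merge Q s t ] , [ ≼⇒⊑ P≼M ] , to (merge-cover s≁t)

    meet₋ : ∀ {x u v y} → Cover₋ u y → Cover₋ v y → u ≢ v → x ≤₋ u → x ≤₋ v →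
            Σ[ b ∈ SPP ₋ ] x ≤₋ b × Cover₋ b v ×
              (b ≤₋ u ⊎ (¬ Special₋ v y × Σ[ w ∈ SPP ₋ ] Cover₋ w y × Special₋ w y × b ≤₋ w))
    meet₋ {u = ⊥₋} {⊥₋} _ _ u≢v _ _ = contradiction refl u≢v
    -- Coatoms of one element have equal rank, so the bottom, of rank 0, cannot occur beside a
    -- partition.
    meet₋ {u = ⊥₋} {[ V ]} {y} (_ , eq) (_ , eq′) _ _ _ = contradiction (ℕₚ.suc-injective (trans eq′ (sym eq))) rank≢0
    meet₋ {u = [ U ]} {⊥₋} (_ , eq) (_ , eq′) _ _ _ = contradiction (ℕₚ.suc-injective (trans eq (sym eq′))) rank≢0
    meet₋ {u = [ U ]} {[ V ]} {⊥₋} (() , _)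
    meet₋ {⊥₋} {[ U ]} {[ V ]} {[ Y ]} covU covV u≢v _ _ = by-rank (rank V) refl
      where
      Goal : Set
      Goal = Σ[ b ∈ SPP ₋ ] ⊥₋ ≤₋ b × Cover₋ b [ V ] ×
              (b ≤₋ [ U ] ⊎ (¬ Special V Y × Σ[ w ∈ SPP ₋ ] Cover₋ w [ Y ] × Special₋ w [ Y ] × b ≤₋ w))
      by-rank : ∀ k → rank V ≡ k → Goal
      by-rank zero          rk = contradiction rk rank≢0
      -- A partition with one block has the bottom as a coatom, and the bottom lies below `U`.
      by-rank (suc zero)    rk = ⊥₋ , (⊥₋≤ ⊥₋) , ((⊥₋≤ [ V ]) , sym rk) , inj₁ (⊥₋≤ [ U ])
      by-rank (suc (suc k)) rk = let B , cov , B≼U = meet-unbounded (from covU) (from covV) (u≢v ∘ cong [_]) rk in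
        [ B ] , (⊥₋≤ _) , to cov , inj₁ [ ≼⇒⊑ B≼U ]
    meet₋ {[ X ]} {[ U ]} {[ V ]} {[ Y ]} covU covV u≢v [ X⊑U ] [ X⊑V ] =
      let B , X≼B , cov , rest = meet (from covU) (from covV) (u≢v ∘ cong [_]) (⊑⇒≼ {P = X} {U} X⊑U) (⊑⇒≼ {P = X} {V} X⊑V) in
      [ B ] , [ ≼⇒⊑ X≼B ] , to cov ,
      [ (λ B≼U → inj₁ [ ≼⇒⊑ B≼U ]) , (λ (¬s , W , covW , sp , B≼W) → inj₂ (¬s , [ W ] , to covW , sp , [ ≼⇒⊑ B≼W ])) ]′ rest

    special-meet₋ : ∀ {b u v y} → Cover₋ u y → Cover₋ v y → u ≢ v → Special₋ u y → Special₋ v y →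
                    Cover₋ b v → b ≤₋ u → Special₋ b v
    special-meet₋ {[ B ]} {[ U ]} {[ V ]} {[ Y ]} covU covV u≢v su sv covB [ B⊑U ] =
      special-meet (from covU) (from covV) (u≢v ∘ cong [_]) su sv (from covB) (⊑⇒≼ {P = B} {U} B⊑U)
    -- If the bottom is a coatom of `V`, then `U` and `V` both have one block. Being special, both
    -- carry the points of `Y`, so they are equal.
    special-meet₋ {⊥₋} {[ U ]} {[ V ]} {[ Y ]} (_ , eqU) (_ , eqV) u≢v su sv (_ , eq) _ =
      contradiction (cong [_] (∼-ext (λ _ → one-block rkU _ _) (λ _ → one-block (sym eq) _ _) λ x → trans (su x) (sym (sv x)))) u≢v
      where
      rkU : rank U ≡ 1
      rkU = ℕₚ.suc-injective (trans eqU (trans (sym eqV) (cong suc (sym eq))))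

    special-lift₋ : ∀ {b v y} → Cover₋ v y → Cover₋ b v → Special₋ b v →
                    Σ[ w ∈ SPP ₋ ] Cover₋ w y × Special₋ w y × b ≤₋ w
    special-lift₋ {[ B ]} {[ V ]} {[ Y ]} covV covB sb =
      let W , covW , sp , B≼W = special-lift (proj₁ (from covV)) (from covB) sb in
      [ W ] , to covW , sp , [ ≼⇒⊑ B≼W ]
    special-lift₋ {[ B ]} {[ V ]} {⊥₋} (() , _)

    shelling₋ : Shelling (Π̂ p q)
    shelling₋ = record
      { ρ            = rank₋
      ; ρ-mono       = λ (x≤y , x≢y) → mono x≤y x≢y
      ; Special      = Special₋
      ; special?     = special₋?
      ; coatom       = λ (x≤y , x≢y) → coatom x≤y x≢y
      ; meet         = meet₋
      ; special-meet = special-meet₋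
      ; special-lift = λ v⋖y _ → special-lift₋ v⋖y
      }

-- Finite differences and the evaluation of the lower sums

module FiniteDifferences where

  open CoatomOrderings using (sgn)
  open import Data.Integer.Base as ℤ using (ℤ; +_; 0ℤ; 1ℤ; -1ℤ; _+_; _*_; _-_; -_; _^_)
  import Data.Integer.Properties as ℤₚ
  open import Data.Integer.Tactic.RingSolver using (solve-∀)
  open import Data.Nat.Base as ℕ using (ℕ; zero; suc; _∸_)
  import Data.Nat.Properties as ℕₚ
  open import Data.Product.Base using (_×_; _,_; proj₁; proj₂)
  open import Relation.Binary.PropositionalEquality using (_≡_; _≢_; refl; sym; trans; cong; cong₂; subst; module ≡-Reasoning)
  open import Relation.Nullary using (contradiction)
  open ≡-Reasoning

  D : (ℕ → ℤ) → ℕ → ℤ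
  D f a = f a - f (suc a)

  -- With S the shift these iterate 1 - S, S + 1 and a (1 - S). In particular `Eⁿ i f k` is the sum
  -- over κ of (i choose κ) f (κ + k), the choice of κ among `i` pointed blocks.
  Dⁿ Eⁿ Λⁿ : ℕ → (ℕ → ℤ) → ℕ → ℤ
  Dⁿ zero    f a = f a
  Dⁿ (suc i) f a = Dⁿ i f a - Dⁿ i f (suc a)
  Eⁿ zero    f a = f a
  Eⁿ (suc i) f a = Eⁿ i f (suc a) + Eⁿ i f a
  Λⁿ zero    f a = f a
  Λⁿ (suc j) f a = + a * (Λⁿ j f a - Λⁿ j f (suc a))

  -- One step accounts for one unpointed block: it is chosen, which raises `c`, or it goes to one of
  -- the κ pointed or `c` earlier unpointed blocks already chosen.
  Lⁿ : ℕ → ℕ → (ℕ → ℤ) → ℕ → ℤ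
  Lⁿ κ zero    f c = f c
  Lⁿ κ (suc j) f c = Lⁿ κ j f (suc c) + + (κ ℕ.+ c) * Lⁿ κ j f c

  Dⁿ-cong : ∀ i {f g : ℕ → ℤ} → (∀ a → f a ≡ g a) → ∀ a → Dⁿ i f a ≡ Dⁿ i g a
  Dⁿ-cong zero    eq a = eq a
  Dⁿ-cong (suc i) eq a = cong₂ _-_ (Dⁿ-cong i eq a) (Dⁿ-cong i eq (suc a))

  Dⁿ-inner : ∀ i f a → Dⁿ (suc i) f a ≡ Dⁿ i (D f) a
  Dⁿ-inner zero    f a = refl
  Dⁿ-inner (suc i) f a = cong₂ _-_ (Dⁿ-inner i f a) (Dⁿ-inner i f (suc a))

  Eⁿ-cong : ∀ i {h h′ : ℕ → ℤ} k → (∀ κ → κ ℕ.≤ i ℕ.+ k → h κ ≡ h′ κ) → Eⁿ i h k ≡ Eⁿ i h′ k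
  Eⁿ-cong zero    k eq = eq k ℕₚ.≤-refl
  Eⁿ-cong (suc i) k eq = cong₂ _+_
    (Eⁿ-cong i (suc k) λ κ κ≤ → eq κ (subst (κ ℕ.≤_) (ℕₚ.+-suc i k) κ≤))
    (Eⁿ-cong i k λ κ κ≤ → eq κ (ℕₚ.m≤n⇒m≤1+n κ≤))

  Eⁿ-+ : ∀ i (f g : ℕ → ℤ) k → Eⁿ i (λ κ → f κ + g κ) k ≡ Eⁿ i f k + Eⁿ i g k
  Eⁿ-+ zero    f g k = refl
  Eⁿ-+ (suc i) f g k = trans (cong₂ _+_ (Eⁿ-+ i f g (suc k)) (Eⁿ-+ i f g k)) (lemma (Eⁿ i f (suc k)) (Eⁿ i f k) _ _)
    where
    lemma : ∀ a b c d → (a + c) + (b + d) ≡ (a + b) + (c + d)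
    lemma = solve-∀

  -- A sign alternating in κ turns S + 1 into the difference 1 - S.
  Eⁿ-sgn : ∀ i g k → Eⁿ i (λ κ → - (sgn κ * g κ)) k ≡ - (sgn k * Dⁿ i g k)
  Eⁿ-sgn zero    g k = refl
  Eⁿ-sgn (suc i) g k = trans (cong₂ _+_ (Eⁿ-sgn i g (suc k)) (Eⁿ-sgn i g k)) (lemma (sgn k) _ _)
    where
    lemma : ∀ s x y → - ((-1ℤ * s) * y) + - (s * x) ≡ - (s * (x - y))
    lemma = solve-∀

  private
    atZero : ℤ → ℕ → ℤ
    atZero v zero    = v
    atZero v (suc _) = 0ℤ

    Eⁿ-atZero-suc : ∀ i v k → Eⁿ i (atZero v) (suc k) ≡ 0ℤ
    Eⁿ-atZero-suc zero    v k = refl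
    Eⁿ-atZero-suc (suc i) v k = cong₂ _+_ (Eⁿ-atZero-suc i v (suc k)) (Eⁿ-atZero-suc i v k)

    Eⁿ-atZero : ∀ i v → Eⁿ i (atZero v) 0 ≡ v
    Eⁿ-atZero zero    v = refl
    Eⁿ-atZero (suc i) v = trans (cong₂ _+_ (Eⁿ-atZero-suc i v 0) (Eⁿ-atZero i v)) (ℤₚ.+-identityˡ v)

  -- The formula for `h` is known only from κ = 1 on. At κ = 0 it would predict -g 0; the defect h 0
  -- + g 0 enters with binomial coefficient 1.
  Eⁿ-corrected : ∀ i {h} g → (∀ κ → suc κ ℕ.≤ i → h (suc κ) ≡ - (sgn (suc κ) * g (suc κ))) →
                 Eⁿ i h 0 ≡ (h 0 + g 0) - Dⁿ i g 0
  Eⁿ-corrected i {h} g eq = begin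
    Eⁿ i h 0
      ≡⟨ Eⁿ-cong i 0 split ⟩
    Eⁿ i (λ κ → atZero (h 0 + g 0) κ + - (sgn κ * g κ)) 0
      ≡⟨ Eⁿ-+ i (atZero (h 0 + g 0)) (λ κ → - (sgn κ * g κ)) 0 ⟩
    Eⁿ i (atZero (h 0 + g 0)) 0 + Eⁿ i (λ κ → - (sgn κ * g κ)) 0
      ≡⟨ cong₂ _+_ (Eⁿ-atZero i _) (trans (Eⁿ-sgn i g 0) (cong -_ (ℤₚ.*-identityˡ _))) ⟩
    (h 0 + g 0) - Dⁿ i g 0 ∎
    where
    lemma : ∀ x y → x ≡ (x + y) + - (1ℤ * y)
    lemma = solve-∀
    split : ∀ κ → κ ℕ.≤ i ℕ.+ 0 → h κ ≡ atZero (h 0 + g 0) κ + - (sgn κ * g κ)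
    split zero    _  = lemma (h 0) (g 0)
    split (suc κ) κ≤ = trans (eq κ (subst (suc κ ℕ.≤_) (ℕₚ.+-identityʳ i) κ≤)) (sym (ℤₚ.+-identityˡ _))

  Lⁿ-cong : ∀ κ j {f g : ℕ → ℤ} → (∀ c → f c ≡ g c) → ∀ c → Lⁿ κ j f c ≡ Lⁿ κ j g c
  Lⁿ-cong κ zero    eq c = eq c
  Lⁿ-cong κ (suc j) eq c = cong₂ _+_ (Lⁿ-cong κ j eq (suc c)) (cong (λ t → + (κ ℕ.+ c) * t) (Lⁿ-cong κ j eq c))

  -- The substitution that turns the counting operator L into Λ = a D.
  Lⁿ-sgn : ∀ κ j (R : ℕ → ℤ) f → (∀ c → R (suc c) ≡ R c * + (κ ℕ.+ c)) → ∀ c →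
           Lⁿ κ j (λ c → sgn (κ ℕ.+ c) * R c * f (κ ℕ.+ c)) c ≡ sgn (κ ℕ.+ c) * R c * Λⁿ j f (κ ℕ.+ c)
  Lⁿ-sgn κ zero    R f step c = refl
  Lⁿ-sgn κ (suc j) R f step c = begin
    Lⁿ κ j G (suc c) + A * Lⁿ κ j G c
      ≡⟨ cong₂ (λ x y → x + A * y) (Lⁿ-sgn κ j R f step (suc c)) (Lⁿ-sgn κ j R f step c) ⟩
    sgn (κ ℕ.+ suc c) * R (suc c) * Λⁿ j f (κ ℕ.+ suc c) + A * (sgn (κ ℕ.+ c) * R c * Λⁿ j f (κ ℕ.+ c))
      ≡⟨ cong₂ (λ k r → sgn k * r * Λⁿ j f k + A * (sgn (κ ℕ.+ c) * R c * Λⁿ j f (κ ℕ.+ c))) (ℕₚ.+-suc κ c) (step c) ⟩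
    (-1ℤ * sgn (κ ℕ.+ c)) * (R c * A) * Λⁿ j f (suc (κ ℕ.+ c)) + A * (sgn (κ ℕ.+ c) * R c * Λⁿ j f (κ ℕ.+ c))
      ≡⟨ lemma (sgn (κ ℕ.+ c)) (R c) A _ _ ⟩
    sgn (κ ℕ.+ c) * R c * (A * (Λⁿ j f (κ ℕ.+ c) - Λⁿ j f (suc (κ ℕ.+ c)))) ∎
    where
    G : ℕ → ℤ
    G c = sgn (κ ℕ.+ c) * R c * f (κ ℕ.+ c)
    A = + (κ ℕ.+ c)
    lemma : ∀ s r a x y → (-1ℤ * s) * (r * a) * y + a * (s * r * x) ≡ s * r * (a * (x - y))
    lemma = solve-∀

  -- Functions of two variables killed by any d differences; a polynomial of joint degree < d is one.

  Deg : ℕ → (ℕ → ℕ → ℤ) → Set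
  Deg zero    φ = ∀ κ a → φ κ a ≡ 0ℤ
  Deg (suc d) φ = Deg d (λ κ a → φ κ a - φ (suc κ) a) × Deg d (λ κ → D (φ κ))

  Deg-cong : ∀ d {φ ψ} → (∀ κ a → φ κ a ≡ ψ κ a) → Deg d φ → Deg d ψ
  Deg-cong zero    eq deg κ a = trans (sym (eq κ a)) (deg κ a)
  Deg-cong (suc d) eq (deg₁ , deg₂) =
    Deg-cong d (λ κ a → cong₂ _-_ (eq κ a) (eq (suc κ) a)) deg₁ ,
    Deg-cong d (λ κ a → cong₂ _-_ (eq κ a) (eq κ (suc a))) deg₂

  Deg-zero : ∀ d {φ} → (∀ κ a → φ κ a ≡ 0ℤ) → Deg d φ
  Deg-zero zero    eq = eq
  Deg-zero (suc d) eq = Deg-zero d (λ κ a → cong₂ _-_ (eq κ a) (eq (suc κ) a)) ,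
                        Deg-zero d (λ κ a → cong₂ _-_ (eq κ a) (eq κ (suc a)))

  private
    interchange : ∀ x y z w → (x - z) + (y - w) ≡ (x + y) - (z + w)
    interchange = solve-∀
    neg-minus : ∀ x y → - (x - y) ≡ - x - - y
    neg-minus = solve-∀

  Deg-+ : ∀ d {φ ψ} → Deg d φ → Deg d ψ → Deg d (λ κ a → φ κ a + ψ κ a)
  Deg-+ zero    deg deg′ κ a = cong₂ _+_ (deg κ a) (deg′ κ a)
  Deg-+ (suc d) {φ} {ψ} (deg₁ , deg₂) (deg₁′ , deg₂′) =
    Deg-cong d (λ κ a → interchange (φ κ a) (ψ κ a) _ _) (Deg-+ d deg₁ deg₁′) ,
    Deg-cong d (λ κ a → interchange (φ κ a) (ψ κ a) _ _) (Deg-+ d deg₂ deg₂′)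

  Deg-neg : ∀ d {φ} → Deg d φ → Deg d (λ κ a → - φ κ a)
  Deg-neg zero    deg κ a = cong -_ (deg κ a)
  Deg-neg (suc d) {φ} (deg₁ , deg₂) = Deg-cong d (λ κ a → neg-minus (φ κ a) _) (Deg-neg d deg₁) ,
                                  Deg-cong d (λ κ a → neg-minus (φ κ a) _) (Deg-neg d deg₂)

  Deg-shift : ∀ d {φ} → Deg d φ → Deg d (λ κ a → φ κ (suc a)) × Deg d (λ κ a → φ (suc κ) a)
  Deg-shift zero    deg = (λ κ a → deg κ (suc a)) , (λ κ a → deg (suc κ) a)
  Deg-shift (suc d) (deg₁ , deg₂) =
    (proj₁ (Deg-shift d deg₁) , proj₁ (Deg-shift d deg₂)) , (proj₂ (Deg-shift d deg₁) , proj₂ (Deg-shift d deg₂))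

  -- By the product rule D (a φ) = a D φ - φ (a + 1), so one extra difference suffices.
  Deg-* : ∀ d {φ} → Deg d φ → Deg (suc d) (λ κ a → + a * φ κ a)
  Deg-* zero    deg = Deg-zero 1 λ κ a → trans (cong (λ t → + a * t) (deg κ a)) (ℤₚ.*-zeroʳ (+ a))
  Deg-* (suc d) {φ} deg@(deg₁ , deg₂) =
    Deg-cong (suc d) (λ κ a → lemma₁ (+ a) (φ κ a) _) (Deg-* d deg₁) ,
    Deg-cong (suc d) (λ κ a → lemma₂ (+ a) (φ κ a) (φ κ (suc a)))
      (Deg-+ (suc d) {λ κ a → + a * D (φ κ) a} {λ κ a → - φ κ (suc a)} (Deg-* d deg₂)
        (Deg-neg (suc d) {λ κ a → φ κ (suc a)} (proj₁ (Deg-shift (suc d) {φ} deg))))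
    where
    lemma₁ : ∀ a x y → a * (x - y) ≡ a * x - a * y
    lemma₁ = solve-∀
    lemma₂ : ∀ a x y → a * (x - y) + - y ≡ a * x - (1ℤ + a) * y
    lemma₂ = solve-∀

  -- The difference lowers the degree and the factor `a` restores it.
  Deg-Λ : ∀ j d {φ} → Deg d φ → Deg d (λ κ → Λⁿ j (φ κ))
  Deg-Λ zero    d deg = deg
  Deg-Λ (suc j) zero deg κ a = trans (cong (λ t → + a * t)
    (cong₂ _-_ (Deg-Λ j zero deg κ a) (Deg-Λ j zero deg κ (suc a)))) (ℤₚ.*-zeroʳ (+ a))
  Deg-Λ (suc j) (suc d) deg = Deg-* d (proj₂ (Deg-Λ j (suc d) deg))

  -- A step along the diagonal is a step in κ followed by a step in `a`, and either difference
  -- lowers the degree.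
  Deg-diagonal : ∀ d {φ} → Deg d φ → ∀ k → Dⁿ d (λ κ → φ κ κ) k ≡ 0ℤ
  Deg-diagonal zero    deg k = deg k k
  Deg-diagonal (suc d) {φ} (deg₁ , deg₂) k = begin
    Dⁿ (suc d) (λ κ → φ κ κ) k         ≡⟨ Dⁿ-inner d (λ κ → φ κ κ) k ⟩
    Dⁿ d (D (λ κ → φ κ κ)) k           ≡⟨ Dⁿ-cong d (λ κ → lemma (φ κ κ) (φ (suc κ) κ) (φ (suc κ) (suc κ))) k ⟩
    Dⁿ d (λ κ → ψ κ κ) k               ≡⟨ Deg-diagonal d {ψ} (Deg-+ d deg₁ (proj₂ (Deg-shift d deg₂))) k ⟩
    0ℤ ∎
    where
    ψ : ℕ → ℕ → ℤ
    ψ κ a = (φ κ a - φ (suc κ) a) + D (φ (suc κ)) a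
    lemma : ∀ x y z → x - z ≡ (x - y) + (y - z)
    lemma = solve-∀

  Deg-power : ∀ d → Deg (suc d) (λ _ a → (+ a) ^ d)
  Deg-power zero    = Deg-zero 0 (λ _ _ → refl) , Deg-zero 0 (λ _ _ → refl)
  Deg-power (suc d) = Deg-* (suc d) (Deg-power d)

  power-vanishes : ∀ i j → Dⁿ (suc i) (Λⁿ j (λ a → (+ a) ^ i)) 0 ≡ 0ℤ
  power-vanishes i j = Deg-diagonal (suc i) {λ _ → Λⁿ j (λ a → (+ a) ^ i)}
    (Deg-Λ j (suc i) {λ _ a → (+ a) ^ i} (Deg-power i)) 0

  -- The rising factorial. For p ≥ 1 and n = p + q, `rise p q` is (n - 1)! / (p - 1)!.
  rise : ℕ → ℕ → ℤ
  rise κ zero    = 1ℤ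
  rise κ (suc c) = rise κ c * + (κ ℕ.+ c)

  -- Σ_v μ(m v , y), μ(⊥ , y) and the sum of μ(x , y) over the minimal x, for y with κ pointed and c unpointed blocks.
  pointedSum bottomNumber minimalSum : ℕ → ℕ → ℤ
  pointedSum zero    c = 0ℤ
  pointedSum (suc κ) c = - (sgn (suc κ ℕ.+ c) * rise (suc κ) c * (+ (suc κ ℕ.+ c)) ^ κ)

  bottomNumber zero    (suc zero) = -1ℤ
  bottomNumber zero    _          = 0ℤ
  bottomNumber (suc κ) c = sgn (suc κ ℕ.+ c) * rise (suc κ) c * (+ (suc κ ℕ.+ c) - 1ℤ) ^ κ

  minimalSum κ zero    = pointedSum κ zero
  minimalSum κ (suc c) = - (sgn (κ ℕ.+ suc c) * rise (suc κ) c * (+ (κ ℕ.+ suc c)) ^ κ)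

  -- The sum of `T` over the partitions below one with `i` pointed and `j` unpointed blocks. Here κ
  -- and `c` count the chosen blocks, and each of the i - κ other pointed blocks may go to any of
  -- these.
  total : (ℕ → ℕ → ℤ) → ℕ → ℕ → ℤ
  total T i j = Eⁿ i (λ κ → Lⁿ κ j (λ c → T κ c * (+ (κ ℕ.+ c)) ^ (i ∸ κ)) 0) 0

  power-split : ∀ (x : ℤ) {κ i} → κ ℕ.≤ i → x ^ κ * x ^ (i ∸ κ) ≡ x ^ i
  power-split x {κ} κ≤i = trans (sym (ℤₚ.^-distribˡ-+-* x κ _)) (cong (x ^_) (ℕₚ.m+[n∸m]≡n κ≤i))

  Λⁿ-at-0 : ∀ j f → Λⁿ (suc j) f 0 ≡ 0ℤ
  Λⁿ-at-0 j f = ℤₚ.*-zeroˡ (Λⁿ j f 0 - Λⁿ j f 1)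

  -- The exponents κ - 1 and i - κ add up to i - 1, so a single power of `a` remains, the same for
  -- all κ.
  total-pointedSum : ∀ i j → total pointedSum i j ≡ Λⁿ j (λ a → (+ a) ^ (i ∸ 1)) 0 - Dⁿ i (λ κ → Λⁿ j (λ a → (+ a) ^ (i ∸ 1)) κ) 0
  total-pointedSum i j = trans (Eⁿ-corrected i {h} g step) (cong (_- Dⁿ i g 0) (trans (cong (_+ g 0) (zero-L j 0)) (ℤₚ.+-identityˡ (g 0))))
    where
    f g h : ℕ → ℤ
    f a = (+ a) ^ (i ∸ 1)
    g = Λⁿ j f
    h κ = Lⁿ κ j (λ c → pointedSum κ c * (+ (κ ℕ.+ c)) ^ (i ∸ κ)) 0
    zero-L : ∀ j c → Lⁿ 0 j (λ c → 0ℤ * (+ c) ^ i) c ≡ 0ℤ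
    zero-L zero    c = refl
    zero-L (suc j) c = trans (cong₂ (λ x y → x + + c * y) (zero-L j (suc c)) (zero-L j c)) (trans (ℤₚ.+-identityˡ _) (ℤₚ.*-zeroʳ (+ c)))
    lemma : ∀ s r x y → - (s * r * x) * y ≡ s * (- r) * (x * y)
    lemma = solve-∀
    lemma′ : ∀ s x → s * (- 1ℤ) * x ≡ - (s * x)
    lemma′ = solve-∀
    step : ∀ κ → suc κ ℕ.≤ i → h (suc κ) ≡ - (sgn (suc κ) * g (suc κ))
    step κ (ℕ.s≤s {n = i′} κ≤i′) = begin
      h (suc κ)
        ≡⟨ Lⁿ-cong (suc κ) j (λ c → trans (lemma (sgn (suc κ ℕ.+ c)) (rise (suc κ) c) _ _)
             (cong (λ t → sgn (suc κ ℕ.+ c) * (- rise (suc κ) c) * t) (power-split (+ (suc κ ℕ.+ c)) κ≤i′))) 0 ⟩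
      Lⁿ (suc κ) j (λ c → sgn (suc κ ℕ.+ c) * (- rise (suc κ) c) * f (suc κ ℕ.+ c)) 0
        ≡⟨ Lⁿ-sgn (suc κ) j (λ c → - rise (suc κ) c) f (λ c → ℤₚ.neg-distribˡ-* (rise (suc κ) c) _) 0 ⟩
      sgn (suc κ ℕ.+ 0) * (- 1ℤ) * g (suc κ ℕ.+ 0)
        ≡⟨ cong (λ k → sgn k * (- 1ℤ) * g k) (ℕₚ.+-identityʳ (suc κ)) ⟩
      sgn (suc κ) * (- 1ℤ) * g (suc κ)
        ≡⟨ lemma′ (sgn (suc κ)) _ ⟩
      - (sgn (suc κ) * g (suc κ)) ∎

  -- For i ≥ 1 the number of differences exceeds the degree, and the boundary term contains a factor
  -- 0. The exception (1 , 0) is the type of the partitions `m v`.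
  total-pointedSum-0 : ∀ i j → (i , j) ≢ (1 , 0) → total pointedSum i j ≡ 0ℤ
  total-pointedSum-0 zero j ne = trans (total-pointedSum 0 j) (ℤₚ.+-inverseʳ (Λⁿ j (λ a → (+ a) ^ 0) 0))
  total-pointedSum-0 (suc i) j ne = trans (total-pointedSum (suc i) j) (cong₂ _-_ (at-0 i j ne)
      (power-vanishes i j))
    where
    at-0 : ∀ i j → (suc i , j) ≢ (1 , 0) → Λⁿ j (λ a → (+ a) ^ i) 0 ≡ 0ℤ
    at-0 zero    zero    ne = contradiction refl ne
    at-0 (suc i) zero    ne = ℤₚ.*-zeroˡ (0ℤ ^ i)
    at-0 i       (suc j) ne = Λⁿ-at-0 j (λ a → (+ a) ^ i)

  -- For 1 ≤ κ ≤ i, (a - 1)^(κ-1) a^(i-κ) equals Bin i κ a, a polynomial of joint degree below i in κ and a: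
  -- the coefficients ± (κ-1 choose r) of the binomial expansion are extended to κ = 0 as polynomials in κ.
  C : ℕ → ℕ → ℤ
  C zero    κ       = 1ℤ
  C (suc r) zero    = 1ℤ
  C (suc r) (suc κ) = C (suc r) κ - C r κ

  Bin : ℕ → ℕ → ℕ → ℤ
  Bin zero    κ a = 0ℤ
  Bin (suc i) κ a = + a * Bin i κ a + C i κ

  Bin-difference : ∀ i κ a → Bin (suc i) (suc κ) a ≡ Bin (suc i) κ a - Bin i κ a
  Bin-difference zero    κ a = lemma (+ a * 0ℤ)
    where
    lemma : ∀ x → x + 1ℤ ≡ (x + 1ℤ) - 0ℤ
    lemma = solve-∀
  Bin-difference (suc i) κ a = trans (cong (λ t → + a * t + (C (suc i) κ - C i κ)) (Bin-difference i κ a))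
      (lemma (+ a) (Bin (suc i) κ a) (Bin i κ a) _ _)
    where
    lemma : ∀ a x y c d → a * (x - y) + (c - d) ≡ (a * x + c) - (a * y + d)
    lemma = solve-∀

  C-at-1 : ∀ r → C (suc r) 1 ≡ 0ℤ
  C-at-1 zero    = refl
  C-at-1 (suc r) = refl

  -- By induction on κ: a further factor a - 1 at the expense of one factor `a` is the recursion in
  -- `Bin-difference`.
  Bin-power : ∀ i κ → suc κ ℕ.≤ i → ∀ a → (+ a - 1ℤ) ^ κ * (+ a) ^ (i ∸ suc κ) ≡ Bin i (suc κ) a
  Bin-power (suc i) zero _ a = trans (ℤₚ.*-identityˡ _) (at-1 i)
    where
    at-1 : ∀ i → (+ a) ^ i ≡ Bin (suc i) 1 a
    at-1 zero    = trans (sym (ℤₚ.+-identityˡ 1ℤ)) (cong (_+ 1ℤ) (sym (ℤₚ.*-zeroʳ (+ a))))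
    at-1 (suc i) = trans (cong (+ a *_) (at-1 i)) (trans (sym (ℤₚ.+-identityʳ _)) (cong (λ t → + a * Bin (suc i) 1 a + t) (sym (C-at-1 i))))
  Bin-power (suc i) (suc κ) (ℕ.s≤s κ<i) a = begin
    (+ a - 1ℤ) ^ suc κ * (+ a) ^ (i ∸ suc κ)
      ≡⟨ lemma (+ a) ((+ a - 1ℤ) ^ κ) ((+ a) ^ (i ∸ suc κ)) ⟩
    (+ a - 1ℤ) ^ κ * (+ a * (+ a) ^ (i ∸ suc κ)) - (+ a - 1ℤ) ^ κ * (+ a) ^ (i ∸ suc κ)
      ≡⟨ cong (λ t → (+ a - 1ℤ) ^ κ * (+ a) ^ t - (+ a - 1ℤ) ^ κ * (+ a) ^ (i ∸ suc κ)) (sym (ℕₚ.+-∸-assoc 1 κ<i)) ⟩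
    (+ a - 1ℤ) ^ κ * (+ a) ^ (suc i ∸ suc κ) - (+ a - 1ℤ) ^ κ * (+ a) ^ (i ∸ suc κ)
      ≡⟨ cong₂ _-_ (Bin-power (suc i) κ (ℕₚ.m≤n⇒m≤1+n κ<i) a) (Bin-power i κ κ<i a) ⟩
    Bin (suc i) (suc κ) a - Bin i (suc κ) a
      ≡⟨ Bin-difference i (suc κ) a ⟨
    Bin (suc i) (suc (suc κ)) a ∎
    where
    lemma : ∀ a x y → ((a - 1ℤ) * x) * y ≡ x * (a * y) - x * y
    lemma = solve-∀

  Deg-C : ∀ r → Deg (suc r) (λ κ _ → C r κ)
  Deg-C zero    = Deg-zero 0 (λ _ _ → refl) , Deg-zero 0 (λ _ _ → refl)
  Deg-C (suc r) = Deg-cong (suc r) (λ κ a → lemma (C (suc r) κ) (C r κ)) (Deg-C r) ,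
                  Deg-zero (suc r) (λ κ a → ℤₚ.+-inverseʳ (C (suc r) κ))
    where
    lemma : ∀ x y → y ≡ x - (x - y)
    lemma = solve-∀

  Deg-Bin : ∀ i → Deg i (Bin i)
  Deg-Bin zero    κ a = refl
  Deg-Bin (suc i) = Deg-+ (suc i) {λ κ a → + a * Bin i κ a} {λ κ _ → C i κ} (Deg-* i (Deg-Bin i)) (Deg-C i)

  -- After rewriting by `Bin` the summand depends on κ twice, through the exponent and through a =
  -- κ, so the differences run along the diagonal. They vanish, and -1 is the defect at κ = 0.
  total-bottomNumber : ∀ i j → (i , j) ≢ (0 , 0) → total bottomNumber i j ≡ -1ℤ
  total-bottomNumber i j ne = trans (Eⁿ-corrected i {h} g step) (trans
      (cong (λ t → (h 0 + g 0) - t) (Deg-diagonal i {λ κ a → - Λⁿ j (Bin i κ) a} (Deg-neg i {λ κ → Λⁿ j (Bin i κ)} (Deg-Λ j i (Deg-Bin i))) 0))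
      (trans (ℤₚ.+-identityʳ _) (boundary i j ne)))
    where
    g h : ℕ → ℤ
    g κ = - Λⁿ j (Bin i κ) κ
    h κ = Lⁿ κ j (λ c → bottomNumber κ c * (+ (κ ℕ.+ c)) ^ (i ∸ κ)) 0
    lemma : ∀ s r x y → (s * r * x) * y ≡ s * r * (x * y)
    lemma = solve-∀
    lemma′ : ∀ s x → s * 1ℤ * x ≡ - (s * (- x))
    lemma′ = solve-∀
    step : ∀ κ → suc κ ℕ.≤ i → h (suc κ) ≡ - (sgn (suc κ) * g (suc κ))
    step κ κ<i = begin
      h (suc κ)
        ≡⟨ Lⁿ-cong (suc κ) j (λ c → trans (lemma (sgn (suc κ ℕ.+ c)) (rise (suc κ) c) _ _)
             (cong (λ t → sgn (suc κ ℕ.+ c) * rise (suc κ) c * t) (Bin-power i κ κ<i (suc κ ℕ.+ c)))) 0 ⟩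
      Lⁿ (suc κ) j (λ c → sgn (suc κ ℕ.+ c) * rise (suc κ) c * Bin i (suc κ) (suc κ ℕ.+ c)) 0
        ≡⟨ Lⁿ-sgn (suc κ) j (rise (suc κ)) (Bin i (suc κ)) (λ c → refl) 0 ⟩
      sgn (suc κ ℕ.+ 0) * 1ℤ * Λⁿ j (Bin i (suc κ)) (suc κ ℕ.+ 0)
        ≡⟨ cong (λ k → sgn k * 1ℤ * Λⁿ j (Bin i (suc κ)) k) (ℕₚ.+-identityʳ (suc κ)) ⟩
      sgn (suc κ) * 1ℤ * Λⁿ j (Bin i (suc κ)) (suc κ)
        ≡⟨ lemma′ (sgn (suc κ)) _ ⟩
      - (sgn (suc κ) * g (suc κ)) ∎
    H : ℕ → ℕ → ℤ
    H i c = bottomNumber 0 c * (+ c) ^ i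
    above-1 : ∀ i j c → Lⁿ 0 j (H i) (2 ℕ.+ c) ≡ 0ℤ
    above-1 i zero    c = ℤₚ.*-zeroˡ ((+ (2 ℕ.+ c)) ^ i)
    above-1 i (suc j) c = trans (cong₂ (λ x y → x + + (2 ℕ.+ c) * y) (above-1 i j (suc c)) (above-1 i j c))
      (trans (ℤₚ.+-identityˡ _) (ℤₚ.*-zeroʳ (+ (2 ℕ.+ c))))
    at-1 : ∀ i j → Lⁿ 0 j (H i) 1 ≡ -1ℤ
    at-1 i zero    = cong (-1ℤ *_) (ℤₚ.^-zeroˡ i)
    at-1 i (suc j) = cong₂ (λ x y → x + 1ℤ * y) (above-1 i j 0) (at-1 i j)
    -- For j ≥ 1 the value -1 comes from the one unpointed block, `bottomNumber 0 1`; for j = 0 it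
    -- comes from the constant term of `Bin`.
    boundary : ∀ i j → (i , j) ≢ (0 , 0) →
               Lⁿ 0 j (H i) 0 + - Λⁿ j (Bin i 0) 0 ≡ -1ℤ
    boundary zero    zero    ne = contradiction refl ne
    boundary (suc i) zero    _ = cong₂ (λ x y → x + - y) (ℤₚ.*-zeroˡ (0ℤ ^ suc i)) (trans (cong (_+ C i 0) (ℤₚ.*-zeroˡ (Bin i 0 0))) (C-at-0 i))
      where
      C-at-0 : ∀ i → 0ℤ + C i 0 ≡ 1ℤ
      C-at-0 zero    = refl
      C-at-0 (suc i) = refl
    boundary i       (suc j) _ = cong₂ (λ x y → x + - y) (trans (cong (λ t → t + 0ℤ * Lⁿ 0 j (H i) 0) (at-1 i j)) (cong (λ t → -1ℤ + t) (ℤₚ.*-zeroˡ (Lⁿ 0 j (H i) 0)))) (Λⁿ-at-0 j (Bin i 0))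

  module _ (i : ℕ) where

    private
      G : ℕ → ℕ → ℤ
      G κ c = minimalSum κ c * (+ (κ ℕ.+ c)) ^ (i ∸ κ)
      f : ℕ → ℤ
      f a = (+ a) ^ i

    -- The substitution of `Lⁿ-sgn` again, restricted to c ≥ 1: the rising factorial now starts at κ
    -- + 1, and its next factor is κ + suc c.
    above-0 : ∀ κ j c → κ ℕ.≤ i →
      Lⁿ κ j (G κ) (suc c) ≡ - (sgn (κ ℕ.+ suc c) * rise (suc κ) c * Λⁿ j f (κ ℕ.+ suc c))
    above-0 κ zero c κ≤i = trans (lemma (sgn (κ ℕ.+ suc c) * rise (suc κ) c) _ _)
      (cong (λ t → - (sgn (κ ℕ.+ suc c) * rise (suc κ) c * t)) (power-split (+ (κ ℕ.+ suc c)) κ≤i))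
      where
      lemma : ∀ s x y → - (s * x) * y ≡ - (s * (x * y))
      lemma = solve-∀
    above-0 κ (suc j) c κ≤i = begin
      Lⁿ κ j (G κ) (suc (suc c)) + A * Lⁿ κ j (G κ) (suc c)
        ≡⟨ cong₂ (λ x y → x + A * y) (above-0 κ j (suc c) κ≤i) (above-0 κ j c κ≤i) ⟩
      - (sgn (κ ℕ.+ suc (suc c)) * (R * + (suc κ ℕ.+ c)) * Λⁿ j f (κ ℕ.+ suc (suc c))) + A * - (S * R * Λⁿ j f (κ ℕ.+ suc c))
        ≡⟨ cong₂ (λ k l → - (sgn k * (R * + l) * Λⁿ j f k) + A * - (S * R * Λⁿ j f (κ ℕ.+ suc c))) (ℕₚ.+-suc κ (suc c)) (sym (ℕₚ.+-suc κ c)) ⟩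
      - ((-1ℤ * S) * (R * A) * Λⁿ j f (suc (κ ℕ.+ suc c))) + A * - (S * R * Λⁿ j f (κ ℕ.+ suc c))
        ≡⟨ lemma S R A _ _ ⟩
      - (S * R * (A * (Λⁿ j f (κ ℕ.+ suc c) - Λⁿ j f (suc (κ ℕ.+ suc c))))) ∎
      where
      A = + (κ ℕ.+ suc c)
      S = sgn (κ ℕ.+ suc c)
      R = rise (suc κ) c
      lemma : ∀ s r a x y → - ((-1ℤ * s) * (r * a) * y) + a * - (s * r * x) ≡ - (s * r * (a * (x - y)))
      lemma = solve-∀

    private
      first-step : ∀ κ j → κ ℕ.≤ i → Lⁿ κ j (G κ) 1 ≡ sgn κ * Λⁿ j f (suc κ)
      first-step κ j κ≤i = trans (above-0 κ j 0 κ≤i) (trans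
        (cong (λ k → - (sgn k * 1ℤ * Λⁿ j f k)) (trans (ℕₚ.+-suc κ 0) (cong suc (ℕₚ.+-identityʳ κ)))) (lemma (sgn κ) _))
        where
        lemma : ∀ s x → - ((-1ℤ * s) * 1ℤ * x) ≡ s * x
        lemma = solve-∀

    -- At c = 0 the prefactor (n - 1)! / p! is 1 / κ. The factor κ + 0 from the next step of `Lⁿ`
    -- clears it, and for κ = 0 both sides vanish because 0 ^ i does.
    at-0 : i ≢ 0 → ∀ κ j → κ ℕ.≤ i → + (κ ℕ.+ 0) * Lⁿ κ j (G κ) 0 ≡ - (sgn κ * Λⁿ j f κ)
    at-0 i≢0 zero zero _ = trans (ℤₚ.*-zeroˡ (Lⁿ 0 0 (G 0) 0)) (sym (cong (λ t → - (1ℤ * t)) (zero-power i i≢0)))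
      where
      zero-power : ∀ i → i ≢ 0 → 0ℤ ^ i ≡ 0ℤ
      zero-power zero    i≢0 = contradiction refl i≢0
      zero-power (suc i) _   = ℤₚ.*-zeroˡ (0ℤ ^ i)
    at-0 _ (suc κ) zero κ<i = trans (lemma (+ (suc κ ℕ.+ 0)) (sgn (suc κ ℕ.+ 0)) _ _) (trans
      (cong (λ t → - (sgn (suc κ ℕ.+ 0) * t)) (power-split (+ (suc κ ℕ.+ 0)) κ<i))
      (cong (λ k → - (sgn k * (+ k) ^ i)) (ℕₚ.+-identityʳ (suc κ))))
      where
      lemma : ∀ a s x y → a * (- (s * 1ℤ * x) * y) ≡ - (s * ((a * x) * y))
      lemma = solve-∀
    at-0 i≢0 κ (suc j) κ≤i = begin
      A * (Lⁿ κ j (G κ) 1 + A * Lⁿ κ j (G κ) 0)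
        ≡⟨ cong₂ (λ x y → A * (x + y)) (first-step κ j κ≤i) (at-0 i≢0 κ j κ≤i) ⟩
      A * (sgn κ * Λⁿ j f (suc κ) + - (sgn κ * Λⁿ j f κ))
        ≡⟨ lemma A (sgn κ) _ _ ⟩
      - (sgn κ * (A * (Λⁿ j f κ - Λⁿ j f (suc κ))))
        ≡⟨ cong (λ k → - (sgn κ * (+ k * (Λⁿ j f κ - Λⁿ j f (suc κ))))) (ℕₚ.+-identityʳ κ) ⟩
      - (sgn κ * (+ κ * (Λⁿ j f κ - Λⁿ j f (suc κ)))) ∎
      where
      A = + (κ ℕ.+ 0)
      lemma : ∀ a s x y → a * (s * y + - (s * x)) ≡ - (s * (a * (x - y)))
      lemma = solve-∀

    -- The values at c = 1 and c = 0 combine into one further difference. This holds at κ = 0 too,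
    -- so there is no defect, and i + 1 differences kill degree `i`.
    total-minimalSum-step : i ≢ 0 → ∀ j → total minimalSum i (suc j) ≡ 0ℤ
    total-minimalSum-step i≢0 j = begin
      total minimalSum i (suc j)
        ≡⟨ Eⁿ-cong i 0 (λ κ κ≤ → let κ≤i = subst (κ ℕ.≤_) (ℕₚ.+-identityʳ i) κ≤ in
             trans (cong₂ _+_ (first-step κ j κ≤i) (at-0 i≢0 κ j κ≤i)) (lemma (sgn κ) _ _)) ⟩
      Eⁿ i (λ κ → - (sgn κ * D (Λⁿ j f) κ)) 0
        ≡⟨ Eⁿ-sgn i (D (Λⁿ j f)) 0 ⟩
      - (1ℤ * Dⁿ i (D (Λⁿ j f)) 0)
        ≡⟨ cong (λ t → - (1ℤ * t)) (trans (sym (Dⁿ-inner i (Λⁿ j f) 0)) (power-vanishes i j)) ⟩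
      0ℤ ∎
      where
      lemma : ∀ s x y → s * y + - (s * x) ≡ - (s * (x - y))
      lemma = solve-∀

  total-minimalSum-1 : ∀ i j → i ℕ.+ j ≡ 1 → total minimalSum i j ≡ 1ℤ
  total-minimalSum-1 zero       (suc zero) _ = refl
  total-minimalSum-1 (suc zero) zero       _ = refl
  total-minimalSum-1 (suc zero) (suc j) ()
  total-minimalSum-1 (suc (suc i)) j ()

  total-minimalSum-0 : ∀ i j → i ℕ.+ j ≢ 1 → total minimalSum i j ≡ 0ℤ
  total-minimalSum-0 i       zero    ne = total-pointedSum-0 i 0 λ { refl → ne refl }
  total-minimalSum-0 (suc i) (suc j) ne = total-minimalSum-step (suc i) (λ ()) j
  total-minimalSum-0 zero    (suc zero) ne = contradiction refl ne
  total-minimalSum-0 zero    (suc (suc j)) _ = begin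
    Lⁿ 0 (suc j) G 1 + 0ℤ * Lⁿ 0 (suc j) G 0
      ≡⟨ cong₂ _+_ (above-0 0 0 (suc j) 0 ℕ.z≤n) (ℤₚ.*-zeroˡ (Lⁿ 0 (suc j) G 0)) ⟩
    - (-1ℤ * 1ℤ * (1ℤ * (Λⁿ j (λ _ → 1ℤ) 1 - Λⁿ j (λ _ → 1ℤ) 2))) + 0ℤ
      ≡⟨ cong (λ t → - (-1ℤ * 1ℤ * (1ℤ * t)) + 0ℤ) (constant j 1) ⟩
    0ℤ ∎
    where
    G : ℕ → ℤ
    G c = minimalSum 0 c * 1ℤ
    constant : ∀ j a → Λⁿ j (λ _ → 1ℤ) a - Λⁿ j (λ _ → 1ℤ) (suc a) ≡ 0ℤ
    constant zero    a = refl
    constant (suc j) a = cong₂ _-_ (trans (cong (+ a *_) (constant j a)) (ℤₚ.*-zeroʳ (+ a)))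
      (trans (cong (+ suc a *_) (constant j (suc a))) (ℤₚ.*-zeroʳ (+ suc a)))

-- Weighted sums over sets of chosen blocks

module LabelledSubsets where

  open FiniteSums
  open FiniteDifferences
  open import Data.Bool.Base using (Bool; true; false)
  open import Data.Fin.Base as Fin using (Fin; zero; suc)
  open import Data.Integer.Base as ℤ using (ℤ; +_; 0ℤ; 1ℤ; _+_; _*_; _^_)
  import Data.Integer.Properties as ℤₚ
  open import Data.Integer.Tactic.RingSolver using (solve-∀)
  open import Data.List.Base as List using (List; []; _∷_; _++_; allFin; cartesianProductWith)
  import Data.List.Properties as Listₚ
  open import Data.Nat.Base as ℕ using (ℕ; zero; suc; _∸_)
  import Data.Nat.Properties as ℕₚ
  open import Data.Vec.Base as Vec using (Vec; []; _∷_; lookup)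
  open import Function.Base using (_∘_; id)
  open import Relation.Binary.PropositionalEquality using (_≡_; _≢_; refl; sym; trans; cong; cong₂; module ≡-Reasoning)
  open import Relation.Nullary using (¬_; Dec; yes; no; contradiction)
  import Data.Fin.Properties as Finₚ

  open Sums ℤₚ.+-*-commutativeRing

  Σₗ-++ : ∀ {A : Set} (xs ys : List A) f → Σₗ (xs ++ ys) f ≡ Σₗ xs f + Σₗ ys f
  Σₗ-++ []       ys f = sym (ℤₚ.+-identityˡ _)
  Σₗ-++ (x ∷ xs) ys f = trans (cong (λ t → f x + t) (Σₗ-++ xs ys f)) (sym (ℤₚ.+-assoc (f x) _ _))

  Σₗ-map : ∀ {A B : Set} (g : A → B) xs (f : B → ℤ) → Σₗ (List.map g xs) f ≡ Σₗ xs (f ∘ g)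
  Σₗ-map g []       f = refl
  Σₗ-map g (x ∷ xs) f = cong (λ t → f (g x) + t) (Σₗ-map g xs f)

  Σₗ-allFin-suc : ∀ {n} (f : Fin (suc n) → ℤ) → Σₗ (allFin (suc n)) f ≡ f zero + Σₗ (allFin n) (f ∘ suc)
  Σₗ-allFin-suc {n} f = cong (λ t → f zero + t) (trans (cong (λ xs → Σₗ xs f) (sym (Listₚ.map-tabulate id suc))) (Σₗ-map suc (allFin n) f))

  Σₗ-cartesian : ∀ {A B C : Set} (_∙_ : A → B → C) xs ys (f : C → ℤ) →
                 Σₗ (cartesianProductWith _∙_ xs ys) f ≡ Σₗ xs (λ x → Σₗ ys λ y → f (x ∙ y))
  Σₗ-cartesian _∙_ []       ys f = refl
  Σₗ-cartesian _∙_ (x ∷ xs) ys f = trans (Σₗ-++ (List.map (x ∙_) ys) _ f)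
    (cong₂ _+_ (Σₗ-map (x ∙_) ys f) (Σₗ-cartesian _∙_ xs ys f))

  Πᶠ : ∀ {n} → (Fin n → ℤ) → ℤ
  Πᶠ {zero}  f = 1ℤ
  Πᶠ {suc n} f = f zero * Πᶠ (f ∘ suc)

  Πᶠ-cong : ∀ {n} {f g : Fin n → ℤ} → (∀ x → f x ≡ g x) → Πᶠ f ≡ Πᶠ g
  Πᶠ-cong {zero}  eq = refl
  Πᶠ-cong {suc n} eq = cong₂ _*_ (eq zero) (Πᶠ-cong (eq ∘ suc))

  count-choices : ∀ {A : Set} (xs : List A) n {Q : Fin n → A → Set} (Q? : ∀ x c → Dec (Q x c))
                  (all? : ∀ r → Dec (∀ x → Q x (lookup r x))) →
                  Σₗ (allVecs xs n) (λ r → when (all? r) 1ℤ) ≡ Πᶠ (λ x → Σₗ xs λ c → when (Q? x c) 1ℤ)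
  count-choices xs zero    Q? all? = trans (ℤₚ.+-identityʳ _) (when-yes (all? []) λ ())
  count-choices xs (suc n) {Q} Q? all? = begin
    Σₗ (allVecs xs (suc n)) (λ r → when (all? r) 1ℤ)
      ≡⟨ Σₗ-cartesian _∷_ xs (allVecs xs n) _ ⟩
    Σₗ xs (λ c → Σₗ (allVecs xs n) λ r → when (all? (c ∷ r)) 1ℤ)
      ≡⟨ Σₗ-cong xs (λ c → Σₗ-cong (allVecs xs n) λ r → split c r) ⟩
    Σₗ xs (λ c → Σₗ (allVecs xs n) λ r → when (Q? zero c) 1ℤ * when (rest? r) 1ℤ)
      ≡⟨ Σₗ-cong xs (λ c → Σₗ-* (allVecs xs n) (when (Q? zero c) 1ℤ) _) ⟩
    Σₗ xs (λ c → when (Q? zero c) 1ℤ * R)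
      ≡⟨ Σₗ-cong xs (λ c → ℤₚ.*-comm (when (Q? zero c) 1ℤ) R) ⟩
    Σₗ xs (λ c → R * when (Q? zero c) 1ℤ)
      ≡⟨ Σₗ-* xs R _ ⟩
    R * Σₗ xs (λ c → when (Q? zero c) 1ℤ)
      ≡⟨ ℤₚ.*-comm R _ ⟩
    Σₗ xs (λ c → when (Q? zero c) 1ℤ) * R
      ≡⟨ cong (Σₗ xs (λ c → when (Q? zero c) 1ℤ) *_) (count-choices xs n (Q? ∘ suc) rest?) ⟩
    Πᶠ (λ x → Σₗ xs λ c → when (Q? x c) 1ℤ) ∎
    where
    open ≡-Reasoning
    rest? : ∀ r → Dec (∀ x → Q (suc x) (lookup r x))
    rest? r = Finₚ.all? λ x → Q? (suc x) (lookup r x)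
    R = Σₗ (allVecs xs n) λ r → when (rest? r) 1ℤ
    split : ∀ c r → when (all? (c ∷ r)) 1ℤ ≡ when (Q? zero c) 1ℤ * when (rest? r) 1ℤ
    split c r with all? (c ∷ r) | Q? zero c | rest? r
    ... | yes _ | yes _ | yes _ = refl
    ... | yes a | yes _ | no ¬r = contradiction (a ∘ suc) ¬r
    ... | yes a | no ¬q | _     = contradiction (a zero) ¬q
    ... | no ¬a | yes q | yes r = contradiction (λ { zero → q ; (suc x) → r x }) ¬a
    ... | no _  | yes _ | no _  = refl
    ... | no _  | no _  | yes _ = refl
    ... | no _  | no _  | no _  = refl

  -- other marks the elements that do not represent their block, pointed and unpointed the
  -- representatives of such blocks.
  data Label : Set where
    other pointed unpointed : Label

  pointed≢other : pointed ≢ other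
  pointed≢other ()

  unpointed≢other : unpointed ≢ other
  unpointed≢other ()

  subsets : ∀ n → List (Vec Bool n)
  subsets = allVecs (true ∷ false ∷ [])

  #pointed #unpointed : ∀ {n} → (Fin n → Label) → ℕ
  #pointed {zero}  lab = 0
  #pointed {suc n} lab with lab zero
  ... | pointed = suc (#pointed (lab ∘ suc))
  ... | _       = #pointed (lab ∘ suc)
  #unpointed {zero}  lab = 0
  #unpointed {suc n} lab with lab zero
  ... | unpointed = suc (#unpointed (lab ∘ suc))
  ... | _         = #unpointed (lab ∘ suc)

  select : Bool → Label → Label
  select true  l = l
  select false _ = other

  inside outside : ∀ {n} → (Fin n → Label) → Vec Bool n → Fin n → Label
  inside  lab I x = select (lookup I x) (lab x)
  outside lab I x = select (Data.Bool.Base.not (lookup I x)) (lab x)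

  isUnpointed : Label → ℕ
  isUnpointed unpointed = 1
  isUnpointed _         = 0

  before : ∀ {n} → (Fin n → Label) → Fin n → ℕ
  before lab zero    = 0
  before lab (suc x) = isUnpointed (lab zero) ℕ.+ before (lab ∘ suc) x

  -- Counts the admissible code values at one element: ν is the number of all chosen elements, κ of
  -- the pointed ones, `c` of the unpointed ones before it. A non-representative must not be chosen
  -- and has one fixed value.
  options : Label → Bool → (κ ν c : ℕ) → ℤ
  options other     true  κ ν c = 0ℤ
  options other     false κ ν c = 1ℤ
  options pointed   true  κ ν c = 1ℤ
  options pointed   false κ ν c = + ν
  options unpointed true  κ ν c = 1ℤ
  options unpointed false κ ν c = + (κ ℕ.+ c)

  weight : ∀ {n} → (κ ν c : ℕ) → (Fin n → Label) → Vec Bool n → ℤ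
  weight κ ν c lab []      = 1ℤ
  weight κ ν c lab (b ∷ I) = options (lab zero) b κ ν c * weight κ ν (isUnpointed (select b (lab zero)) ℕ.+ c) (lab ∘ suc) I

  options-product : ∀ {n} κ ν c (lab : Fin n → Label) I →
    Πᶠ (λ x → options (lab x) (lookup I x) κ ν (before (inside lab I) x ℕ.+ c)) ≡ weight κ ν c lab I
  options-product κ ν c lab []      = refl
  options-product κ ν c lab (b ∷ I) = cong (options (lab zero) b κ ν c *_) (trans
    (Πᶠ-cong λ x → cong (options (lab (suc x)) (lookup I x) κ ν) (shift (isUnpointed (select b (lab zero))) (before (inside (lab ∘ suc) I) x)))
    (options-product κ ν (isUnpointed (select b (lab zero)) ℕ.+ c) (lab ∘ suc) I))
    where
    shift : ∀ u v → (u ℕ.+ v) ℕ.+ c ≡ v ℕ.+ (u ℕ.+ c)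
    shift u v = trans (cong (ℕ._+ c) (ℕₚ.+-comm u v)) (ℕₚ.+-assoc v u c)

  private
    *-shuffle : ∀ x y z → x * (y * z) ≡ y * (x * z)
    *-shuffle = solve-∀
    *-assoc′ : ∀ x y z → x * (y * z) ≡ (x * y) * z
    *-assoc′ = solve-∀

  -- The final number ν of chosen elements is unknown while the elements are processed one at a
  -- time. Its factors are therefore collected in a power, and ν is replaced by 1.
  weight-power : ∀ {n} κ ν c (lab : Fin n → Label) I →
                 weight κ ν c lab I ≡ (+ ν) ^ #pointed (outside lab I) * weight κ 1 c lab I
  weight-power κ ν c lab []      = refl
  weight-power κ ν c lab (b ∷ I) with lab zero | b
  ... | other     | true  = trans (ℤₚ.*-zeroˡ (weight κ ν c (lab ∘ suc) I)) (sym (trans (cong (X *_) (ℤₚ.*-zeroˡ (weight κ 1 c (lab ∘ suc) I))) (ℤₚ.*-zeroʳ X)))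
    where X = (+ ν) ^ #pointed (outside (lab ∘ suc) I)
  ... | other     | false = trans (cong (1ℤ *_) (weight-power κ ν c (lab ∘ suc) I)) (*-shuffle 1ℤ ((+ ν) ^ #pointed (outside (lab ∘ suc) I)) _)
  ... | pointed   | true  = trans (cong (1ℤ *_) (weight-power κ ν c (lab ∘ suc) I)) (*-shuffle 1ℤ ((+ ν) ^ #pointed (outside (lab ∘ suc) I)) _)
  ... | pointed   | false = trans (cong (+ ν *_) (weight-power κ ν c (lab ∘ suc) I)) (trans (*-assoc′ (+ ν) _ _)
      (cong ((+ ν * (+ ν) ^ #pointed (outside (lab ∘ suc) I)) *_) (sym (ℤₚ.*-identityˡ _))))
  ... | unpointed | true  = trans (cong (1ℤ *_) (weight-power κ ν (suc c) (lab ∘ suc) I)) (*-shuffle 1ℤ ((+ ν) ^ #pointed (outside (lab ∘ suc) I)) _)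
  ... | unpointed | false = trans (cong (+ (κ ℕ.+ c) *_) (weight-power κ ν c (lab ∘ suc) I)) (*-shuffle (+ (κ ℕ.+ c)) ((+ ν) ^ #pointed (outside (lab ∘ suc) I)) _)

  inside+outside : ∀ {n} (lab : Fin n → Label) I → #pointed (inside lab I) ℕ.+ #pointed (outside lab I) ≡ #pointed lab
  inside+outside lab []      = refl
  inside+outside lab (b ∷ I) with lab zero | b
  ... | other     | true  = inside+outside (lab ∘ suc) I
  ... | other     | false = inside+outside (lab ∘ suc) I
  ... | pointed   | true  = cong suc (inside+outside (lab ∘ suc) I)
  ... | pointed   | false = trans (ℕₚ.+-suc _ _) (cong suc (inside+outside (lab ∘ suc) I))
  ... | unpointed | true  = inside+outside (lab ∘ suc) I
  ... | unpointed | false = inside+outside (lab ∘ suc) I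

  Lⁿ-* : ∀ κ j r f c → Lⁿ κ j (λ c → r * f c) c ≡ r * Lⁿ κ j f c
  Lⁿ-* κ zero    r f c = refl
  Lⁿ-* κ (suc j) r f c = trans (cong₂ (λ x y → x + + (κ ℕ.+ c) * y) (Lⁿ-* κ j r f (suc c)) (Lⁿ-* κ j r f c)) (lemma r (Lⁿ κ j f (suc c)) (+ (κ ℕ.+ c)) (Lⁿ κ j f c))
    where
    lemma : ∀ r x a y → r * x + a * (r * y) ≡ r * (x + a * y)
    lemma = solve-∀

  Σ-subsets-suc : ∀ {n} (f : Vec Bool (suc n) → ℤ) →
                  Σₗ (subsets (suc n)) f ≡ Σₗ (subsets n) (λ I → f (true ∷ I)) + Σₗ (subsets n) (λ I → f (false ∷ I))
  Σ-subsets-suc {n} f = trans (Σₗ-cartesian _∷_ (true ∷ false ∷ []) (subsets n) f)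
    (cong (λ t → Σₗ (subsets n) (λ I → f (true ∷ I)) + t) (ℤₚ.+-identityʳ _))

  -- Each pointed element contributes a step of `Eⁿ` and each unpointed one a step of `Lⁿ`, in
  -- whatever order they occur, because `Eⁿ` is additive. The offsets `k` and `c` count the elements
  -- chosen so far.
  subset-sum : ∀ {n} (lab : Fin n → Label) (G : ℕ → ℕ → ℤ) k c →
    Σₗ (subsets n) (λ I → G (#pointed (inside lab I) ℕ.+ k) (#unpointed (inside lab I) ℕ.+ c)
                          * weight (#pointed (inside lab I) ℕ.+ k) 1 c lab I)
    ≡ Eⁿ (#pointed lab) (λ κ → Lⁿ κ (#unpointed lab) (G κ) c) k
  subset-sum {zero} lab G k c = trans (ℤₚ.+-identityʳ _) (ℤₚ.*-identityʳ _)
  subset-sum {suc n} lab G k c = trans (Σ-subsets-suc {n} _) (by-label (lab zero) refl)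
    where
    open ≡-Reasoning
    lab′ = lab ∘ suc
    P U : Vec Bool n → ℕ
    P I = #pointed (inside lab′ I)
    U I = #unpointed (inside lab′ I)
    H W : Vec Bool n → ℤ
    H I = G (P I ℕ.+ k) (U I ℕ.+ c)
    W I = weight (P I ℕ.+ k) 1 c lab′ I
    term : Bool → Vec Bool n → ℤ
    term b I = G (#pointed (inside lab (b ∷ I)) ℕ.+ k) (#unpointed (inside lab (b ∷ I)) ℕ.+ c)
               * weight (#pointed (inside lab (b ∷ I)) ℕ.+ k) 1 c lab (b ∷ I)
    vanish : ∀ x y → x * (0ℤ * y) ≡ 0ℤ
    vanish = solve-∀
    one : ∀ x y → x * (1ℤ * y) ≡ x * y
    one = solve-∀
    move : ∀ x a y → x * (a * y) ≡ (a * x) * y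
    move = solve-∀
    by-label : ∀ l → lab zero ≡ l →
      Σₗ (subsets n) (term true) + Σₗ (subsets n) (term false)
      ≡ Eⁿ (#pointed lab) (λ κ → Lⁿ κ (#unpointed lab) (G κ) c) k
    by-label other eq rewrite eq = begin
      _ ≡⟨ cong₂ _+_ (trans (Σₗ-cong (subsets n) λ I → vanish (H I) (W I)) (Σₗ-zero (subsets n))) (Σₗ-cong (subsets n) λ I → one (H I) (W I)) ⟩
      0ℤ + Σₗ (subsets n) (λ I → G (P I ℕ.+ k) (U I ℕ.+ c) * weight (P I ℕ.+ k) 1 c lab′ I)
        ≡⟨ trans (ℤₚ.+-identityˡ _) (subset-sum lab′ G k c) ⟩
      _ ∎
    by-label pointed eq rewrite eq = cong₂ _+_
      (trans (Σₗ-cong (subsets n) λ I → trans (one (G (suc (P I) ℕ.+ k) (U I ℕ.+ c)) (weight (suc (P I) ℕ.+ k) 1 c lab′ I)) (cong (λ κ → G κ (U I ℕ.+ c) * weight κ 1 c lab′ I) (sym (ℕₚ.+-suc (P I) k))))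
             (subset-sum lab′ G (suc k) c))
      (trans (Σₗ-cong (subsets n) λ I → one (H I) (W I)) (subset-sum lab′ G k c))
    by-label unpointed eq rewrite eq = begin
      _ ≡⟨ cong₂ _+_
             (trans (Σₗ-cong (subsets n) λ I → trans (one (G (P I ℕ.+ k) (suc (U I) ℕ.+ c)) (weight (P I ℕ.+ k) 1 (suc c) lab′ I)) (cong (λ d → G (P I ℕ.+ k) d * weight (P I ℕ.+ k) 1 (suc c) lab′ I) (sym (ℕₚ.+-suc (U I) c))))
                    (subset-sum lab′ G k (suc c)))
             (trans (Σₗ-cong (subsets n) λ I → move (H I) (+ (P I ℕ.+ k ℕ.+ c)) (W I)) (subset-sum lab′ (λ κ d → + (κ ℕ.+ c) * G κ d) k c)) ⟩
      Eⁿ (#pointed lab′) (λ κ → Lⁿ κ (#unpointed lab′) (G κ) (suc c)) k +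
      Eⁿ (#pointed lab′) (λ κ → Lⁿ κ (#unpointed lab′) (λ d → + (κ ℕ.+ c) * G κ d) c) k
        ≡⟨ Eⁿ-+ (#pointed lab′) (λ κ → Lⁿ κ (#unpointed lab′) (G κ) (suc c)) (λ κ → Lⁿ κ (#unpointed lab′) (λ d → + (κ ℕ.+ c) * G κ d) c) k ⟨
      Eⁿ (#pointed lab′) (λ κ → Lⁿ κ (#unpointed lab′) (G κ) (suc c) + Lⁿ κ (#unpointed lab′) (λ d → + (κ ℕ.+ c) * G κ d) c) k
        ≡⟨ Eⁿ-cong (#pointed lab′) k (λ κ _ → cong (λ t → Lⁿ κ (#unpointed lab′) (G κ) (suc c) + t) (Lⁿ-* κ (#unpointed lab′) (+ (κ ℕ.+ c)) (G κ) c)) ⟩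
      _ ∎

  codes-sum : ∀ {n} (lab : Fin n → Label) (T : ℕ → ℕ → ℤ) →
    Σₗ (subsets n) (λ I → let κ = #pointed (inside lab I) ; λ′ = #unpointed (inside lab I) in
      T κ λ′ * Πᶠ (λ x → options (lab x) (lookup I x) κ (κ ℕ.+ λ′) (before (inside lab I) x ℕ.+ 0)))
    ≡ total T (#pointed lab) (#unpointed lab)
  codes-sum {n} lab T = trans (Σₗ-cong (subsets n) rearrange) (subset-sum lab G 0 0)
    where
    G : ℕ → ℕ → ℤ
    G κ c = T κ c * (+ (κ ℕ.+ c)) ^ (#pointed lab ∸ κ)
    rearrange : ∀ I → _ ≡ _
    rearrange I = begin
      T κ u * Πᶠ (λ x → options (lab x) (lookup I x) κ (κ ℕ.+ u) (before (inside lab I) x ℕ.+ 0))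
        ≡⟨ cong (T κ u *_) (trans (options-product κ (κ ℕ.+ u) 0 lab I) (weight-power κ (κ ℕ.+ u) 0 lab I)) ⟩
      T κ u * ((+ (κ ℕ.+ u)) ^ #pointed (outside lab I) * weight κ 1 0 lab I)
        ≡⟨ *-assoc′ (T κ u) _ _ ⟩
      T κ u * (+ (κ ℕ.+ u)) ^ #pointed (outside lab I) * weight κ 1 0 lab I
        ≡⟨ cong (λ e → T κ u * (+ (κ ℕ.+ u)) ^ e * weight κ 1 0 lab I) (sym (trans (cong (_∸ κ) (sym (inside+outside lab I))) (ℕₚ.m+n∸m≡n κ _))) ⟩
      G κ u * weight κ 1 0 lab I
        ≡⟨ cong₂ (λ a b → G a b * weight a 1 0 lab I) (sym (ℕₚ.+-identityʳ κ)) (sym (ℕₚ.+-identityʳ u)) ⟩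
      G (κ ℕ.+ 0) (u ℕ.+ 0) * weight (κ ℕ.+ 0) 1 0 lab I ∎
      where
      open ≡-Reasoning
      κ = #pointed (inside lab I)
      u = #unpointed (inside lab I)

-- Codes and their enumeration

module CodeSums where

  open FiniteSums
  open Partitions
  open FiniteDifferences
  open LabelledSubsets
  open import Data.Bool.Base using (Bool; true; false)
  import Data.Bool.Properties as Boolₚ
  open import Data.Fin.Base as Fin using (Fin; zero; suc)
  import Data.Fin.Properties as Finₚ
  open import Data.Fin.Subset using (_∈_)
  open import Data.Integer.Base as ℤ using (ℤ; +_; 1ℤ; _+_; _*_)
  import Data.Integer.Properties as ℤₚ
  open import Data.List.Base as List using (List; []; _∷_; allFin; cartesianProductWith)
  open import Data.List.Membership.Propositional using () renaming (_∈_ to _∈ₗ_)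
  open import Data.List.Membership.Propositional.Properties using (∈-allFin; ∈-cartesianProductWith⁺)
  open import Data.List.Relation.Unary.Any using (here; there)
  open import Data.List.Relation.Unary.All as LAll using ()
  open import Data.List.Relation.Unary.AllPairs as LAP using ()
  open import Data.List.Relation.Unary.Unique.Propositional using (Unique)
  import Data.List.Relation.Unary.Unique.Propositional.Properties as Uniqueₚ
  open import Data.Nat.Base as ℕ using (ℕ; zero; suc)
  import Data.Nat.Properties as ℕₚ
  open import Data.Product.Base using (_×_; _,_)
  import Data.Product.Properties as Productₚ
  open import Data.Empty using (⊥)
  open import Data.Vec.Base as Vec using (Vec; []; _∷_; lookup)
  import Data.Vec.Properties as Vecₚ
  open import Function.Base using (_∘_)
  open import Relation.Binary.Definitions using (DecidableEquality)
  open import Relation.Binary.PropositionalEquality using (_≡_; _≢_; refl; sym; trans; cong; module ≡-Reasoning)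
  open import Relation.Nullary using (¬_; Dec; yes; no; contradiction)
  open import Relation.Nullary.Decidable using (_×-dec_; _→-dec_; ¬?)

  open Sums ℤₚ.+-*-commutativeRing

  _≟ᴸ_ : DecidableEquality Label
  other     ≟ᴸ other     = yes refl
  other     ≟ᴸ pointed   = no λ ()
  other     ≟ᴸ unpointed = no λ ()
  pointed   ≟ᴸ other     = no λ ()
  pointed   ≟ᴸ pointed   = yes refl
  pointed   ≟ᴸ unpointed = no λ ()
  unpointed ≟ᴸ other     = no λ ()
  unpointed ≟ᴸ pointed   = no λ ()
  unpointed ≟ᴸ unpointed = yes refl

  #pointed-count : ∀ {n} (L : Fin n → Label) {Q : Fin n → Set} (Q? : ∀ x → Dec (Q x)) →
                   (∀ x → L x ≡ pointed → Q x) → (∀ x → Q x → L x ≡ pointed) → #pointed L ≡ count Q?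
  #pointed-count {n} L Q? to from = ℤₚ.+-injective (trans (go L) (trans
    (Σₗ-cong (allFin n) λ x → when-⇔ (L x ≟ᴸ pointed) (Q? x) (to x) (from x) λ _ → refl) (sym (+length-filter Q? (allFin n)))))
    where
    go : ∀ {n} (L : Fin n → Label) → + #pointed L ≡ Σₗ (allFin n) (λ x → when (L x ≟ᴸ pointed) 1ℤ)
    go {zero}  L = refl
    go {suc n} L = trans (head (L zero) refl) (sym (Σₗ-allFin-suc λ x → when (L x ≟ᴸ pointed) 1ℤ))
      where
      head : ∀ l → L zero ≡ l → + #pointed L ≡ when (L zero ≟ᴸ pointed) 1ℤ + Σₗ (allFin n) (λ x → when (L (suc x) ≟ᴸ pointed) 1ℤ)
      head other     eq rewrite eq = trans (go (L ∘ suc)) (sym (ℤₚ.+-identityˡ _))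
      head pointed   eq rewrite eq = trans (ℤₚ.pos-+ 1 (#pointed (L ∘ suc))) (cong (λ t → 1ℤ + t) (go (L ∘ suc)))
      head unpointed eq rewrite eq = trans (go (L ∘ suc)) (sym (ℤₚ.+-identityˡ _))

  #unpointed-count : ∀ {n} (L : Fin n → Label) {Q : Fin n → Set} (Q? : ∀ x → Dec (Q x)) →
                     (∀ x → L x ≡ unpointed → Q x) → (∀ x → Q x → L x ≡ unpointed) → #unpointed L ≡ count Q?
  #unpointed-count {n} L Q? to from = ℤₚ.+-injective (trans (go L) (trans
    (Σₗ-cong (allFin n) λ x → when-⇔ (L x ≟ᴸ unpointed) (Q? x) (to x) (from x) λ _ → refl) (sym (+length-filter Q? (allFin n)))))
    where
    go : ∀ {n} (L : Fin n → Label) → + #unpointed L ≡ Σₗ (allFin n) (λ x → when (L x ≟ᴸ unpointed) 1ℤ)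
    go {zero}  L = refl
    go {suc n} L = trans (head (L zero) refl) (sym (Σₗ-allFin-suc λ x → when (L x ≟ᴸ unpointed) 1ℤ))
      where
      head : ∀ l → L zero ≡ l → + #unpointed L ≡ when (L zero ≟ᴸ unpointed) 1ℤ + Σₗ (allFin n) (λ x → when (L (suc x) ≟ᴸ unpointed) 1ℤ)
      head other     eq rewrite eq = trans (go (L ∘ suc)) (sym (ℤₚ.+-identityˡ _))
      head pointed   eq rewrite eq = trans (go (L ∘ suc)) (sym (ℤₚ.+-identityˡ _))
      head unpointed eq rewrite eq = trans (ℤₚ.pos-+ 1 (#unpointed (L ∘ suc))) (cong (λ t → 1ℤ + t) (go (L ∘ suc)))

  chosen? : ∀ (l : Label) → Dec (l ≢ other)
  chosen? l = ¬? (l ≟ᴸ other)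

  +-#chosen : ∀ {n} (L : Fin n → Label) → + (#pointed L ℕ.+ #unpointed L) ≡ Σₗ (allFin n) (λ x → when (chosen? (L x)) 1ℤ)
  +-#chosen {zero}  L = refl
  +-#chosen {suc n} L = trans (head (L zero) refl) (sym (Σₗ-allFin-suc λ x → when (chosen? (L x)) 1ℤ))
    where
    head : ∀ l → L zero ≡ l → + (#pointed L ℕ.+ #unpointed L) ≡ when (chosen? (L zero)) 1ℤ + Σₗ (allFin n) (λ x → when (chosen? (L (suc x))) 1ℤ)
    head other     eq rewrite eq = trans (+-#chosen (L ∘ suc)) (sym (ℤₚ.+-identityˡ _))
    head pointed   eq rewrite eq = trans (ℤₚ.pos-+ 1 (#pointed (L ∘ suc) ℕ.+ #unpointed (L ∘ suc))) (cong (λ t → 1ℤ + t) (+-#chosen (L ∘ suc)))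
    head unpointed eq rewrite eq = trans (cong +_ (ℕₚ.+-suc (#pointed (L ∘ suc)) (#unpointed (L ∘ suc))))
      (trans (ℤₚ.pos-+ 1 (#pointed (L ∘ suc) ℕ.+ #unpointed (L ∘ suc))) (cong (λ t → 1ℤ + t) (+-#chosen (L ∘ suc))))

  -- A pointed block of the coarser partition is named by the block whose point it keeps, but an
  -- unpointed one may contain several unpointed blocks. The order condition makes the chosen one
  -- the least of these.
  Early : ∀ {n} → (Fin n → Label) → Fin n → Fin n → Set
  Early L x c = L c ≢ other × (L c ≡ unpointed → c Fin.< x)

  early? : ∀ {n} (L : Fin n → Label) x c → Dec (Early L x c)
  early? L x c = chosen? (L c) ×-dec ((L c ≟ᴸ unpointed) →-dec (c Finₚ.<? x))

  +-#early : ∀ {n} (L : Fin n → Label) x → + (#pointed L ℕ.+ before L x) ≡ Σₗ (allFin n) (λ c → when (early? L x c) 1ℤ)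
  +-#early {suc n} L zero = trans (cong +_ (trans (ℕₚ.+-identityʳ _) (#pointed-count L (early? L zero)
      (λ c eq → (λ eq′ → pointed≢other (trans (sym eq) eq′)) , λ eq′ → contradiction (trans (sym eq) eq′) λ ())
      (λ c (c≢ , un) → only (L c) refl c≢ un)))) (+length-filter (early? L zero) (allFin (suc n)))
    where
    only : ∀ {c : Fin (suc n)} l → L c ≡ l → L c ≢ other → (L c ≡ unpointed → c Fin.< zero {n}) → L c ≡ pointed
    only other     eq c≢ _  = contradiction eq c≢
    only pointed   eq _  _  = eq
    only unpointed eq _  un = contradiction (un eq) λ ()
  +-#early {suc n} L (suc x) = trans (head (L zero) refl) (sym (Σₗ-allFin-suc λ c → when (early? L (suc x) c) 1ℤ))
    where
    tail : ∀ c → when (early? (L ∘ suc) x c) 1ℤ ≡ when (early? L (suc x) (suc c)) 1ℤ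
    tail c = when-⇔ (early? (L ∘ suc) x c) (early? L (suc x) (suc c))
      (λ (c≢ , un) → c≢ , ℕ.s≤s ∘ un) (λ (c≢ , un) → c≢ , ℕ.s≤s⁻¹ ∘ un) λ _ → refl
    rest : + (#pointed (L ∘ suc) ℕ.+ before (L ∘ suc) x) ≡ Σₗ (allFin n) (λ c → when (early? L (suc x) (suc c)) 1ℤ)
    rest = trans (+-#early (L ∘ suc) x) (Σₗ-cong (allFin n) tail)
    head : ∀ l → L zero ≡ l → + (#pointed L ℕ.+ before L (suc x)) ≡
           when (early? L (suc x) zero) 1ℤ + Σₗ (allFin n) (λ c → when (early? L (suc x) (suc c)) 1ℤ)
    head other eq rewrite eq = trans rest (sym (ℤₚ.+-identityˡ _))
    head pointed eq rewrite eq = trans (ℤₚ.pos-+ 1 (#pointed (L ∘ suc) ℕ.+ before (L ∘ suc) x)) (cong (λ t → 1ℤ + t) rest)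
    head unpointed eq rewrite eq = trans (cong +_ (ℕₚ.+-suc (#pointed (L ∘ suc)) (before (L ∘ suc) x)))
      (trans (ℤₚ.pos-+ 1 (#pointed (L ∘ suc) ℕ.+ before (L ∘ suc) x)) (cong (λ t → 1ℤ + t) rest))

  -- The admissible values c of a code at x: the chosen representatives (those with I x) are fixed, any
  -- other representative moves to a chosen one, an unpointed one to a pointed or an earlier one.
  module _ {n : ℕ} (lab : Fin n → Label) (I : Vec Bool n) where

    private L = inside lab I

    choice : Label → Bool → Fin n → Fin n → Set
    choice other     true  x c = ⊥
    choice other     false x c = c ≡ x
    choice pointed   true  x c = c ≡ x
    choice pointed   false x c = L c ≢ other
    choice unpointed true  x c = c ≡ x
    choice unpointed false x c = Early L x c

    choice? : ∀ l b x c → Dec (choice l b x c)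
    choice? other     true  x c = no λ ()
    choice? other     false x c = c Finₚ.≟ x
    choice? pointed   true  x c = c Finₚ.≟ x
    choice? pointed   false x c = chosen? (L c)
    choice? unpointed true  x c = c Finₚ.≟ x
    choice? unpointed false x c = early? L x c

    choice-count : ∀ l b x → Σₗ (allFin n) (λ c → when (choice? l b x c) 1ℤ) ≡
                   options l b (#pointed L) (#pointed L ℕ.+ #unpointed L) (before L x ℕ.+ 0)
    choice-count other     true  x = Σₗ-zero (allFin n)
    choice-count other     false x = Σₗ-single Finₚ._≟_ (λ _ → 1ℤ) (Uniqueₚ.allFin⁺ n) (∈-allFin x)
    choice-count pointed   true  x = Σₗ-single Finₚ._≟_ (λ _ → 1ℤ) (Uniqueₚ.allFin⁺ n) (∈-allFin x)
    choice-count pointed   false x = sym (+-#chosen L)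
    choice-count unpointed true  x = Σₗ-single Finₚ._≟_ (λ _ → 1ℤ) (Uniqueₚ.allFin⁺ n) (∈-allFin x)
    choice-count unpointed false x = trans (sym (+-#early L x)) (cong (λ b → + (#pointed L ℕ.+ b)) (sym (ℕₚ.+-identityʳ _)))

  Code : ℕ → Set
  Code n = Vec Bool n × Vec (Fin n) n

  Valid : ∀ {n} → (Fin n → Label) → Code n → Set
  Valid lab (I , r) = ∀ x → choice lab I (lab x) (lookup I x) x (lookup r x)

  validCode? : ∀ {n} (lab : Fin n → Label) c → Dec (Valid lab c)
  validCode? lab (I , r) = Finₚ.all? λ x → choice? lab I (lab x) (lookup I x) x (lookup r x)

  codes : ∀ n → List (Code n)
  codes n = cartesianProductWith _,_ (subsets n) (allVecs (allFin n) n)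

  unique-allVecs : ∀ {A : Set} {xs : List A} → Unique xs → ∀ n → Unique (allVecs xs n)
  unique-allVecs u zero    = LAll.[] LAP.∷ LAP.[]
  unique-allVecs u (suc n) = Uniqueₚ.cartesianProductWith⁺ _∷_ Vecₚ.∷-injective u (unique-allVecs u n)

  unique-codes : ∀ n → Unique (codes n)
  unique-codes n = Uniqueₚ.cartesianProductWith⁺ _,_ (λ { refl → refl , refl })
    (unique-allVecs (((λ ()) LAll.∷ LAll.[]) LAP.∷ LAll.[] LAP.∷ LAP.[]) n) (unique-allVecs (Uniqueₚ.allFin⁺ n) n)

  ∈-codes : ∀ {n} (c : Code n) → c ∈ₗ codes n
  ∈-codes (I , r) = ∈-cartesianProductWith⁺ _,_ (∈-allVecs (λ { true → here refl ; false → there (here refl) }) I) (∈-allVecs ∈-allFin r)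

  _≟ᶜ_ : ∀ {n} → DecidableEquality (Code n)
  _≟ᶜ_ = Productₚ.≡-dec (Vecₚ.≡-dec Boolₚ._≟_) (Vecₚ.≡-dec Finₚ._≟_)

  -- The summand depends on `I` only, and for fixed `I` the values at different elements are
  -- independent, so their number is a product.
  valid-codes-sum : ∀ {n} (lab : Fin n → Label) (T : ℕ → ℕ → ℤ) →
    Σₗ (codes n) (λ (I , r) → when (validCode? lab (I , r)) (T (#pointed (inside lab I)) (#unpointed (inside lab I))))
    ≡ total T (#pointed lab) (#unpointed lab)
  valid-codes-sum {n} lab T = begin
    Σₗ (codes n) (λ (I , r) → when (validCode? lab (I , r)) (T′ I))
      ≡⟨ Σₗ-cartesian _,_ (subsets n) (allVecs (allFin n) n) (λ (I , r) → when (validCode? lab (I , r)) (T′ I)) ⟩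
    Σₗ (subsets n) (λ I → Σₗ (allVecs (allFin n) n) λ r → when (validCode? lab (I , r)) (T′ I))
      ≡⟨ Σₗ-cong (subsets n) (λ I → Σₗ-cong (allVecs (allFin n) n) λ r → scale (validCode? lab (I , r)) (T′ I)) ⟩
    Σₗ (subsets n) (λ I → Σₗ (allVecs (allFin n) n) λ r → T′ I * when (validCode? lab (I , r)) 1ℤ)
      ≡⟨ Σₗ-cong (subsets n) (λ I → trans (Σₗ-* (allVecs (allFin n) n) (T′ I) _) (cong (T′ I *_) (trans
           (count-choices (allFin n) n (λ x c → choice? lab I (lab x) (lookup I x) x c) (λ r → validCode? lab (I , r)))
           (Πᶠ-cong λ x → choice-count lab I (lab x) (lookup I x) x)))) ⟩
    Σₗ (subsets n) (λ I → T′ I * Πᶠ (λ x → options (lab x) (lookup I x) (#pointed (inside lab I))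
        (#pointed (inside lab I) ℕ.+ #unpointed (inside lab I)) (before (inside lab I) x ℕ.+ 0)))
      ≡⟨ codes-sum lab T ⟩
    total T (#pointed lab) (#unpointed lab) ∎
    where
    open ≡-Reasoning
    T′ : Vec Bool n → ℤ
    T′ I = T (#pointed (inside lab I)) (#unpointed (inside lab I))
    scale : ∀ {A : Set} (d : Dec A) t → when d t ≡ t * when d 1ℤ
    scale (yes _) t = sym (ℤₚ.*-identityʳ t)
    scale (no _)  t = sym (ℤₚ.*-zeroʳ t)

-- The bijection between codes and the partitions below a given one

module LowerSums where

  open FiniteSums
  open Partitions
  open FiniteDifferences
  open LabelledSubsets
  open CodeSums
  open import Data.Bool.Base using (Bool; true; false)
  open import Data.Fin.Base as Fin using (Fin)
  import Data.Fin.Properties as Finₚ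
  open import Data.Integer.Base as ℤ using (ℤ; +_)
  import Data.Integer.Properties as ℤₚ
  open import Data.Maybe.Base using (Maybe; just; nothing)
  open import Data.List.Base as List using (List)
  open import Data.Nat.Base as ℕ using (ℕ)
  import Data.Nat.Properties as ℕₚ
  open import Data.Product.Base using (_×_; _,_; proj₁; proj₂)
  open import Data.Vec.Base as Vec using (Vec; lookup; tabulate)
  import Data.Vec.Properties as Vecₚ
  open import Function.Base using (_∘_)
  open import Relation.Binary.PropositionalEquality using (_≡_; _≢_; refl; sym; trans; cong; cong₂; subst)
  open import Relation.Nullary using (¬_; Dec; yes; no; does; contradiction)
  open import Relation.Nullary.Decidable using (_×-dec_; ¬?; dec-true; dec-false)

  open Sums ℤₚ.+-*-commutativeRing

  module _ {p q : ℕ} where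

    private
      n = p ℕ.+ q
      SPP = SemiPointedPartition p q

    labelOf : ∀ {R : Set} → Dec R → Maybe (Fin p) → Label
    labelOf (no _)  _        = other
    labelOf (yes _) (just _) = pointed
    labelOf (yes _) nothing  = unpointed

    abstract

      label : SPP → Fin n → Label
      label P x = labelOf (isRep? P x) (pt P x)

      label⁻-rep : ∀ {P x} → label P x ≢ other → IsRep P x
      label⁻-rep {P} {x} l≢ with isRep? P x
      ... | yes r = r
      ... | no _  = contradiction refl l≢

      label⁺-rep : ∀ {P x} → IsRep P x → label P x ≢ other
      label⁺-rep {P} {x} r eq with isRep? P x | pt P x
      label⁺-rep {P} {x} r () | yes _ | just _
      label⁺-rep {P} {x} r () | yes _ | nothing
      ... | no ¬r | _ = ¬r r

      label-pointed : ∀ {P x} → label P x ≡ pointed → pt P x ≢ nothing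
      label-pointed {P} {x} eq eq′ with isRep? P x | pt P x
      label-pointed {P} {x} eq () | _ | just _
      label-pointed {P} {x} () _ | yes _ | nothing
      label-pointed {P} {x} () _ | no _ | nothing

      label-unpointed : ∀ {P x} → label P x ≡ unpointed → pt P x ≡ nothing
      label-unpointed {P} {x} eq with isRep? P x | pt P x
      label-unpointed {P} {x} () | no _  | _
      label-unpointed {P} {x} () | yes _ | just _
      ... | yes _ | nothing = refl

    label⁺-pointed : ∀ {P x} → IsRep P x → pt P x ≢ nothing → label P x ≡ pointed
    label⁺-pointed {P} {x} r pt≢ = by-cases (label P x) refl
      where
      by-cases : ∀ l → label P x ≡ l → label P x ≡ pointed
      by-cases other     eq = contradiction eq (label⁺-rep r)
      by-cases pointed   eq = eq
      by-cases unpointed eq = contradiction (label-unpointed {P} eq) pt≢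

    label⁺-unpointed : ∀ {P x} → IsRep P x → pt P x ≡ nothing → label P x ≡ unpointed
    label⁺-unpointed {P} {x} r pt≡ = by-cases (label P x) refl
      where
      by-cases : ∀ l → label P x ≡ l → label P x ≡ unpointed
      by-cases other     eq = contradiction eq (label⁺-rep r)
      by-cases pointed   eq = contradiction pt≡ (label-pointed {P} eq)
      by-cases unpointed eq = eq

    pointedBlocks unpointedBlocks : SPP → ℕ
    pointedBlocks   P = #pointed (label P)
    unpointedBlocks P = #unpointed (label P)

    pointed+unpointed : ∀ (P : SPP) → pointedBlocks P ℕ.+ unpointedBlocks P ≡ rank P
    pointed+unpointed P = ℤₚ.+-injective (trans (+-#chosen (label P)) (trans
      (Σₗ-cong (List.allFin n) λ x → when-⇔ (chosen? (label P x)) (isRep? P x) label⁻-rep label⁺-rep λ _ → refl)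
      (trans (sym (+length-filter (isRep? P) (List.allFin n))) (cong +_ (sym (rank≡count P))))))

    -- Both blocks contain their common point.
    same-point : ∀ {P : SPP} {x w} → pt P x ≡ pt P w → pt P x ≢ nothing → x ∼⟨ P ⟩ w
    same-point {P} {x} {w} eq pt≢ = by-cases (pt P x) refl
      where
      by-cases : ∀ m → pt P x ≡ m → x ∼⟨ P ⟩ w
      by-cases nothing  eq′ = contradiction eq′ pt≢
      by-cases (just e) eq′ = ∼-trans (pt-member eq′) (∼-sym (pt-member (trans (sym eq) eq′)))

    module Codes (Y : SPP) where

      lab : Fin n → Label
      lab = label Y

      module FromCode (I : Vec Bool n) (r : Vec (Fin n) n) (valid : Valid lab (I , r)) where

        L : Fin n → Label
        L = inside lab I

        chosen⇒bit : ∀ {x} → L x ≢ other → lookup I x ≡ true × lab x ≢ other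
        chosen⇒bit {x} L≢ with lookup I x
        ... | true  = refl , L≢
        ... | false = contradiction refl L≢

        bit⇒chosen : ∀ {x} → lookup I x ≡ true → lab x ≢ other → L x ≢ other
        bit⇒chosen {x} eq l≢ with lookup I x
        ... | true = l≢

        chosen⇒label : ∀ {x} → L x ≢ other → L x ≡ lab x
        chosen⇒label {x} L≢ with lookup I x
        ... | true  = refl
        ... | false = contradiction refl L≢

        bit⇒rep : ∀ {x} → lookup I x ≡ true → lab x ≢ other
        bit⇒rep {x} eq l≡ with lab x | lookup I x | valid x
        bit⇒rep {x} refl refl | other | true | ()

        chosen⇒rep : ∀ {x} → L x ≢ other → IsRep Y x
        chosen⇒rep L≢ = label⁻-rep (proj₂ (chosen⇒bit L≢))

        fixed : ∀ {x} → L x ≢ other → lookup r x ≡ x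
        fixed {x} L≢ = go (lab x) (lookup I x) (chosen⇒bit L≢) (valid x)
          where
          go : ∀ l b → b ≡ true × l ≢ other → choice lab I l b x (lookup r x) → lookup r x ≡ x
          go other     b     (_ , l≢) _ = contradiction refl l≢
          go pointed   true  _ eq = eq
          go unpointed true  _ eq = eq

        other-fixed : ∀ {x} → lab x ≡ other → lookup r x ≡ x
        other-fixed {x} eq = go (lab x) (lookup I x) eq (valid x)
          where
          go : ∀ l b → l ≡ other → choice lab I l b x (lookup r x) → lookup r x ≡ x
          go other false _ eq = eq

        lands : ∀ {x} → lab x ≢ other → L (lookup r x) ≢ other
        lands {x} l≢ = go (lab x) (lookup I x) refl refl (valid x)
          where
          self : lookup I x ≡ true → lookup r x ≡ x → L (lookup r x) ≢ other
          self bit eq = subst (λ c → L c ≢ other) (sym eq) (bit⇒chosen bit l≢)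
          go : ∀ l b → lab x ≡ l → lookup I x ≡ b → choice lab I l b x (lookup r x) → L (lookup r x) ≢ other
          go other     b     eq _ _        = contradiction eq l≢
          go pointed   true  _ bit eq      = self bit eq
          go pointed   false _ _ L≢        = L≢
          go unpointed true  _ bit eq      = self bit eq
          go unpointed false _ _ (L≢ , _)  = L≢

        earlier : ∀ {x} → lab x ≡ unpointed → L x ≡ other → L (lookup r x) ≡ unpointed → lookup r x Fin.< x
        earlier {x} l≡ L≡ = go (lab x) (lookup I x) l≡ refl (valid x)
          where
          go : ∀ l b → l ≡ unpointed → lookup I x ≡ b → choice lab I l b x (lookup r x) →
               L (lookup r x) ≡ unpointed → lookup r x Fin.< x
          go unpointed true  _ bit _ _ = contradiction L≡ (bit⇒chosen bit (λ eq → unpointed≢other (trans (sym l≡) eq)))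
          go unpointed false _ _ (_ , early) = early

        -- A retraction onto the chosen representatives, whose fibres are the blocks of the decoded
        -- partition.
        τ : Fin n → Fin n
        τ x = lookup r (rep Y x)

        rep-isRep : ∀ x → IsRep Y (rep Y x)
        rep-isRep = Transversal.chosen (reps Y)

        τ-chosen : ∀ x → L (τ x) ≢ other
        τ-chosen x = lands (label⁺-rep (rep-isRep x))

        τ-∼ : ∀ {x w} → x ∼⟨ Y ⟩ w → τ x ≡ τ w
        τ-∼ x∼w = cong (lookup r) (rep-cong x∼w)

        chosen-τ : ∀ {x} → L x ≢ other → τ x ≡ x
        chosen-τ L≢ = trans (cong (lookup r) (chosen⇒rep L≢)) (fixed L≢)

        ττ : ∀ x → τ (τ x) ≡ τ x
        ττ x = chosen-τ (τ-chosen x)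

        pointing-by-code : Pointing
        pointing-by-code = record
          { _≈_       = λ x w → τ x ≡ τ w
          ; ≈?        = λ x w → τ x Finₚ.≟ τ w
          ; ≈-refl    = refl
          ; ≈-sym     = sym
          ; ≈-trans   = trans
          ; mark      = λ x → pt Y (τ x)
          ; mark-cong = λ eq → cong (pt Y) (sym eq)
          ; mark-here = λ {x} eq → trans (sym (ττ x)) (τ-∼ (pt-member eq))
          ; mark-V₁   = λ {x} ⊆V₁ → proj₁ (proj₂ (proj₂ (proj₂ (isValid Y)))) (τ x)
                          λ w∈ → ⊆V₁ (trans (sym (ττ x)) (τ-∼ (rel w∈)))
          ; mark-V₂   = λ {x} ⊆V₂ → proj₂ (proj₂ (proj₂ (proj₂ (isValid Y)))) (τ x)
                          λ w∈ → ⊆V₂ (trans (sym (ττ x)) (τ-∼ (rel w∈)))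
          }

        abstract

          decoded : SPP
          decoded = Pointing.partition pointing-by-code

          decoded-∼⁺ : ∀ {x w} → τ x ≡ τ w → x ∼⟨ decoded ⟩ w
          decoded-∼⁺ = Pointing.∼⁺ pointing-by-code

          decoded-∼⁻ : ∀ {x w} → x ∼⟨ decoded ⟩ w → τ x ≡ τ w
          decoded-∼⁻ = Pointing.∼⁻ pointing-by-code

          decoded-pt : ∀ x → pt decoded x ≡ pt Y (τ x)
          decoded-pt = Pointing.pt-mark pointing-by-code

        decoded-≼ : decoded ≼ Y
        decoded-≼ = mk-≼ (λ x∼w → decoded-∼⁺ (τ-∼ x∼w)) λ x → τ x , decoded-∼⁺ (sym (ττ x)) , sym (decoded-pt x)

      Target : SPP → Fin n → Fin n → Set
      Target Z x w = x ∼⟨ Z ⟩ w × IsRep Y w × pt Y w ≡ pt Z x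

      target? : ∀ Z x w → Dec (Target Z x w)
      target? Z x w = ∼? Z x w ×-dec isRep? Y w ×-dec (pt Y w ≟ᵖ pt Z x)

      abstract

        -- For a pointed block of some `Z` below `Y` the target is unique, for an unpointed block
        -- the least one is taken. The default `x` arises only when `Z` is not below `Y`.
        σ : SPP → Fin n → Fin n
        σ Z x with Finₚ.any? (target? Z x)
        ... | yes found = proj₁ (least (target? Z x) found)
        ... | no _      = x

        σ-target : ∀ {Z x w} → Target Z x w → Target Z x (σ Z x)
        σ-target {Z} {x} t with Finₚ.any? (target? Z x)
        ... | yes found  = proj₁ (proj₂ (least (target? Z x) found))
        ... | no ¬found  = contradiction (_ , t) ¬found

        σ-least : ∀ {Z x w} → Target Z x w → σ Z x Fin.≤ w
        σ-least {Z} {x} t with Finₚ.any? (target? Z x)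
        ... | yes found  = proj₂ (proj₂ (least (target? Z x) found)) _ t
        ... | no ¬found  = contradiction (_ , t) ¬found

      move : SPP → ∀ x → Dec (IsRep Y x) → Fin n
      move Z x (yes _) = σ Z x
      move Z x (no _)  = x

      moved : ∀ Z {x} (d : Dec (IsRep Y x)) → IsRep Y x → move Z x d ≡ σ Z x
      moved Z (yes _) _ = refl
      moved Z (no ¬r) r = contradiction r ¬r

      unmoved : ∀ Z {x} (d : Dec (IsRep Y x)) → ¬ IsRep Y x → move Z x d ≡ x
      unmoved Z (yes r) ¬r = contradiction r ¬r
      unmoved Z (no _)  _  = refl

      bits : SPP → Vec Bool n
      bits Z = tabulate (λ x → does (σ Z x Finₚ.≟ x))

      moves : SPP → Vec (Fin n) n
      moves Z = tabulate (λ x → move Z x (isRep? Y x))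

      encode : SPP → Code n
      encode Z = bits Z , moves Z

      bit : ∀ Z x → lookup (bits Z) x ≡ does (σ Z x Finₚ.≟ x)
      bit Z x = Vecₚ.lookup∘tabulate _ x

      bit-true : ∀ Z {x} → lookup (bits Z) x ≡ true → σ Z x ≡ x
      bit-true Z {x} eq with σ Z x Finₚ.≟ x | trans (sym (bit Z x)) eq
      ... | yes σ≡ | _ = σ≡

      bit-false : ∀ Z {x} → lookup (bits Z) x ≡ false → σ Z x ≢ x
      bit-false Z {x} eq σ≡ with trans (sym (trans (bit Z x) (dec-true (σ Z x Finₚ.≟ x) σ≡))) eq
      ... | ()

      moves-rep : ∀ Z {x} → IsRep Y x → lookup (moves Z) x ≡ σ Z x
      moves-rep Z {x} r = trans (Vecₚ.lookup∘tabulate _ x) (moved Z (isRep? Y x) r)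

      moves-other : ∀ Z {x} → ¬ IsRep Y x → lookup (moves Z) x ≡ x
      moves-other Z {x} ¬r = trans (Vecₚ.lookup∘tabulate _ x) (unmoved Z (isRep? Y x) ¬r)

      module Encode {Z : SPP} (Z≼Y : Z ≼ Y) where

        L : Fin n → Label
        L = inside lab (bits Z)

        target : ∀ x → Target Z x (σ Z x)
        target x = let w , x∼w , eq = pointing Z≼Y x in σ-target
          ( ∼-trans x∼w (coarser Z≼Y ∼-rep)
          , Transversal.chosen (reps Y) w
          , trans (∼-pt (∼-rep {x = w} {P = Y})) eq )

        target-cong : ∀ {x y w} → x ∼⟨ Z ⟩ y → Target Z x w → Target Z y w
        target-cong x∼y (x∼w , r , eq) = ∼-trans (∼-sym x∼y) x∼w , r , trans eq (sym (∼-pt x∼y))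

        σ-cong : ∀ {x y} → x ∼⟨ Z ⟩ y → σ Z x ≡ σ Z y
        σ-cong {x} {y} x∼y = Finₚ.≤-antisym (σ-least (target-cong (∼-sym x∼y) (target y))) (σ-least (target-cong x∼y (target x)))

        ∼-σ : ∀ x → x ∼⟨ Z ⟩ σ Z x
        ∼-σ x = proj₁ (target x)

        σ-rep : ∀ x → IsRep Y (σ Z x)
        σ-rep x = proj₁ (proj₂ (target x))

        σ-pt : ∀ x → pt Y (σ Z x) ≡ pt Z x
        σ-pt x = proj₂ (proj₂ (target x))

        σσ : ∀ x → σ Z (σ Z x) ≡ σ Z x
        σσ x = sym (σ-cong (∼-σ x))

        L-chosen : ∀ {x} → σ Z x ≡ x → L x ≡ lab x
        L-chosen {x} σ≡ = cong (λ b → select b (lab x)) (trans (bit Z x) (dec-true (σ Z x Finₚ.≟ x) σ≡))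

        L-unchosen : ∀ {x} → σ Z x ≢ x → L x ≡ other
        L-unchosen {x} σ≢ = cong (λ b → select b (lab x)) (trans (bit Z x) (dec-false (σ Z x Finₚ.≟ x) σ≢))

        σ-label : ∀ x → L (σ Z x) ≢ other
        σ-label x L≡ = label⁺-rep (σ-rep x) (trans (sym (L-chosen (σσ x))) L≡)

        valid : Valid lab (encode Z)
        valid x = go (lab x) (lookup (bits Z) x) refl refl
          where
          rep-x : lab x ≢ other → IsRep Y x
          rep-x = label⁻-rep
          go : ∀ l b → lab x ≡ l → lookup (bits Z) x ≡ b → choice lab (bits Z) l b x (lookup (moves Z) x)
          stay : ∀ {l} → lab x ≡ l → l ≢ other → lookup (bits Z) x ≡ true → lookup (moves Z) x ≡ x
          stay eq l≢ b = trans (moves-rep Z (label⁻-rep (l≢ ∘ trans (sym eq)))) (bit-true Z b)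
          go other     true  eq b = contradiction eq (label⁺-rep (subst (IsRep Y) (bit-true Z b) (σ-rep x)))
          go other     false eq b = moves-other Z λ r → label⁺-rep r eq
          go pointed   true  eq b = stay eq (λ ()) b
          go unpointed true  eq b = stay eq (λ ()) b
          go pointed   false eq b = subst (λ c → L c ≢ other) (sym (moves-rep Z (rep-x λ eq′ → pointed≢other (trans (sym eq) eq′)))) (σ-label x)
          go unpointed false eq b = subst (Early L x) (sym (moves-rep Z r)) (σ-label x , early)
            where
            r : IsRep Y x
            r = rep-x λ eq′ → unpointed≢other (trans (sym eq) eq′)
            -- If the chosen representative is unpointed, so is the block of `Z`. Then `x` is itself
            -- a target, and the least target comes before it.
            early : L (σ Z x) ≡ unpointed → σ Z x Fin.< x
            early L≡ = Finₚ.≤∧≢⇒< (σ-least (∼-refl , r , trans (label-unpointed {P = Y} eq)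
                (trans (sym (label-unpointed {P = Y} (trans (sym (L-chosen (σσ x))) L≡))) (σ-pt x)))) (bit-false Z b)

        open FromCode (bits Z) (moves Z) valid using (τ; decoded; decoded-∼⁺; decoded-∼⁻; decoded-pt)

        τ≡σ : ∀ x → τ x ≡ σ Z x
        τ≡σ x = trans (moves-rep Z (Transversal.chosen (reps Y) x)) (sym (σ-cong (coarser Z≼Y ∼-rep)))

        decode-encode : decoded ≡ Z
        decode-encode = ∼-ext
          (λ {x} {w} x∼w → decoded-∼⁺ (trans (τ≡σ x) (trans (σ-cong x∼w) (sym (τ≡σ w)))))
          (λ {x} {w} x∼w → ∼-trans (∼-σ x) (subst (_∼⟨ Z ⟩ w) (sym (trans (sym (τ≡σ x)) (trans (decoded-∼⁻ x∼w) (τ≡σ w)))) (∼-sym (∼-σ w))))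
          (λ x → trans (decoded-pt x) (trans (cong (pt Y) (τ≡σ x)) (σ-pt x)))

        transversal : Transversal Z (λ x → σ Z x ≡ x)
        transversal = record
          { choice   = σ Z
          ; chosen   = σσ
          ; ∼-choice = ∼-σ
          ; unique   = λ σx σw x∼w → trans (sym σx) (trans (σ-cong x∼w) σw)
          }

        chosen⇒σ : ∀ {x} → L x ≢ other → σ Z x ≡ x
        chosen⇒σ {x} L≢ with σ Z x Finₚ.≟ x
        ... | yes σ≡ = σ≡
        ... | no σ≢  = contradiction (L-unchosen σ≢) L≢

        σ⇒pt : ∀ {x} → σ Z x ≡ x → pt Z x ≡ pt Y x
        σ⇒pt {x} σ≡ = trans (sym (σ-pt x)) (cong (pt Y) σ≡)

        σ⇒rep : ∀ {x} → σ Z x ≡ x → IsRep Y x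
        σ⇒rep {x} σ≡ = subst (IsRep Y) σ≡ (σ-rep x)

        -- The fixed points of `σ Z` are a transversal of `Z` on which `Y` and `Z` have the same
        -- points, so the labels of `Y` there count the pointed blocks of `Z`.
        pointed-type : #pointed L ≡ pointedBlocks Z
        pointed-type = trans
          (#pointed-count L (λ x → (σ Z x Finₚ.≟ x) ×-dec ¬? (pt Z x ≟ᵖ nothing))
            (λ x eq → let σ≡ = chosen⇒σ (λ eq′ → pointed≢other (trans (sym eq) eq′)) in
              σ≡ , λ pt≡ → label-pointed {P = Y} (trans (sym (L-chosen σ≡)) eq) (trans (sym (σ⇒pt σ≡)) pt≡))
            (λ x (σ≡ , pt≢) → trans (L-chosen σ≡) (label⁺-pointed (σ⇒rep σ≡) (pt≢ ∘ trans (σ⇒pt σ≡)))))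
          (trans (transversal-count {P = Z} (λ x → σ Z x Finₚ.≟ x) (isRep? Z) (λ x → ¬? (pt Z x ≟ᵖ nothing)) transversal (reps Z)
            (λ x∼w pt≢ → pt≢ ∘ trans (sym (∼-pt x∼w))))
          (sym (#pointed-count (label Z) (λ x → isRep? Z x ×-dec ¬? (pt Z x ≟ᵖ nothing))
            (λ x eq → label⁻-rep (λ eq′ → pointed≢other (trans (sym eq) eq′)) , label-pointed {P = Z} eq)
            (λ x (r , pt≢) → label⁺-pointed r pt≢))))

        unpointed-type : #unpointed L ≡ unpointedBlocks Z
        unpointed-type = trans
          (#unpointed-count L (λ x → (σ Z x Finₚ.≟ x) ×-dec (pt Z x ≟ᵖ nothing))
            (λ x eq → let σ≡ = chosen⇒σ (λ eq′ → unpointed≢other (trans (sym eq) eq′)) in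
              σ≡ , trans (σ⇒pt σ≡) (label-unpointed {P = Y} (trans (sym (L-chosen σ≡)) eq)))
            (λ x (σ≡ , pt≡) → trans (L-chosen σ≡) (label⁺-unpointed (σ⇒rep σ≡) (trans (sym (σ⇒pt σ≡)) pt≡))))
          (trans (transversal-count {P = Z} (λ x → σ Z x Finₚ.≟ x) (isRep? Z) (λ x → pt Z x ≟ᵖ nothing) transversal (reps Z)
            (λ x∼w pt≡ → trans (∼-pt x∼w) pt≡))
          (sym (#unpointed-count (label Z) (λ x → isRep? Z x ×-dec (pt Z x ≟ᵖ nothing))
            (λ x eq → label⁻-rep (λ eq′ → unpointed≢other (trans (sym eq) eq′)) , label-unpointed {P = Z} eq)
            (λ x (r , pt≡) → label⁺-unpointed r pt≡))))

      module _ (I : Vec Bool n) (r : Vec (Fin n) n) (valid : Valid lab (I , r)) where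

        open FromCode I r valid

        decoded-target : ∀ x → Target decoded x (τ x)
        decoded-target x = decoded-∼⁺ (sym (ττ x)) , chosen⇒rep (τ-chosen x) , sym (decoded-pt x)

        -- A target `w` is chosen and fixed; or it is pointed and equal to its image, since the
        -- point determines the block; or it is unpointed and its image is earlier by the rule for
        -- codes.
        τ-least : ∀ {x w} → Target decoded x w → τ x Fin.≤ w
        τ-least {x} {w} (x∼w , rw , eq) = subst (Fin._≤ w) (sym τx≡) (go (L w) (lab w) refl refl)
          where
          τx≡ : τ x ≡ lookup r w
          τx≡ = trans (decoded-∼⁻ x∼w) (cong (lookup r) rw)
          pt≡ : pt Y (lookup r w) ≡ pt Y w
          pt≡ = trans (cong (pt Y) (sym τx≡)) (trans (sym (decoded-pt x)) (sym eq))
          rw-chosen : L (lookup r w) ≢ other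
          rw-chosen = lands (label⁺-rep rw)
          fixed-≤ : L w ≢ other → lookup r w Fin.≤ w
          fixed-≤ L≢ = Finₚ.≤-reflexive (fixed L≢)
          go : ∀ l l′ → L w ≡ l → lab w ≡ l′ → lookup r w Fin.≤ w
          go pointed   _         L≡ _  = fixed-≤ λ eq → pointed≢other (trans (sym L≡) eq)
          go unpointed _         L≡ _  = fixed-≤ λ eq → unpointed≢other (trans (sym L≡) eq)
          go other     other     _  l≡ = contradiction l≡ (label⁺-rep rw)
          go other     pointed   _  l≡ = Finₚ.≤-reflexive (Transversal.unique (reps Y) (chosen⇒rep rw-chosen) rw
            (∼-sym (same-point (sym pt≡) (label-pointed {P = Y} l≡))))
          go other     unpointed L≡ l≡ = ℕₚ.<⇒≤ (earlier l≡ L≡ (trans (chosen⇒label rw-chosen)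
            (label⁺-unpointed (chosen⇒rep rw-chosen) (trans pt≡ (label-unpointed {P = Y} l≡)))))

        σ≡τ : ∀ x → σ decoded x ≡ τ x
        σ≡τ x = Finₚ.≤-antisym (σ-least (decoded-target x)) (τ-least (σ-target (decoded-target x)))

        encode-decode : encode decoded ≡ (I , r)
        encode-decode = cong₂ _,_ (lookup-ext λ x → trans (bit decoded x) (bits≡ x (lookup I x) refl))
                                  (lookup-ext λ x → moves≡ x (isRep? Y x))
          where
          lookup-ext : ∀ {A : Set} {m} {us vs : Vec A m} → (∀ i → lookup us i ≡ lookup vs i) → us ≡ vs
          lookup-ext {us = us} {vs} eq = trans (sym (Vecₚ.tabulate∘lookup us)) (trans (Vecₚ.tabulate-cong eq) (Vecₚ.tabulate∘lookup vs))
          bits≡ : ∀ x b → lookup I x ≡ b → does (σ decoded x Finₚ.≟ x) ≡ lookup I x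
          bits≡ x true  eq = trans (dec-true (σ decoded x Finₚ.≟ x) (trans (σ≡τ x) (chosen-τ (bit⇒chosen eq (bit⇒rep eq))))) (sym eq)
          bits≡ x false eq = trans (dec-false (σ decoded x Finₚ.≟ x) λ σ≡ → contradiction (trans (sym eq)
              (proj₁ (chosen⇒bit (subst (λ c → L c ≢ other) (trans (sym (σ≡τ x)) σ≡) (τ-chosen x))))) λ ()) (sym eq)
          moves≡ : ∀ x → Dec (IsRep Y x) → lookup (moves decoded) x ≡ lookup r x
          moves≡ x (yes rx) = trans (moves-rep decoded rx) (trans (σ≡τ x) (cong (lookup r) rx))
          moves≡ x (no ¬rx) = trans (moves-other decoded ¬rx) (sym (other-fixed (not-rep (lab x) refl)))
            where
            not-rep : ∀ l → lab x ≡ l → lab x ≡ other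
            not-rep other     eq = eq
            not-rep pointed   eq = contradiction (label⁻-rep λ eq′ → pointed≢other (trans (sym eq) eq′)) ¬rx
            not-rep unpointed eq = contradiction (label⁻-rep λ eq′ → unpointed≢other (trans (sym eq) eq′)) ¬rx

      decode′ : ∀ c → Dec (Valid lab c) → SPP
      decode′ (I , r) (yes v) = FromCode.decoded I r v
      -- Invalid codes carry the indicator 0 in the sum, so any partition can serve as their value.
      decode′ _       (no _)  = Y

      decode : Code n → SPP
      decode c = decode′ c (validCode? lab c)

      lower-sum : ∀ (T : ℕ → ℕ → ℤ) →
        Σₗ (allPartitions p q) (λ Z → when (Z ⊑? Y) (T (pointedBlocks Z) (unpointedBlocks Z)))
        ≡ total T (pointedBlocks Y) (unpointedBlocks Y)
      lower-sum T = trans (Σₗ-bijection _≟ˢ_ _≟ᶜ_ (FinitePoset.unique (Π p q)) (unique-codes n)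
          (∈-allPartitions p q) ∈-codes (_⊑? Y) (validCode? lab) encode decode to from
          (λ Z → T (pointedBlocks Z) (unpointedBlocks Z))
          (λ (I , r) → T (#pointed (inside lab I)) (#unpointed (inside lab I)))
          (λ Z Z⊑Y → let Z≼Y = ⊑⇒≼ {P = Z} {Y} Z⊑Y in
            cong₂ T (sym (Encode.pointed-type Z≼Y)) (sym (Encode.unpointed-type Z≼Y))))
        (valid-codes-sum lab T)
        where
        to : ∀ Z → Z ⊑ Y → Valid lab (encode Z) × decode (encode Z) ≡ Z
        to Z Z⊑Y = Encode.valid Z≼Y , back (validCode? lab (encode Z))
          where
          Z≼Y = ⊑⇒≼ {P = Z} {Y} Z⊑Y
          back : ∀ d → decode′ (encode Z) d ≡ Z
          back (no ¬v) = contradiction (Encode.valid Z≼Y) ¬v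
          back (yes v) = decoded-unique v
            where
            decoded-unique : ∀ v → FromCode.decoded (bits Z) (moves Z) v ≡ Z
            decoded-unique v = trans (independent v) (Encode.decode-encode Z≼Y)
              where
              independent : ∀ v → FromCode.decoded (bits Z) (moves Z) v ≡ FromCode.decoded (bits Z) (moves Z) (Encode.valid Z≼Y)
              independent v = ∼-ext
                (λ x∼w → FromCode.decoded-∼⁺ _ _ v (FromCode.decoded-∼⁻ _ _ (Encode.valid Z≼Y) x∼w))
                (λ x∼w → FromCode.decoded-∼⁺ _ _ (Encode.valid Z≼Y) (FromCode.decoded-∼⁻ _ _ v x∼w))
                (λ x → trans (FromCode.decoded-pt _ _ v x) (sym (FromCode.decoded-pt _ _ (Encode.valid Z≼Y) x)))
        from : ∀ c → Valid lab c → decode c ⊑ Y × encode (decode c) ≡ c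
        from c@(I , r) v = go (validCode? lab c)
          where
          go : (d : Dec (Valid lab c)) → decode′ c d ⊑ Y × encode (decode′ c d) ≡ c
          go (no ¬v) = contradiction v ¬v
          go (yes v) = ≼⇒⊑ {P = FromCode.decoded I r v} {Y} (FromCode.decoded-≼ I r v) , encode-decode I r v

-- The three Möbius numbers as closed formulas

module MöbiusNumbers where

  open FiniteSums
  open MöbiusFunctions
  open CoatomOrderings
  open Partitions
  open IntervalShelling
  open BottomShelling
  open FiniteDifferences
  open LabelledSubsets
  open CodeSums
  open LowerSums
  open import Data.Fin.Base as Fin using (Fin; zero; suc; splitAt; _↑ˡ_; _↑ʳ_)
  import Data.Fin.Properties as Finₚ
  open import Data.Fin.Subset using (_∈_)
  open import Data.Fin.Subset.Properties using (∈⊤; x∈⁅y⁆⇒x≡y)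
  open import Data.Integer.Base as ℤ using (ℤ; +_; 0ℤ; 1ℤ; -1ℤ)
  import Data.Integer.Properties as ℤₚ
  open import Data.Integer.Tactic.RingSolver using (solve-∀)
  open import Data.List.Base as List using (List; []; _∷_; allFin; filter)
  open import Data.List.Membership.Propositional.Properties using (∈-allFin)
  import Data.List.Relation.Unary.Unique.Propositional.Properties as Uniqueₚ
  open import Data.Maybe.Base using (just; nothing)
  open import Data.Maybe.Properties using (just-injective)
  open import Data.Nat.Base as ℕ using (ℕ; zero; suc; _∸_; _!)
  import Data.Nat.Properties as ℕₚ
  open import Data.Nat.ListAction using (sum)
  open import Data.Product.Base using (Σ-syntax; ∃-syntax; _×_; _,_; proj₁; proj₂)
  open import Data.Sum.Base using (inj₁; inj₂; [_,_]′)
  open import Data.Vec.Base as Vec using ()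
  import Data.Vec.Properties as Vecₚ
  open import Function.Base using (_∘_; id; const)
  open import Relation.Binary.PropositionalEquality using (_≡_; _≢_; refl; sym; trans; cong; cong₂; subst; module ≡-Reasoning)
  open import Relation.Nullary using (¬_; Dec; yes; no; contradiction)
  open import Relation.Nullary.Construct.Add.Infimum using (⊥₋; [_])
  open import Relation.Nullary.Decidable using (_×-dec_; decidable-stable)
  import Relation.Binary.Construct.Add.Infimum.NonStrict as AddInfimum

  open Sums ℤₚ.+-*-commutativeRing

  pos-^ : ∀ m k → + (m ℕ.^ k) ≡ (+ m) ℤ.^ k
  pos-^ m zero    = refl
  pos-^ m (suc k) = trans (ℤₚ.pos-* m (m ℕ.^ k)) (cong (+ m ℤ.*_) (pos-^ m k))

  factorial-rise : ∀ k c → + (k !) ℤ.* rise (suc k) c ≡ + ((k ℕ.+ c) !)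
  factorial-rise k zero    = trans (ℤₚ.*-identityʳ _) (cong (λ l → + (l !)) (sym (ℕₚ.+-identityʳ k)))
  factorial-rise k (suc c) = begin
    + (k !) ℤ.* (rise (suc k) c ℤ.* + (suc k ℕ.+ c))   ≡⟨ ℤₚ.*-assoc (+ (k !)) _ _ ⟨
    + (k !) ℤ.* rise (suc k) c ℤ.* + (suc k ℕ.+ c)     ≡⟨ cong (ℤ._* + (suc k ℕ.+ c)) (factorial-rise k c) ⟩
    + ((k ℕ.+ c) !) ℤ.* + (suc k ℕ.+ c)                ≡⟨ ℤₚ.*-comm (+ ((k ℕ.+ c) !)) _ ⟩
    + (suc k ℕ.+ c) ℤ.* + ((k ℕ.+ c) !)                ≡⟨ ℤₚ.pos-* (suc k ℕ.+ c) ((k ℕ.+ c) !) ⟨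
    + ((suc (k ℕ.+ c)) !)                              ≡⟨ cong (λ l → + (l !)) (ℕₚ.+-suc k c) ⟨
    + ((k ℕ.+ suc c) !) ∎
    where open ≡-Reasoning

  private
    signed : ∀ s r f x → f ℤ.* ℤ.- ((-1ℤ ℤ.* s) ℤ.* r ℤ.* x) ≡ s ℤ.* ((f ℤ.* r) ℤ.* x)
    signed = solve-∀
    unsigned : ∀ s r f x → f ℤ.* (s ℤ.* r ℤ.* x) ≡ s ℤ.* ((f ℤ.* r) ℤ.* x)
    unsigned = solve-∀

  pointedSum-value : ∀ p q → 1 ℕ.≤ p → + ((p ∸ 1) !) ℤ.* pointedSum p q ≡
                     sgn (p ℕ.+ q ∸ 1) ℤ.* + ((p ℕ.+ q ∸ 1) ! ℕ.* (p ℕ.+ q) ℕ.^ (p ∸ 1))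
  pointedSum-value (suc p) q _ = trans (signed (sgn (p ℕ.+ q)) (rise (suc p) q) (+ (p !)) _)
    (cong (sgn (p ℕ.+ q) ℤ.*_) (trans (cong₂ ℤ._*_ (factorial-rise p q) (sym (pos-^ (suc p ℕ.+ q) p)))
      (sym (ℤₚ.pos-* ((p ℕ.+ q) !) _))))

  bottomNumber-value : ∀ p q → 1 ℕ.≤ p → + ((p ∸ 1) !) ℤ.* bottomNumber p q ≡
                          sgn (p ℕ.+ q) ℤ.* + ((p ℕ.+ q ∸ 1) ! ℕ.* (p ℕ.+ q ∸ 1) ℕ.^ (p ∸ 1))
  bottomNumber-value (suc p) q _ = trans (unsigned (sgn (suc p ℕ.+ q)) (rise (suc p) q) (+ (p !)) _)
    (cong (sgn (suc p ℕ.+ q) ℤ.*_) (trans (cong₂ ℤ._*_ (factorial-rise p q) (sym (pos-^ (p ℕ.+ q) p)))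
      (sym (ℤₚ.pos-* ((p ℕ.+ q) !) _))))

  minimalSum-value : ∀ p q → p ℕ.+ q ≢ 0 → + (p !) ℤ.* minimalSum p q ≡
                     sgn (p ℕ.+ q ∸ 1) ℤ.* + ((p ℕ.+ q ∸ 1) ! ℕ.* (p ℕ.+ q) ℕ.^ p)
  minimalSum-value zero    zero    ne = contradiction refl ne
  minimalSum-value (suc p) zero    _  = begin
    + (suc p !) ℤ.* pointedSum (suc p) 0
      ≡⟨ cong (ℤ._* pointedSum (suc p) 0) (ℤₚ.pos-* (suc p) (p !)) ⟩
    + suc p ℤ.* + (p !) ℤ.* pointedSum (suc p) 0
      ≡⟨ ℤₚ.*-assoc (+ suc p) (+ (p !)) _ ⟩
    + suc p ℤ.* (+ (p !) ℤ.* pointedSum (suc p) 0)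
      ≡⟨ cong (+ suc p ℤ.*_) (pointedSum-value (suc p) 0 (ℕ.s≤s ℕ.z≤n)) ⟩
    + suc p ℤ.* (sgn (p ℕ.+ 0) ℤ.* + ((p ℕ.+ 0) ! ℕ.* (suc p ℕ.+ 0) ℕ.^ p))
      ≡⟨ cong (λ l → + suc p ℤ.* (sgn l ℤ.* + (l ! ℕ.* suc l ℕ.^ p))) (ℕₚ.+-identityʳ p) ⟩
    + suc p ℤ.* (sgn p ℤ.* + (p ! ℕ.* suc p ℕ.^ p))
      ≡⟨ shuffle (+ suc p) (sgn p) _ ⟩
    sgn p ℤ.* (+ suc p ℤ.* + (p ! ℕ.* suc p ℕ.^ p))
      ≡⟨ cong (sgn p ℤ.*_) (trans (sym (ℤₚ.pos-* (suc p) _)) (cong +_ (swap (suc p) (p !) (suc p ℕ.^ p)))) ⟩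
    sgn p ℤ.* + (p ! ℕ.* suc p ℕ.^ suc p)
      ≡⟨ cong (λ l → sgn l ℤ.* + (l ! ℕ.* suc l ℕ.^ suc p)) (ℕₚ.+-identityʳ p) ⟨
    sgn (p ℕ.+ 0) ℤ.* + ((p ℕ.+ 0) ! ℕ.* (suc p ℕ.+ 0) ℕ.^ suc p) ∎
    where
    open ≡-Reasoning
    shuffle : ∀ a s x → a ℤ.* (s ℤ.* x) ≡ s ℤ.* (a ℤ.* x)
    shuffle = solve-∀
    swap : ∀ a b c → a ℕ.* (b ℕ.* c) ≡ b ℕ.* (a ℕ.* c)
    swap a b c = trans (sym (ℕₚ.*-assoc a b c)) (trans (cong (ℕ._* c) (ℕₚ.*-comm a b)) (ℕₚ.*-assoc b a c))
  minimalSum-value p       (suc q) _  rewrite ℕₚ.+-suc p q =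
    trans (signed (sgn (p ℕ.+ q)) (rise (suc p) q) (+ (p !)) _)
      (cong (sgn (p ℕ.+ q) ℤ.*_) (trans (cong₂ ℤ._*_ (factorial-rise p q) (sym (pos-^ (suc (p ℕ.+ q)) p)))
        (sym (ℤₚ.pos-* ((p ℕ.+ q) !) _))))

  sgn² : ∀ k → sgn k ℤ.* sgn k ≡ 1ℤ
  sgn² zero    = refl
  sgn² (suc k) = trans (lemma (sgn k)) (sgn² k)
    where
    lemma : ∀ s → (-1ℤ ℤ.* s) ℤ.* (-1ℤ ℤ.* s) ≡ s ℤ.* s
    lemma = solve-∀

  cancel-sign : ∀ k f d {x} → + f ℤ.* (sgn k ℤ.* + d) ≡ sgn k ℤ.* + x → f ℕ.* d ≡ x
  cancel-sign k f d {x} eq = ℤₚ.+-injective (begin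
    + (f ℕ.* d)                               ≡⟨ ℤₚ.pos-* f d ⟩
    + f ℤ.* + d                               ≡⟨ unit (+ f ℤ.* + d) ⟩
    sgn k ℤ.* sgn k ℤ.* (+ f ℤ.* + d)         ≡⟨ lemma (sgn k) (+ f) (+ d) ⟩
    sgn k ℤ.* (+ f ℤ.* (sgn k ℤ.* + d))       ≡⟨ cong (sgn k ℤ.*_) eq ⟩
    sgn k ℤ.* (sgn k ℤ.* + x)                 ≡⟨ ℤₚ.*-assoc (sgn k) (sgn k) (+ x) ⟨
    sgn k ℤ.* sgn k ℤ.* + x                   ≡⟨ unit (+ x) ⟨
    + x ∎)
    where
    open ≡-Reasoning
    unit : ∀ y → y ≡ sgn k ℤ.* sgn k ℤ.* y
    unit y = sym (trans (cong (ℤ._* y) (sgn² k)) (ℤₚ.*-identityˡ y))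
    lemma : ∀ s f d → s ℤ.* s ℤ.* (f ℤ.* d) ≡ s ℤ.* (f ℤ.* (s ℤ.* d))
    lemma = solve-∀

  +-sum : ∀ {A : Set} (d : A → ℕ) xs → + sum (List.map d xs) ≡ Σₗ xs (λ x → + d x)
  +-sum d []       = refl
  +-sum d (x ∷ xs) = trans (ℤₚ.pos-+ (d x) _) (cong (λ t → + d x ℤ.+ t) (+-sum d xs))

  Σ-signed : ∀ {A : Set} k (d : A → ℕ) xs → Σₗ xs (λ x → sgn k ℤ.* + d x) ≡ sgn k ℤ.* + sum (List.map d xs)
  Σ-signed k d xs = trans (Σₗ-* xs (sgn k) (λ x → + d x)) (cong (sgn k ℤ.*_) (sym (+-sum d xs)))

  Σ-filter : ∀ {A : Set} {Q : A → Set} (Q? : ∀ x → Dec (Q x)) xs (f : A → ℤ) →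
             Σₗ (filter Q? xs) f ≡ Σₗ xs (λ x → when (Q? x) (f x))
  Σ-filter Q? []       f = refl
  Σ-filter Q? (x ∷ xs) f with Q? x
  ... | yes _ = cong (λ t → f x ℤ.+ t) (Σ-filter Q? xs f)
  ... | no  _ = trans (Σ-filter Q? xs f) (sym (ℤₚ.+-identityˡ _))

  #pointed-≢0 : ∀ {n} (L : Fin n → Label) → #pointed L ≢ 0 → Σ[ x ∈ Fin n ] L x ≡ pointed
  #pointed-≢0 {zero}  L ne = contradiction refl ne
  #pointed-≢0 {suc n} L ne with L zero in eq
  ... | pointed   = zero , eq
  ... | other     = let x , eq′ = #pointed-≢0 (L ∘ suc) ne in suc x , eq′
  ... | unpointed = let x , eq′ = #pointed-≢0 (L ∘ suc) ne in suc x , eq′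

  #unpointed-0 : ∀ {n} (L : Fin n → Label) → (∀ x → L x ≢ unpointed) → #unpointed L ≡ 0
  #unpointed-0 {zero}  L ne = refl
  #unpointed-0 {suc n} L ne with L zero in eq
  ... | pointed   = #unpointed-0 (L ∘ suc) (ne ∘ suc)
  ... | other     = #unpointed-0 (L ∘ suc) (ne ∘ suc)
  ... | unpointed = contradiction eq (ne zero)

  #-split : ∀ p {q} (L : Fin (p ℕ.+ q) → Label) → (∀ v → L (v ↑ˡ q) ≡ pointed) → (∀ w → L (p ↑ʳ w) ≡ unpointed) →
            #pointed L ≡ p × #unpointed L ≡ q
  #-split zero    {zero}  L _ _ = refl , refl
  #-split zero    {suc q} L P U with L zero | U zero
  ... | unpointed | _ = let i , j = #-split zero {q} (L ∘ suc) (λ ()) (U ∘ suc) in i , cong suc j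
  #-split (suc p) {q}     L P U with L zero | P zero
  ... | pointed | _ = let i , j = #-split p {q} (L ∘ suc) (P ∘ suc) U in cong suc i , j

  module _ {p q : ℕ} where

    private
      n = p ℕ.+ q
      SPP = SemiPointedPartition p q

    open FinitePoset (Π p q) using (elements; unique; Minimal; minimal?; minimals) renaming (_<_ to _⊏_; _<?_ to _⊏?_)

    top : SPP
    top = singletons

    top-∼ : ∀ {x w} → x ∼⟨ top ⟩ w → x ≡ w
    top-∼ {x} {w} (rel w∈) = sym (x∈⁅y⁆⇒x≡y x (subst (λ (B : Block p q) → w ∈ members B) (Vecₚ.lookup∘tabulate _ x) w∈))

    top-pt : ∀ x → pt top x ≡ [ just , const nothing ]′ (splitAt p x)
    top-pt x = cong point (Vecₚ.lookup∘tabulate _ x)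

    top-pt-V₁ : ∀ v → pt top (v ↑ˡ q) ≡ just v
    top-pt-V₁ v = trans (top-pt (v ↑ˡ q)) (cong [ just , const nothing ]′ (Finₚ.splitAt-↑ˡ p v q))

    top-pt-V₂ : ∀ w → pt top (p ↑ʳ w) ≡ nothing
    top-pt-V₂ w = trans (top-pt (p ↑ʳ w)) (cong [ just , const nothing ]′ (Finₚ.splitAt-↑ʳ p q w))

    top-pt-or-V₁ : ∀ x → pt top x ≢ nothing → x ∈ V₁ p q
    top-pt-or-V₁ x ne with splitAt p x in split | top-pt x
    ... | inj₁ v | _  = subst (_∈ V₁ p q) (Finₚ.splitAt⁻¹-↑ˡ split) (↑ˡ∈V₁ v)
    ... | inj₂ w | eq = contradiction eq ne

    ≼-top : ∀ (P : SPP) → P ≼ top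
    ≼-top P = mk-≼ (λ {x} x∼w → subst (x ∼⟨ P ⟩_) (top-∼ x∼w) ∼-refl) λ x → witness x (pt P x) refl
      where
      witness : ∀ x mp → pt P x ≡ mp → ∃[ w ] (x ∼⟨ P ⟩ w × pt top w ≡ pt P x)
      witness x (just e) eq = e ↑ˡ q , pt-member eq , trans (top-pt-V₁ e) (sym eq)
      witness x nothing  eq with Finₚ.any? (λ w → ∼? P x w ×-dec (pt top w ≟ᵖ nothing))
      ... | yes (w , x∼w , eq′) = w , x∼w , trans eq′ (sym eq)
      -- An unpointed block is not contained in V₁, so it has an element of V₂, and the singleton of
      -- that element is unpointed.
      ... | no ¬found = contradiction eq (proj₁ (proj₂ (proj₂ (proj₂ (isValid P)))) x λ {w} w∈ →
        top-pt-or-V₁ w λ eq′ → ¬found (w , rel w∈ , eq′))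

    top-rep : ∀ x → IsRep top x
    top-rep x = sym (top-∼ ∼-rep)

    top-type : pointedBlocks top ≡ p × unpointedBlocks top ≡ q
    top-type = #-split p (label top)
      (λ v → label⁺-pointed (top-rep _) λ eq → contradiction (trans (sym (top-pt-V₁ v)) eq) λ ())
      (λ w → label⁺-unpointed (top-rep _) (top-pt-V₂ w))

    at-top : ∀ (T : ℕ → ℕ → ℤ) → T (pointedBlocks top) (unpointedBlocks top) ≡ T p q
    at-top T = cong₂ T (proj₁ top-type) (proj₂ top-type)

    rank-top : rank top ≡ n
    rank-top = trans (sym (pointed+unpointed top)) (cong₂ ℕ._+_ (proj₁ top-type) (proj₂ top-type))

    m-∼ : ∀ (v : Fin p) (x w : Fin n) → x ∼⟨ m {p} {q} v ⟩ w
    m-∼ v x w = rel (subst (λ (B : Block p q) → w ∈ members B) (sym (Vecₚ.lookup-replicate x _)) ∈⊤)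

    m-pt : ∀ (v : Fin p) (x : Fin n) → pt (m {p} {q} v) x ≡ just v
    m-pt v x = cong point (Vecₚ.lookup-replicate x _)

    rank-m : ∀ (v : Fin p) → rank (m {p} {q} v) ≡ 1
    rank-m v = one-block-rank (v ↑ˡ q) (m-∼ v (v ↑ˡ q))

    m-type : ∀ (v : Fin p) → pointedBlocks (m {p} {q} v) ≡ 1 × unpointedBlocks (m {p} {q} v) ≡ 0
    m-type v = trans (sym (ℕₚ.+-identityʳ _)) (trans (cong (pointedBlocks (m v) ℕ.+_) (sym none)) (trans (pointed+unpointed (m v)) (rank-m v))) , none
      where
      none : unpointedBlocks (m {p} {q} v) ≡ 0
      none = #unpointed-0 (label (m v)) λ x eq → contradiction (trans (sym (m-pt v x)) (label-unpointed {P = m v} eq)) λ ()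

    type-m : ∀ (Y : SPP) → pointedBlocks Y ≡ 1 → unpointedBlocks Y ≡ 0 → Σ[ v ∈ Fin p ] m v ≡ Y
    type-m Y pb ub = let x , eq = #pointed-≢0 (label Y) (λ pb0 → ℕₚ.1+n≢0 (trans (sym pb) pb0)) in
      pick x (pt Y x) refl (label-pointed {P = Y} eq)
      where
      rk : rank Y ≡ 1
      rk = trans (sym (pointed+unpointed Y)) (cong₂ ℕ._+_ pb ub)
      pick : ∀ x mp → pt Y x ≡ mp → pt Y x ≢ nothing → Σ[ v ∈ Fin p ] m v ≡ Y
      pick x nothing  eq ne = contradiction eq ne
      pick x (just v) eq _  = v , ∼-ext (λ _ → m-∼ v _ _) (λ _ → one-block x rk _ _)
        λ w → trans (m-pt v w) (sym (trans (∼-pt (one-block x rk x w)) eq))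

    m-injective : ∀ {v w : Fin p} → m {p} {q} v ≡ m w → v ≡ w
    m-injective {v} {w} eq = just-injective (trans (sym (m-pt v (v ↑ˡ q))) (trans (cong (λ (P : SPP) → pt P (v ↑ˡ q)) eq) (m-pt w (v ↑ˡ q))))

    private module Mπ = Möbius (Π p q)

    -- The partitions of type (1 , 0) are exactly the `m v`, each for a single `v`, so both sides
    -- are the indicator of this type.
    sum-m : ∀ (Y : SPP) → Σₗ (allFin p) (λ v → when (m v ≟ˢ Y) 1ℤ) ≡ total pointedSum (pointedBlocks Y) (unpointedBlocks Y)
    sum-m Y = by-cases (pointedBlocks Y ℕₚ.≟ 1) (unpointedBlocks Y ℕₚ.≟ 0)
      where
      none : (∀ v → m v ≢ Y) → Σₗ (allFin p) (λ v → when (m v ≟ˢ Y) 1ℤ) ≡ 0ℤ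
      none ne = trans (Σₗ-cong (allFin p) λ v → when-no (m v ≟ˢ Y) (ne v)) (Σₗ-zero (allFin p))
      by-cases : Dec (pointedBlocks Y ≡ 1) → Dec (unpointedBlocks Y ≡ 0) →
        Σₗ (allFin p) (λ v → when (m v ≟ˢ Y) 1ℤ) ≡ total pointedSum (pointedBlocks Y) (unpointedBlocks Y)
      by-cases (yes pb) (yes ub) = let e , m≡Y = type-m Y pb ub in
        trans (Σₗ-cong (allFin p) λ v → when-⇔ (m v ≟ˢ Y) (v Finₚ.≟ e) (λ eq → m-injective (trans eq (sym m≡Y)))
            (λ { refl → m≡Y }) (λ _ → refl))
          (trans (Σₗ-single Finₚ._≟_ (λ _ → 1ℤ) (Uniqueₚ.allFin⁺ p) (∈-allFin e)) (sym (cong₂ (total pointedSum) pb ub)))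
      by-cases (no pb) _ = trans (none λ v eq → pb (trans (cong pointedBlocks (sym eq)) (proj₁ (m-type v))))
        (sym (total-pointedSum-0 (pointedBlocks Y) (unpointedBlocks Y) λ eq → pb (cong proj₁ eq)))
      by-cases (yes _) (no ub) = trans (none λ v eq → ub (trans (cong unpointedBlocks (sym eq)) (proj₂ (m-type v))))
        (sym (total-pointedSum-0 (pointedBlocks Y) (unpointedBlocks Y) λ eq → ub (cong proj₂ eq)))

    Σμ-list : ∀ {A : Set} (f : A → SPP) xs Y →
              Σₗ elements (λ Z → when (Z ⊑? Y) (Σₗ xs λ a → μ (Π p q) (f a) Z)) ≡ Σₗ xs (λ a → when (f a ≟ˢ Y) 1ℤ)
    Σμ-list f xs Y = trans (Σₗ-cong elements λ Z → Σₗ-when (Z ⊑? Y) xs _) (trans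
      (Σₗ-swap elements xs λ Z a → when (Z ⊑? Y) (μ (Π p q) (f a) Z)) (Σₗ-cong xs λ a → Mπ.Σμ (f a) Y))

    -- A single μ(m v , Y) also depends on whether `v` is the point of a block of `Y`. Only the sum
    -- over `v` is a function of the two block counts, which is what the inversion requires.
    Σμ-pointed : ∀ (Y : SPP) → Σₗ (allFin p) (λ v → μ (Π p q) (m v) Y) ≡ pointedSum (pointedBlocks Y) (unpointedBlocks Y)
    Σμ-pointed = Mπ.Σ≤-injective λ Y →
      trans (Σμ-list m (allFin p) Y) (trans (sum-m Y) (sym (Codes.lower-sum Y pointedSum)))

    rank-minimal : ∀ {Y : SPP} → Fin n → Minimal Y → rank Y ≡ 1
    rank-minimal {Y} x₀ min = by-rank (rank Y) refl
      where
      by-rank : ∀ k → rank Y ≡ k → rank Y ≡ 1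
      by-rank zero          rk = contradiction rk (rank≢0 x₀)
      by-rank (suc zero)    rk = rk
      by-rank (suc (suc k)) rk = let w , x≁w = two-blocks rk x₀ in
        contradiction (trans (cong suc (cong rank (sym (min _ (≼⇒⊑ {P = merge Y x₀ w} {Y} merge-≼))))) (rank-merge x≁w)) ℕₚ.1+n≢n

    minimal-rank : ∀ {Y : SPP} → Fin n → rank Y ≡ 1 → Minimal Y
    minimal-rank {Y} x₀ rk Z Z⊑Y = decidable-stable (Z ≟ˢ Y) λ Z≢Y →
      rank≢0 x₀ (ℕₚ.n<1⇒n≡0 (subst (rank Z ℕ.<_) rk (rank-mono (rank Y) refl (⊑⇒≼ {P = Z} {Y} Z⊑Y) Z≢Y)))

    -- The minimal partitions are those of rank one, so the lower sums of the left side are the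
    -- indicator of rank one.
    Σμ-minimal : Fin n → ∀ (Y : SPP) → Σₗ minimals (λ x → μ (Π p q) x Y) ≡ minimalSum (pointedBlocks Y) (unpointedBlocks Y)
    Σμ-minimal x₀ = Mπ.Σ≤-injective λ Y → trans (Σμ-list id minimals Y) (trans
        (Σ-filter minimal? elements (λ x → when (x ≟ˢ Y) 1ℤ)) (trans (Σₗ-cong elements λ x → exchange x Y)
        (trans (Σₗ-single _≟ˢ_ (λ x → when (minimal? x) 1ℤ) unique (∈-allPartitions p q Y)) (trans
        (by-rank Y (minimal? Y)) (sym (Codes.lower-sum Y minimalSum))))))
      where
      exchange : ∀ x Y → when (minimal? x) (when (x ≟ˢ Y) 1ℤ) ≡ when (x ≟ˢ Y) (when (minimal? x) 1ℤ)
      exchange x Y = by-cases (minimal? x) (x ≟ˢ Y)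
        where
        by-cases : ∀ {A B : Set} (d : Dec A) (e : Dec B) → when d (when e 1ℤ) ≡ when e (when d 1ℤ)
        by-cases (yes _) (yes _) = refl
        by-cases (yes _) (no _)  = refl
        by-cases (no _)  (yes _) = refl
        by-cases (no _)  (no _)  = refl
      by-rank : ∀ Y (d : Dec (Minimal Y)) → when d 1ℤ ≡ total minimalSum (pointedBlocks Y) (unpointedBlocks Y)
      by-rank Y (yes min) = sym (total-minimalSum-1 (pointedBlocks Y) (unpointedBlocks Y) (trans (pointed+unpointed Y) (rank-minimal x₀ min)))
      by-rank Y (no ¬min) = sym (total-minimalSum-0 (pointedBlocks Y) (unpointedBlocks Y) λ eq →
        ¬min (minimal-rank x₀ (trans (sym (pointed+unpointed Y)) eq)))

    -- The lower sum over the proper partitions is -1: together with the term 1 of the bottom itself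
    -- it must give 0.
    μ-bottom : Fin n → ∀ (Y : SPP) → μ (Π̂ p q) ⊥₋ [ Y ] ≡ bottomNumber (pointedBlocks Y) (unpointedBlocks Y)
    μ-bottom x₀ = Mπ.Σ≤-injective λ Y → trans (lower Y) (sym (trans (Codes.lower-sum Y bottomNumber)
        (total-bottomNumber (pointedBlocks Y) (unpointedBlocks Y) λ eq → rank≢0 x₀ (trans (sym (pointed+unpointed Y)) (cong₂ ℕ._+_ (cong proj₁ eq) (cong proj₂ eq))))))
      where
      module M̂ = Möbius (Π̂ p q)
      open AddInfimum (_⊑_ {p} {q}) using (⊥₋≤_; [_]; [≤]-injective)
      _≤̂?_ = FinitePoset._≤?_ (Π̂ p q)
      φ : SPP → ℤ
      φ Z = μ (Π̂ p q) ⊥₋ [ Z ]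
      lower : ∀ Y → Σₗ elements (λ Z → when (Z ⊑? Y) (φ Z)) ≡ -1ℤ
      lower Y = begin
        S                                                                             ≡⟨ lemma S ⟩
        -1ℤ ℤ.+ (1ℤ ℤ.+ S)                                                            ≡⟨ cong (λ t → -1ℤ ℤ.+ t) (sym whole) ⟩
        -1ℤ ℤ.+ Σₗ (FinitePoset.elements (Π̂ p q)) (λ z → when (z ≤̂? [ Y ]) (μ (Π̂ p q) ⊥₋ z))
                                                                                      ≡⟨ cong (λ t → -1ℤ ℤ.+ t) (M̂.Σμ ⊥₋ [ Y ]) ⟩
        -1ℤ ℤ.+ 0ℤ ∎
        where
        open ≡-Reasoning
        S = Σₗ elements (λ Z → when (Z ⊑? Y) (φ Z))
        lemma : ∀ s → s ≡ -1ℤ ℤ.+ (1ℤ ℤ.+ s)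
        lemma = solve-∀
        whole : Σₗ (FinitePoset.elements (Π̂ p q)) (λ z → when (z ≤̂? [ Y ]) (μ (Π̂ p q) ⊥₋ z)) ≡ 1ℤ ℤ.+ S
        whole = cong₂ ℤ._+_ (trans (when-yes (⊥₋ ≤̂? [ Y ]) (⊥₋≤ [ Y ])) (M̂.μ-refl ⊥₋))
          (trans (Σₗ-map [_] elements _) (Σₗ-cong elements λ Z →
            when-⇔ ([ Z ] ≤̂? [ Y ]) (Z ⊑? Y) [≤]-injective [_] λ _ → refl))

-- Assembly: signs, dimensions and the three statements

open FiniteSums
open MöbiusFunctions
open CoatomOrderings
open Partitions
open IntervalShelling
open BottomShelling
open FiniteDifferences
open LabelledSubsets
open CodeSums
open LowerSums
open MöbiusNumbers
open import Algebra.Apartness.Bundles using (HeytingField)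
open import Data.Fin.Base using (Fin; zero; suc)
open import Data.Integer.Base using (ℤ; +_; -1ℤ) renaming (_*_ to _*ℤ_; _^_ to _^ℤ_)
open import Data.List.Base using ([]; _∷_; map; allFin; sum)
open import Data.List.Relation.Unary.All as LAll using ()
import Data.List.Relation.Unary.All.Properties as LAllₚ
open import Data.Nat.Base using (ℕ; zero; suc; _+_; _*_; _∸_; _^_; _≤_; _!)
import Data.Nat.Base as ℕ
import Data.Nat.Properties as ℕₚ
import Data.Integer.Properties as ℤₚ
open import Data.Product.Base using (_×_; _,_; Σ-syntax; proj₁; proj₂)
open import Data.Empty using (⊥)
open import Data.Sum.Base using (inj₁; inj₂)
import Data.Integer.Base as ℤ
open import Relation.Binary.PropositionalEquality using (_≡_; _≢_; refl; sym; trans; cong; cong₂; subst)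
open import Relation.Nullary using (Dec; yes; no; contradiction)
open import Relation.Nullary.Construct.Add.Infimum using (⊥₋; [_])
import Relation.Binary.Construct.Add.Infimum.NonStrict as AddInfimum

open Sums ℤₚ.+-*-commutativeRing

module _ {c ℓ₁ ℓ₂} (K : HeytingField c ℓ₁ ℓ₂) {p q : ℕ} (x₀ : Fin (p + q)) where

  private
    n = p + q
    SPP = SemiPointedPartition p q

  open FinitePoset (Π p q) using (_<_; _<?_; Minimal; minimals; minimal?; elements)

  rank-1-interval : ∀ {x : SPP} → rank x ≡ 1 → 2 ≤ n → x < singletons
  rank-1-interval {x} rk 2≤n = ≼⇒⊑ {P = x} (≼-top x) , λ x≡top → ℕₚ.<⇒≢ 2≤n (trans (sym rk) (trans (cong rank x≡top) rank-top))

  rank-1-homology : ∀ {x : SPP} → rank x ≡ 1 → (x<top : x < singletons) → let d = dimension K shelling x x<top in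
                    μ (Π p q) x singletons ≡ sgn (n ∸ 1) *ℤ + d ×
                    UniqueNonvanishingDimension K (Π p q) x singletons d
  rank-1-homology {x} rk x<top =
    trans (μ≡dimension K shelling x x<top) (cong (λ k → sgn k *ℤ + d) corank≡) ,
    interval-homology K shelling x x<top (thick⇒dimension≢0 K shelling x x<top shelling-thick)
    where
    d = dimension K shelling x x<top
    k = corank K shelling x x<top
    corank≡ : suc k ≡ n ∸ 1
    corank≡ = cong (_∸ 1) (trans (cong suc (trans (ℕₚ.+-comm 1 k) (cong (λ r → k + r) (sym rk)))) (trans (corank-eq K shelling x x<top) rank-top))

  pointed-intervals : 1 ≤ p →
    (+ ((p ∸ 1) !)) *ℤ Σₗ (allFin p) (λ v → μ (Π p q) (m v) singletons) ≡ sgn (n ∸ 1) *ℤ (+ ((n ∸ 1) ! * n ^ (p ∸ 1)))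
  pointed-intervals 1≤p = trans (cong (λ t → + ((p ∸ 1) !) *ℤ t) (trans (Σμ-pointed {p} {q} singletons)
    (at-top {p} {q} pointedSum))) (pointedSum-value p q 1≤p)

  pointed-homology : 1 ≤ p → 2 ≤ n → Σ[ d ∈ (Fin p → ℕ) ]
    (∀ v → UniqueNonvanishingDimension K (Π p q) (m v) singletons (d v))
    × (p ∸ 1) ! * sum (map d (allFin p)) ≡ (n ∸ 1) ! * n ^ (p ∸ 1)
  pointed-homology 1≤p 2≤n = d , (λ v → proj₂ (homology v)) , cancel-sign (n ∸ 1) ((p ∸ 1) !) (sum (map d (allFin p))) (trans
      (cong (λ t → + ((p ∸ 1) !) *ℤ t) (trans (sym (Σ-signed (n ∸ 1) d (allFin p)))
        (sym (Σₗ-cong (allFin p) λ v → proj₁ (homology v)))))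
      (pointed-intervals 1≤p))
    where
    d : Fin p → ℕ
    d v = dimension K shelling (m v) (rank-1-interval (rank-m v) 2≤n)
    homology = λ v → rank-1-homology (rank-m v) (rank-1-interval (rank-m v) 2≤n)

  bottom-number : 1 ≤ p →
    (+ ((p ∸ 1) !)) *ℤ μ (Π̂ p q) ⊥₋ [ singletons ] ≡ sgn n *ℤ (+ ((n ∸ 1) ! * (n ∸ 1) ^ (p ∸ 1)))
  bottom-number 1≤p = trans (cong (λ t → + ((p ∸ 1) !) *ℤ t) (trans (μ-bottom {p} {q} x₀ singletons)
    (at-top {p} {q} bottomNumber))) (bottomNumber-value p q 1≤p)

  bottom-homology : 1 ≤ p → Σ[ d ∈ ℕ ]
    UniqueNonvanishingDimension K (Π̂ p q) ⊥₋ [ singletons ] d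
    × (p ∸ 1) ! * d ≡ (n ∸ 1) ! * (n ∸ 1) ^ (p ∸ 1)
  bottom-homology 1≤p = d , interval-homology K (shelling₋ x₀) ⊥₋ ⊥<top d≢0 , d-eq
    where
    open AddInfimum (_⊑_ {p} {q}) using (⊥₋≤_)
    ⊥<top : FinitePoset._<_ (Π̂ p q) ⊥₋ [ singletons ]
    ⊥<top = (⊥₋≤ _) , λ ()
    d = dimension K (shelling₋ x₀) ⊥₋ ⊥<top
    k = corank K (shelling₋ x₀) ⊥₋ ⊥<top
    corank≡ : suc k ≡ n
    corank≡ = trans (cong suc (sym (ℕₚ.+-identityʳ k))) (trans (corank-eq K (shelling₋ x₀) ⊥₋ ⊥<top) rank-top)
    d-eq : (p ∸ 1) ! * d ≡ (n ∸ 1) ! * (n ∸ 1) ^ (p ∸ 1)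
    d-eq = cancel-sign n ((p ∸ 1) !) d (trans (cong (λ t → + ((p ∸ 1) !) *ℤ t) (sym (trans (μ≡dimension K (shelling₋ x₀) ⊥₋ ⊥<top)
      (cong (λ j → sgn j *ℤ + d) corank≡)))) (bottom-number 1≤p))
    power≢0 : ∀ a b → (a ≡ 0 → b ≡ 0) → a ^ b ≢ 0
    power≢0 zero    b b≡0 with refl ← b≡0 refl = λ ()
    power≢0 (suc a) b _   = ℕₚ.>⇒≢ (ℕₚ.m^n>0 (suc a) b)
    -- Thickness may fail here: below a partition with two unpointed blocks there is just one
    -- partition, so its interval down to the bottom is a chain. The closed formula is positive
    -- instead, by 0 ^ 0 = 1 if n = 1.
    d≢0 : d ≢ 0
    d≢0 d≡0 = product≢0 (trans (sym d-eq) (trans (cong ((p ∸ 1) ! *_) d≡0) (ℕₚ.*-zeroʳ ((p ∸ 1) !))))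
      where
      product≢0 : (n ∸ 1) ! * (n ∸ 1) ^ (p ∸ 1) ≢ 0
      product≢0 eq with ℕₚ.m*n≡0⇒m≡0∨n≡0 ((n ∸ 1) !) eq
      ... | inj₁ f≡0 = ℕₚ.>⇒≢ (ℕₚ.n≢0⇒n>0 (ℕ.≢-nonZero⁻¹ ((n ∸ 1) !) {{ (n ∸ 1) ℕₚ.!≢0 }})) f≡0
      ... | inj₂ r≡0 = power≢0 (n ∸ 1) (p ∸ 1) (λ n≡0 → ℕₚ.n≤0⇒n≡0 (subst (p ∸ 1 ≤_) n≡0 (ℕₚ.∸-monoˡ-≤ 1 (ℕₚ.m≤m+n p q)))) r≡0

  minimal-intervals :
    (+ (p !)) *ℤ Σₗ minimals (λ x → μ (Π p q) x singletons) ≡ sgn (n ∸ 1) *ℤ (+ ((n ∸ 1) ! * n ^ p))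
  minimal-intervals = trans (cong (λ t → + (p !) *ℤ t) (trans (Σμ-minimal {p} {q} x₀ singletons)
    (at-top {p} {q} minimalSum))) (minimalSum-value p q λ n≡0 → no-point (subst Fin n≡0 x₀))
    where
    no-point : Fin 0 → ⊥
    no-point ()

  minimal-homology : 2 ≤ n → Σ[ d ∈ (SPP → ℕ) ]
    (∀ x → Minimal x → UniqueNonvanishingDimension K (Π p q) x singletons (d x))
    × p ! * sum (map d minimals) ≡ (n ∸ 1) ! * n ^ p
  minimal-homology 2≤n = d , (λ x min → proj₂ (homology x min)) , cancel-sign (n ∸ 1) (p !) (sum (map d minimals)) (trans
      (cong (λ t → + (p !) *ℤ t) (trans (sym (Σ-signed (n ∸ 1) d minimals))
        (sym (go minimals (LAllₚ.all-filter minimal? elements)))))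
      minimal-intervals)
    where
    d′ : ∀ x → Dec (x < singletons) → ℕ
    d′ x (yes x<top) = dimension K shelling x x<top
    -- A default that makes `d` total; for n ≥ 2 every minimal partition lies below `singletons`.
    d′ x (no _)      = 0
    d : SPP → ℕ
    d x = d′ x (x <? singletons)
    homology : ∀ x → Minimal x → μ (Π p q) x singletons ≡ sgn (n ∸ 1) *ℤ + d x ×
               UniqueNonvanishingDimension K (Π p q) x singletons (d x)
    homology x min = by-cases (x <? singletons)
      where
      rk : rank x ≡ 1
      rk = rank-minimal x₀ min
      by-cases : ∀ e → μ (Π p q) x singletons ≡ sgn (n ∸ 1) *ℤ + d′ x e ×
                 UniqueNonvanishingDimension K (Π p q) x singletons (d′ x e)
      by-cases (yes x<top) = rank-1-homology rk x<top
      by-cases (no x≮top)  = contradiction (rank-1-interval rk 2≤n) x≮top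
    go : ∀ xs → LAll.All Minimal xs → Σₗ xs (λ x → μ (Π p q) x singletons) ≡ Σₗ xs (λ x → sgn (n ∸ 1) *ℤ + d x)
    go []       _               = refl
    go (x ∷ xs) (min LAll.∷ ms) = cong₂ (λ s t → s ℤ.+ t) (proj₁ (homology x min)) (go xs ms)

mainTheorem8 : ∀ {c ℓ₁ ℓ₂} (K : HeytingField c ℓ₁ ℓ₂) → CharacteristicZero K →
    ∀ (p q : ℕ) → let n = p + q in (p , q) ≢ (0 , 0) →
    (1 ≤ p →
    (+ ((p ∸ 1) !)) *ℤ sumℤ (map (λ v → μ (Π p q) (m v) singletons) (allFin p))
    ≡ (-1ℤ ^ℤ (n ∸ 1)) *ℤ (+ ((n ∸ 1) ! * n ^ (p ∸ 1)))
    ×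
    (2 ≤ n →
    Σ[ d ∈ (Fin p → ℕ) ]
    (∀ v → UniqueNonvanishingDimension K (Π p q) (m v) singletons (d v))
    × (p ∸ 1) ! * sum (map d (allFin p)) ≡ (n ∸ 1) ! * n ^ (p ∸ 1)))
    ×
    (1 ≤ p →
    (+ ((p ∸ 1) !)) *ℤ μ (Π̂ p q) ⊥₋ [ singletons ]
    ≡ (-1ℤ ^ℤ n) *ℤ (+ ((n ∸ 1) ! * (n ∸ 1) ^ (p ∸ 1)))
    ×
    Σ[ d ∈ ℕ ]
    UniqueNonvanishingDimension K (Π̂ p q) ⊥₋ [ singletons ] d
    × (p ∸ 1) ! * d ≡ (n ∸ 1) ! * (n ∸ 1) ^ (p ∸ 1))
    ×
    ((+ (p !)) *ℤ sumℤ (map (λ x → μ (Π p q) x singletons) (FinitePoset.minimals (Π p q)))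
    ≡ (-1ℤ ^ℤ (n ∸ 1)) *ℤ (+ ((n ∸ 1) ! * n ^ p))
    ×
    (2 ≤ n →
    Σ[ d ∈ (SemiPointedPartition p q → ℕ) ]
    (∀ x → FinitePoset.Minimal (Π p q) x →
    UniqueNonvanishingDimension K (Π p q) x singletons (d x))
    × p ! * sum (map d (FinitePoset.minimals (Π p q))) ≡ (n ∸ 1) ! * n ^ p))
mainTheorem8 K _ p q pq≢0 =
    (λ 1≤p → pointed-intervals K {p} {q} x₀ 1≤p , pointed-homology K {p} {q} x₀ 1≤p)
  , (λ 1≤p → bottom-number K {p} {q} x₀ 1≤p , bottom-homology K {p} {q} x₀ 1≤p)
  , minimal-intervals K {p} {q} x₀ , minimal-homology K {p} {q} x₀
  where
  element : ∀ p q → (p , q) ≢ (0 , 0) → Fin (p + q)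
  element zero    zero    ne = contradiction refl ne
  element zero    (suc q) _  = zero
  element (suc p) q       _  = zero
  x₀ = element p q pq≢0
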